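{- Let $r\geqslant 2$ and $\ell\geqslant 1$ be integers with $\gcd(r,\ell)=1$ or $2$. Set $m=2^r(2^{\ell}+1)$, $d=(m-2)/2$ and $e=\binom{(d-1)/2}{2}$. Then for every positive integer $n$ and every polynomial $f(x)=\sum_{k=0}^{m}a_{m-k}x^k$ with coefficients $a_i\in\mathbb{F}_{2^n}$ such that $a_0\neq 0$ and $a_1\neq 0$, the number of $\alpha\in\overline{\mathbb{F}}_2^{*}$ such that $L_{\alpha}f$ does not have distinct critical values is at most $(5d+4)e$.
   Context: $\overline{\mathbb{F}}_2$ is an algebraic closure of $\mathbb{F}_2$. For nonzero $\alpha\in\overline{\mathbb{F}}_2$, $L_{\alpha}f$ denotes the unique polynomial in $\overline{\mathbb{F}}_2[x]$ of degree at most $d$ such that $(L_{\alpha}f)(x(x+\alpha))=f(x+\alpha)+f(x)$; it has degree exactly $d$ (odd) when $a_1\neq0$. For a polynomial $g=\sum_{k=0}^{d}b_{d-k}x^k$ of odd degree $d$ over $\overline{\mathbb{F}}_2$ with $b_0\neq 0$, write $g'(x)=b_0\prod_{i=1}^{(d-1)/2}(x+\tau_i)^2$ and set $\Pi_d(g)=\prod_{i\neq j}\bigl(g(\tau_i)+g(\tau_j)\bigr)$. The polynomial $g$ is said to have distinct critical values if $\Pi_d(g)\neq 0$ (i.e., the $\tau_i$ are pairwise distinct and the values $g(\tau_i)$ are pairwise distinct). -}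

module Defs where

open import Level using (Level; _⊔_) renaming (suc to lsuc)
open import Data.Nat using (ℕ; zero; suc; _∸_; _≤_; _<_)
import Data.Nat as N
open import Data.Fin using (Fin; toℕ)
import Data.Fin as F
open import Data.List using (List; []; _∷_; allFin; concatMap; foldr)
open import Data.Product using (Σ; ∃; _×_; _,_)
open import Relation.Nullary using (¬_; yes; no)
open import Algebra.Bundles using (CommutativeRing)

module RingOps {c ℓ : Level} (R : CommutativeRing c ℓ) where
  open CommutativeRing R

  infixr 8 _^_
  _^_ : Carrier → ℕ → Carrier
  x ^ zero  = 1#
  x ^ suc k = x * (x ^ k)

  sumTo : ℕ → (ℕ → Carrier) → Carrier
  sumTo zero    t = t 0
  sumTo (suc n) t = sumTo n t + t (suc n)

record AlgClosureF2 (c ℓ : Level) : Set (lsuc (c ⊔ ℓ)) where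
  field
    cring : CommutativeRing c ℓ
  open CommutativeRing cring public
  open RingOps cring public
  field
    1≉0        : ¬ (1# ≈ 0#)
    inverse    : ∀ x → ¬ (x ≈ 0#) → ∃ λ y → x * y ≈ 1#
    char2      : 1# + 1# ≈ 0#
    algClosed  : ∀ (n : ℕ) (c : ℕ → Carrier) → 1 ≤ n → ¬ (c n ≈ 0#) →
                 ∃ λ x → sumTo n (λ k → c k * x ^ k) ≈ 0#
    algebraic  : ∀ x → ∃ λ k → 1 ≤ k × x ^ (2 N.^ k) ≈ x

module Poly {c ℓ : Level} (K : AlgClosureF2 c ℓ) where
  open AlgClosureF2 K

  _·_ : ℕ → Carrier → Carrier
  zero  · x = 0#
  suc k · x = x + (k · x)

  -- The polynomial  Σ_{k=0}^{d} a_{d-k} x^k  (coefficients a₀ … a_d,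
  -- a₀ the leading one, as in the paper), evaluated at x.
  evalP : ℕ → (ℕ → Carrier) → Carrier → Carrier
  evalP d a x = sumTo d (λ k → a (d ∸ k) * x ^ k)

  evalDeriv : ℕ → (ℕ → Carrier) → Carrier → Carrier
  evalDeriv d a x = sumTo d (λ k → (k · a (d ∸ k)) * x ^ (k ∸ 1))

  prod : List Carrier → Carrier
  prod = foldr _*_ 1#

  prodFin : (h : ℕ) → (Fin h → Carrier) → Carrier
  prodFin h t = prod (Data.List.map t (allFin h))

  Pi : (d : ℕ) → (b : ℕ → Carrier) → (τ : Fin (N.⌊ d ∸ 1 /2⌋) → Carrier) → Carrier
  Pi d b τ = prod (concatMap (λ i → concatMap (λ j → pairTerm i j) (allFin h)) (allFin h))
    where
      h = N.⌊ d ∸ 1 /2⌋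
      pairTerm : Fin h → Fin h → List Carrier
      pairTerm i j with i F.≟ j
      ... | yes _ = []
      ... | no  _ = (evalP d b (τ i) + evalP d b (τ j)) ∷ []

  IsCritFactorisation : (d : ℕ) → (b : ℕ → Carrier) → (Fin (N.⌊ d ∸ 1 /2⌋) → Carrier) → Set (c ⊔ ℓ)
  IsCritFactorisation d b τ =
    ∀ x → evalDeriv d b x ≈ b 0 * prodFin (N.⌊ d ∸ 1 /2⌋) (λ i → (x + τ i) ^ 2)

  -- g = Σ_{k=0}^{d} b_{d-k} x^k (d odd, b₀ ≠ 0) has distinct critical values:
  -- Π_d(g) ≠ 0, where the τ_i are the roots in the factorisation of g'.
  -- (The factorisation exists since K is algebraically closed, and is unique
  -- up to reordering, on which Π_d does not depend.)
  HasDistinctCritVals : (d : ℕ) → (b : ℕ → Carrier) → Set (c ⊔ ℓ)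
  HasDistinctCritVals d b =
    ∃ λ τ → IsCritFactorisation d b τ × ¬ (Pi d b τ ≈ 0#)

  IsLalpha : (m d : ℕ) → (a : ℕ → Carrier) → (α : Carrier) → (ℕ → Carrier) → Set (c ⊔ ℓ)
  IsLalpha m d a α c' =
    ∀ x → evalP d c' (x * (x + α)) ≈ evalP m a (x + α) + evalP m a x

  Bad : (m d : ℕ) → (a : ℕ → Carrier) → Carrier → Set (c ⊔ ℓ)
  Bad m d a α = ¬ (α ≈ 0#) ×
    ∃ λ c' → IsLalpha m d a α c' × ¬ HasDistinctCritVals d c'

{-# OPTIONS --safe #-}
module Submission where

-- Put μ = 1/α and t = y/α². In these coordinates L_α f becomes a polynomial G(μ, t) and its
-- t-derivative is, up to a factor, the square of C(μ, t), which is monic of degree h = (d − 1)/2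
-- in t. A bad α yields two roots x, y of C(μ, ·), or a double root, with G(μ, x) = G(μ, y). The
-- functions on the curve of pairs (x, y) are spanned over K[μ] by the h(h − 1) monomials x^b y^c,
-- b < h, c < h − 1, and multiplication by G(μ, x) + G(μ, y) has matrix entries of μ-degree at most
-- w + s_i − s_j, where w = 2d + 1 and s is the weight 2(b + c). Hence its determinant has degree at
-- most h(h − 1)w = (4d + 2)e and vanishes at 1/α for each bad α; instead of the determinant, a
-- nonzero polynomial S with these properties is produced by counting equations and unknowns.
--
-- S is nonzero because the matrix is injective at μ = 0. There C is (u + 1)^d + u^d, t = u² + u,
-- which is separable, and the value at t is a constant times (u^q + u + 1)^(2^r) with q = 2^l.
-- If u and v are critical with equal values, then u + v lies in 𝔽_q, and comparing
-- N(u)^Q = u (u^q + u + 1)^Q, where N(u) = u^(q+1) and Q = 2^(r−1), for u and v forces u^q + u = 0.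
-- Then u and v lie in 𝔽_(2^r) ∩ 𝔽_q ⊆ 𝔽_4, so that u² + u = 1 = v² + v.
--
-- Equality in K is not decidable, so all case distinctions take place under a double negation;
-- the final inequality between natural numbers is decidable.

open import Defs
open import Level using (Level; 0ℓ; _⊔_)
import Data.Nat as N
import Data.Nat.Properties as N
open import Data.Nat using (ℕ; zero; suc; z≤n; s≤s)
open import Data.Nat.Induction using (<-rec)
open import Data.Nat.GCD using (gcd; gcd-GCD; module Bézout)
open import Data.Bool using (Bool; true; false; _xor_; _∧_)
open import Data.Bool.Properties using () renaming (_≟_ to _≟ᵇ_)
open import Data.Fin as F using (Fin; zero; suc; toℕ; fromℕ<)
import Data.Fin.Properties as F
open import Data.Vec.Functional using (insertAt)
open import Data.Vec.Functional.Properties using (insertAt-lookup; insertAt-punchIn)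
open import Data.List using (List; []; _∷_; length; lookup; tabulate; allFin; concatMap)
open import Data.List.Properties using (length-tabulate; map-tabulate)
open import Data.List.Relation.Unary.All as All using (All; []; _∷_)
import Data.List.Relation.Unary.All.Properties as All
open import Data.List.Relation.Unary.AllPairs using (AllPairs; []; _∷_)
import Data.List.Relation.Unary.AllPairs.Properties as AllPairs
import Data.List.Relation.Unary.Any as Any
import Data.List.Relation.Unary.Any.Properties as Any
open import Data.Maybe using (Maybe; just; nothing)
open import Data.Product as Product using (∃; _×_; _,_; proj₁; proj₂; uncurry)
open import Data.Sum as Sum using (_⊎_; inj₁; inj₂)
open import Data.Empty using (⊥)
open import Function using (_∘_; id)
open import Relation.Nullary using (¬_; Dec; yes; no; contradiction)
open import Relation.Nullary.Decidable using (decidable-stable)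
open import Relation.Binary.PropositionalEquality as ≡ using (_≡_; _≢_)
open import Algebra.Bundles using (RawRing)
open import Algebra.Solver.Ring.AlmostCommutativeRing using (_-Raw-AlmostCommutative⟶_; fromCommutativeRing)

-- The fibre μ = 0, that is α = ∞, is chosen because all but one coefficient of f drop out there: G
-- becomes a₀ E_m and C, from which the factor a₁ μ has been divided out, becomes E_d, with E_k the
-- polynomial in u² + u equal to (u + 1)^k + u^k. One computation about x^m thus settles S ≠ 0 for
-- every f at once. The second point y is a root of C divided by t - x rather than of C. On the full
-- product the diagonal would be a component on which G(μ, x) = G(μ, y), and the determinant would
-- vanish identically; after the division a diagonal point (x, x) remains only where x is a double
-- root. The weights come from the degree of E_k in t being below k/2. With μ of weight 1 and t of
-- weight 2, G has weight at most m - 1 = w and C at most d - 1 = 2h, so rewriting t^h by C never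
-- raises the weight. S is found as an element of the ideal of G(μ, x) + G(μ, y): a combination of
-- the rows of the matrix that equals S times the monomial 1. At a collision the left side vanishes,
-- hence so does S.

module Arithmetic where

  -- Degrees, weights and the final count in natural numbers

  open import Data.Nat
  open import Data.Nat.Properties
  open import Data.Nat.Combinatorics using (_C_; nC1≡n; nCk+nC[k+1]≡[n+1]C[k+1])
  open import Data.Nat.Solver using (module +-*-Solver)
  open import Relation.Binary.PropositionalEquality
  open import Data.Product using (∃; _,_)
  open +-*-Solver using (solve; _:=_; _:+_; _:*_; con)

  -- Weights add up: a factor of degree below D - sᵢ times an entry of degree at most w + sᵢ - sⱼ
  -- has degree below (D - sⱼ) + w. Contrapositively, at total degree k with first factor at `a`,
  -- the entry is taken at `k ∸ a`, beyond its degree.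
  product-degree : ∀ {w D sᵢ sⱼ a k} → a ≤ k → sᵢ ≤ D → sⱼ ≤ D → a < D ∸ sᵢ → (D ∸ sⱼ) + w ≤ k →
                   w + sᵢ < (k ∸ a) + sⱼ
  product-degree {w} {D} {sᵢ} {sⱼ} {a} {k} a≤k sᵢ≤D sⱼ≤D a< k≥ = +-cancelˡ-< a _ _ (begin-strict
    a + (w + sᵢ)          ≡⟨ solve 3 (λ a w s → a :+ (w :+ s) := (a :+ s) :+ w) refl a w sᵢ ⟩
    (a + sᵢ) + w          <⟨ +-monoˡ-< w (+-monoˡ-< sᵢ a<) ⟩
    ((D ∸ sᵢ) + sᵢ) + w   ≡⟨ cong (_+ w) (m∸n+n≡m sᵢ≤D) ⟩
    D + w                 ≡⟨ cong (_+ w) (m∸n+n≡m sⱼ≤D) ⟨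
    ((D ∸ sⱼ) + sⱼ) + w   ≡⟨ solve 3 (λ d s w → (d :+ s) :+ w := (d :+ w) :+ s) refl (D ∸ sⱼ) sⱼ w ⟩
    ((D ∸ sⱼ) + w) + sⱼ   ≤⟨ +-monoˡ-≤ sⱼ k≥ ⟩
    k + sⱼ                ≡⟨ cong (_+ sⱼ) (m+[n∸m]≡n a≤k) ⟨
    (a + (k ∸ a)) + sⱼ    ≡⟨ +-assoc a (k ∸ a) sⱼ ⟩
    a + ((k ∸ a) + sⱼ)    ∎)
    where open ≤-Reasoning

  -- The divided difference `hc (suc b)` has degree b, not b + 1. The 2 cancelled here is the weight
  -- so gained, and it keeps the rewriting of y^(h-1) within weight 2(h - 1).
  0<·⇒ : ∀ {k b W} → k + 2 * suc b ≤ 2 + W → k + 2 * b ≤ W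
  0<·⇒ {k} {b} {W} p = +-cancelˡ-≤ 2 _ _ (begin
    2 + (k + 2 * b)  ≡⟨ solve 2 (λ k b → con 2 :+ (k :+ con 2 :* b) := k :+ con 2 :* (con 1 :+ b)) refl k b ⟩
    k + 2 * suc b    ≤⟨ p ⟩
    2 + W            ∎)
    where open ≤-Reasoning

  weight-x : ∀ {a b c W} → a + 2 * (b + c) ≤ W → a + 2 * (suc b + c) ≤ 2 + W
  weight-x {a} {b} {c} {W} p = begin
    a + 2 * (suc b + c)      ≡⟨ solve 3 (λ a b c → a :+ con 2 :* (con 1 :+ b :+ c) := con 2 :+ (a :+ con 2 :* (b :+ c))) refl a b c ⟩
    2 + (a + 2 * (b + c))    ≤⟨ +-monoʳ-≤ 2 p ⟩
    2 + W                    ∎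
    where open ≤-Reasoning

  weight-y : ∀ {a b c W} → a + 2 * (b + c) ≤ W → a + 2 * (b + suc c) ≤ 2 + W
  weight-y {a} {b} {c} {W} p = subst (λ z → a + 2 * z ≤ 2 + W) (sym (+-suc b c)) (weight-x {a} {b} {c} p)

  -- The overflow case: x^(b+1) is traded for μ^k x^b′ of no greater weight, so multiplication by x
  -- still costs only 2.
  weight-x-top : ∀ {a b c W k b′} → a + 2 * (b + c) ≤ W → k + 2 * b′ ≤ 2 * suc b → (k + a) + 2 * (b′ + c) ≤ 2 + W
  weight-x-top {a} {b} {c} {W} {k} {b′} p q = begin
    (k + a) + 2 * (b′ + c)         ≡⟨ solve 4 (λ k a b c → (k :+ a) :+ con 2 :* (b :+ c) := (k :+ con 2 :* b) :+ (a :+ con 2 :* c)) refl k a b′ c ⟩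
    (k + 2 * b′) + (a + 2 * c)     ≤⟨ +-monoˡ-≤ (a + 2 * c) q ⟩
    2 * suc b + (a + 2 * c)        ≡⟨ solve 3 (λ b a c → con 2 :* (con 1 :+ b) :+ (a :+ con 2 :* c) := con 2 :+ (a :+ con 2 :* (b :+ c))) refl b a c ⟩
    2 + (a + 2 * (b + c))          ≤⟨ +-monoʳ-≤ 2 p ⟩
    2 + W                          ∎
    where open ≤-Reasoning

  weight-y-top : ∀ {a b c W} → a + 2 * (b + c) ≤ W → 2 * b + (a + 2 * suc c) ≤ 2 + W
  weight-y-top {a} {b} {c} {W} p = ≤-trans
    (≤-reflexive (solve 3 (λ a b c → con 2 :* b :+ (a :+ con 2 :* (con 1 :+ c)) := con 2 :+ (a :+ con 2 :* (b :+ c))) refl a b c))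
    (+-monoʳ-≤ 2 p)

  2*nC2 : ∀ n → 2 * (suc n C 2) ≡ suc n * n
  2*nC2 zero = refl
  2*nC2 (suc n) = begin
    2 * (suc (suc n) C 2)            ≡⟨ cong (2 *_) (nCk+nC[k+1]≡[n+1]C[k+1] (suc n) 1) ⟨
    2 * ((suc n C 1) + (suc n C 2))  ≡⟨ *-distribˡ-+ 2 (suc n C 1) (suc n C 2) ⟩
    2 * (suc n C 1) + 2 * (suc n C 2) ≡⟨ cong₂ (λ p q → 2 * p + q) (nC1≡n (suc n)) (2*nC2 n) ⟩
    2 * suc n + suc n * n            ≡⟨ solve 1 (λ n → con 2 :* (con 1 :+ n) :+ (con 1 :+ n) :* n := (con 2 :+ n) :* (con 1 :+ n)) refl n ⟩
    suc (suc n) * suc n              ∎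
    where open ≡-Reasoning

  ⌊2*n/2⌋ : ∀ n → ⌊ 2 * n /2⌋ ≡ n
  ⌊2*n/2⌋ n = trans (cong ⌊_/2⌋ (cong (n +_) (+-identityʳ n))) (sym (n≡⌊n+n/2⌋ n))

  count≤bound : ∀ g d → d ≡ suc (2 * suc (suc g)) →
                (suc (suc g) * suc g) * suc (2 * d) ≤ (5 * d + 4) * (⌊ d ∸ 1 /2⌋ C 2)
  count≤bound g d refl = begin
    (suc (suc g) * suc g) * suc (2 * d)   ≡⟨ cong (_* suc (2 * d)) (2*nC2 (suc g)) ⟨
    -- The slack between (4d + 2)e, which the argument yields, and (5d + 4)e.
    (2 * e) * suc (2 * d)                 ≤⟨ m≤m+n _ ((d + 2) * e) ⟩
    (2 * e) * suc (2 * d) + (d + 2) * e   ≡⟨ solve 2 (λ e d → (con 2 :* e) :* (con 1 :+ con 2 :* d) :+ (d :+ con 2) :* e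
                                                 := (con 5 :* d :+ con 4) :* e) refl e d ⟩
    (5 * d + 4) * e                       ≡⟨ cong (λ k → (5 * d + 4) * (k C 2)) (⌊2*n/2⌋ (suc (suc g))) ⟨
    (5 * d + 4) * (⌊ d ∸ 1 /2⌋ C 2)       ∎
    where
    open ≤-Reasoning
    e = suc (suc g) C 2

  -- Applied with r - 2 for r, this gives m = 4(3 + g), hence d = 2(g + 2) + 1 and h = g + 2: d is
  -- odd and there are at least two critical points.
  3≤factor : ∀ r l → 1 ≤ l → ∃ λ g → 2 ^ r * (2 ^ l + 1) ≡ 3 + g
  3≤factor r l 1≤l = _ , sym (m+[n∸m]≡n (begin
    3                    ≤⟨ +-monoˡ-≤ 1 (^-monoʳ-≤ 2 1≤l) ⟩
    2 ^ l + 1            ≤⟨ m≤n*m (2 ^ l + 1) (2 ^ r) {{m^n≢0 2 r}} ⟩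
    2 ^ r * (2 ^ l + 1)  ∎))
    where open ≤-Reasoning

  half-m∸2 : ∀ {m} n → m ≡ 2 * suc n → ⌊ m ∸ 2 /2⌋ ≡ n
  half-m∸2 n refl = trans (cong (λ k → ⌊ k ∸ 2 /2⌋) (*-suc 2 n)) (⌊2*n/2⌋ n)

module CriticalValues {c ℓ : Level} (K : AlgClosureF2 c ℓ) where
  open Arithmetic
  open AlgClosureF2 K hiding (zero)
  open Poly K
  open import Relation.Binary.Reasoning.Setoid setoid
  open import Algebra.Properties.CommutativeMonoid.Sum *-commutativeMonoid
    using () renaming (sum to ∏; sum-remove to ∏-remove; ∑-distrib-+ to ∏-distrib-*)
  open import Algebra.Properties.Semiring.Sum semiring
    using (∑-comm) renaming (sum to ∑; sum-remove to ∑-remove; sum-replicate-zero to ∑-replicate-0;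
                             ∑-distrib-+ to ∑-+; *-distribˡ-sum to *-distribˡ-∑; *-distribʳ-sum to *-distribʳ-∑)

  -- Field arithmetic in characteristic 2

  𝔽₂ : RawRing 0ℓ 0ℓ
  𝔽₂ = record { Carrier = Bool; _≈_ = _≡_; _+_ = _xor_; _*_ = _∧_; -_ = id; 0# = false; 1# = true }

  -‿char2 : ∀ x → - x ≈ x
  -‿char2 x = begin
    - x                  ≈⟨ +-identityʳ _ ⟨
    - x + 0#             ≈⟨ +-congˡ (zeroʳ x) ⟨
    - x + x * 0#         ≈⟨ +-congˡ (*-congˡ char2) ⟨
    - x + x * (1# + 1#)  ≈⟨ +-congˡ (distribˡ x 1# 1#) ⟩
    - x + (x * 1# + x * 1#)  ≈⟨ +-congˡ (+-cong (*-identityʳ x) (*-identityʳ x)) ⟩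
    - x + (x + x)        ≈⟨ +-assoc _ _ _ ⟨
    (- x + x) + x        ≈⟨ +-congʳ (-‿inverseˡ x) ⟩
    0# + x               ≈⟨ +-identityˡ x ⟩
    x                    ∎

  𝔽₂⟶K : 𝔽₂ -Raw-AlmostCommutative⟶ fromCommutativeRing cring
  𝔽₂⟶K = record
    { ⟦_⟧ = ι
    ; +-homo = add
    ; *-homo = mul
    ; -‿homo = λ x → sym (-‿char2 (ι x))
    ; 0-homo = refl
    ; 1-homo = refl
    }
    where
    ι : Bool → Carrier
    ι true = 1#
    ι false = 0#
    add : ∀ x y → ι (x xor y) ≈ ι x + ι y
    add true true = sym char2
    add true false = sym (+-identityʳ 1#)
    add false y = sym (+-identityˡ (ι y))
    mul : ∀ x y → ι (x ∧ y) ≈ ι x * ι y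
    mul true y = sym (*-identityˡ (ι y))
    mul false y = sym (zeroˡ (ι y))

  _≟coeff_ : ∀ x y → Maybe (_-Raw-AlmostCommutative⟶_.⟦_⟧ 𝔽₂⟶K x ≈ _-Raw-AlmostCommutative⟶_.⟦_⟧ 𝔽₂⟶K y)
  x ≟coeff y with x ≟ᵇ y
  ... | yes ≡.refl = just refl
  ... | no _ = nothing

  -- The coefficients lie in 𝔽₂, so the solver also normalises x + x to 0.
  open import Algebra.Solver.Ring 𝔽₂ (fromCommutativeRing cring) 𝔽₂⟶K _≟coeff_
    using (solve; _:=_; _:+_; _:*_; con; Polynomial)

  :0 :1 : ∀ {n} → Polynomial n
  :0 = con false
  :1 = con true

  x+x≈0 : ∀ x → x + x ≈ 0#
  x+x≈0 = solve 1 (λ x → x :+ x := :0) refl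

  +-cancel-0 : ∀ {x y} → x + y ≈ 0# → x ≈ y
  +-cancel-0 {x} {y} e = begin
    x           ≈⟨ solve 2 (λ x y → x := (x :+ y) :+ y) refl x y ⟩
    (x + y) + y ≈⟨ +-congʳ e ⟩
    0# + y      ≈⟨ +-identityˡ y ⟩
    y           ∎

  ≈⇒+≈0 : ∀ {x y} → x ≈ y → x + y ≈ 0#
  ≈⇒+≈0 {x} {y} e = trans (+-congʳ e) (x+x≈0 y)

  *-cancelˡ-0 : ∀ {x y} → ¬ x ≈ 0# → x * y ≈ 0# → y ≈ 0#
  *-cancelˡ-0 {x} {y} x≉0 e with inverse x x≉0
  ... | x⁻¹ , inv = begin
    y              ≈⟨ *-identityˡ y ⟨
    1# * y         ≈⟨ *-congʳ inv ⟨
    (x * x⁻¹) * y  ≈⟨ solve 3 (λ x i y → (x :* i) :* y := i :* (x :* y)) refl x x⁻¹ y ⟩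
    x⁻¹ * (x * y)  ≈⟨ *-congˡ e ⟩
    x⁻¹ * 0#       ≈⟨ zeroʳ _ ⟩
    0#             ∎

  *-cancelˡ : ∀ {x y z} → ¬ x ≈ 0# → x * y ≈ x * z → y ≈ z
  *-cancelˡ {x} {y} {z} x≉0 e = +-cancel-0 (*-cancelˡ-0 x≉0 (trans (distribˡ x y z) (≈⇒+≈0 e)))

  *-≉0 : ∀ {x y} → ¬ x ≈ 0# → ¬ y ≈ 0# → ¬ x * y ≈ 0#
  *-≉0 x≉0 y≉0 e = y≉0 (*-cancelˡ-0 x≉0 e)

  -- Powers and the Frobenius map

  ^-cong : ∀ {x y} k → x ≈ y → x ^ k ≈ y ^ k
  ^-cong zero e = refl
  ^-cong (suc k) e = *-cong e (^-cong k e)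

  ^-cong-≡ : ∀ x {j k} → j ≡ k → x ^ j ≈ x ^ k
  ^-cong-≡ x ≡.refl = refl

  ^-+ : ∀ x j k → x ^ (j N.+ k) ≈ x ^ j * x ^ k
  ^-+ x zero k = sym (*-identityˡ _)
  ^-+ x (suc j) k = trans (*-congˡ (^-+ x j k)) (sym (*-assoc _ _ _))

  1^ : ∀ k → 1# ^ k ≈ 1#
  1^ zero = refl
  1^ (suc k) = trans (*-identityˡ _) (1^ k)

  ^-distrib-* : ∀ x y k → (x * y) ^ k ≈ x ^ k * y ^ k
  ^-distrib-* x y zero = sym (*-identityˡ 1#)
  ^-distrib-* x y (suc k) = trans (*-congˡ (^-distrib-* x y k))
    (solve 4 (λ x y p q → (x :* y) :* (p :* q) := (x :* p) :* (y :* q)) refl x y (x ^ k) (y ^ k))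

  ^-^ : ∀ x j k → (x ^ j) ^ k ≈ x ^ (j N.* k)
  ^-^ x zero k = 1^ k
  ^-^ x (suc j) k = begin
    (x * x ^ j) ^ k       ≈⟨ ^-distrib-* x (x ^ j) k ⟩
    x ^ k * (x ^ j) ^ k   ≈⟨ *-congˡ (^-^ x j k) ⟩
    x ^ k * x ^ (j N.* k) ≈⟨ ^-+ x k _ ⟨
    x ^ (k N.+ j N.* k)   ∎

  ^-≉0 : ∀ {x} k → ¬ x ≈ 0# → ¬ x ^ k ≈ 0#
  ^-≉0 zero x≉0 = 1≉0
  ^-≉0 (suc k) x≉0 = *-≉0 x≉0 (^-≉0 k x≉0)

  0^ : ∀ k → 1 N.≤ k → 0# ^ k ≈ 0#
  0^ (suc k) _ = zeroˡ _

  ^2≈* : ∀ x → x ^ 2 ≈ x * x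
  ^2≈* x = *-congˡ (*-identityʳ x)

  frob : ∀ k x y → (x + y) ^ (2 N.^ k) ≈ x ^ (2 N.^ k) + y ^ (2 N.^ k)
  frob zero x y = solve 2 (λ x y → (x :+ y) :* :1 := x :* :1 :+ y :* :1) refl x y
  frob (suc k) x y = begin
    (x + y) ^ (2 N.* q)                    ≈⟨ dbl (x + y) ⟩
    (x + y) ^ q * (x + y) ^ q              ≈⟨ *-cong (frob k x y) (frob k x y) ⟩
    (x ^ q + y ^ q) * (x ^ q + y ^ q)      ≈⟨ solve 2 (λ a b → (a :+ b) :* (a :+ b) := a :* a :+ b :* b) refl _ _ ⟩
    x ^ q * x ^ q + y ^ q * y ^ q          ≈⟨ +-cong (dbl x) (dbl y) ⟨
    x ^ (2 N.* q) + y ^ (2 N.* q)          ∎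
    where
    q = 2 N.^ k
    dbl : ∀ x → x ^ (2 N.* q) ≈ x ^ q * x ^ q
    dbl x = trans (^-cong-≡ x (≡.cong (q N.+_) (N.+-identityʳ q))) (^-+ x q q)

  -- By `algebraic`, x is fixed by some iterate of Frobenius; stopping one squaring earlier gives
  -- the root.
  sqrt : ∀ x → ∃ λ y → y * y ≈ x
  sqrt x with algebraic x
  ... | suc k , _ , e = x ^ (2 N.^ k) , trans (sym (trans (^-cong-≡ x (≡.cong (2 N.^ k N.+_) (N.+-identityʳ _))) (^-+ x (2 N.^ k) _))) e

  -- Finite sums

  sum-cong≤ : ∀ n {f g : ℕ → Carrier} → (∀ k → k N.≤ n → f k ≈ g k) → sumTo n f ≈ sumTo n g
  sum-cong≤ zero e = e 0 z≤n
  sum-cong≤ (suc n) e = +-cong (sum-cong≤ n (λ k k≤n → e k (N.m≤n⇒m≤1+n k≤n))) (e (suc n) N.≤-refl)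

  sum-cong : ∀ n {f g : ℕ → Carrier} → (∀ k → f k ≈ g k) → sumTo n f ≈ sumTo n g
  sum-cong n e = sum-cong≤ n (λ k _ → e k)

  sum-0 : ∀ n {f : ℕ → Carrier} → (∀ k → k N.≤ n → f k ≈ 0#) → sumTo n f ≈ 0#
  sum-0 zero e = e 0 z≤n
  sum-0 (suc n) e = trans (+-cong (sum-0 n (λ k k≤n → e k (N.m≤n⇒m≤1+n k≤n))) (e (suc n) N.≤-refl)) (+-identityˡ 0#)

  sum-+ : ∀ n (f g : ℕ → Carrier) → sumTo n (λ k → f k + g k) ≈ sumTo n f + sumTo n g
  sum-+ zero f g = refl
  sum-+ (suc n) f g = trans (+-congʳ (sum-+ n f g))
    (solve 4 (λ a b p q → (a :+ b) :+ (p :+ q) := (a :+ p) :+ (b :+ q)) refl _ _ _ _)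

  sum-*ˡ : ∀ n x (f : ℕ → Carrier) → sumTo n (λ k → x * f k) ≈ x * sumTo n f
  sum-*ˡ zero x f = refl
  sum-*ˡ (suc n) x f = trans (+-congʳ (sum-*ˡ n x f)) (sym (distribˡ _ _ _))

  sum-*ʳ : ∀ n x (f : ℕ → Carrier) → sumTo n (λ k → f k * x) ≈ sumTo n f * x
  sum-*ʳ n x f = trans (sum-cong n (λ k → *-comm _ _)) (trans (sum-*ˡ n x f) (*-comm _ _))

  sum-head : ∀ n (f : ℕ → Carrier) → sumTo (suc n) f ≈ f 0 + sumTo n (f ∘ suc)
  sum-head zero f = refl
  sum-head (suc n) f = trans (+-congʳ (sum-head n f)) (+-assoc _ _ _)

  sum-comm : ∀ m n (f : ℕ → ℕ → Carrier) → sumTo m (λ i → sumTo n (f i)) ≈ sumTo n (λ j → sumTo m (λ i → f i j))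
  sum-comm zero n f = refl
  sum-comm (suc m) n f = trans (+-congʳ (sum-comm m n f)) (sym (sum-+ n _ _))

  sum-extend : ∀ {n m} (f : ℕ → Carrier) → n N.≤ m → (∀ k → n N.< k → f k ≈ 0#) → sumTo m f ≈ sumTo n f
  sum-extend {n} f n≤m e with N.m≤n⇒m<n∨m≡n n≤m
  ... | inj₂ ≡.refl = refl
  sum-extend {n} {suc m} f n≤m e | inj₁ (s≤s n≤m′) =
    trans (+-cong (sum-extend f n≤m′ e) (e (suc m) (s≤s n≤m′))) (+-identityʳ _)

  sum-single : ∀ n (f : ℕ → Carrier) {j} → j N.≤ n → (∀ k → k ≢ j → f k ≈ 0#) → sumTo n f ≈ f j
  sum-single zero f {zero} _ e = refl
  sum-single (suc n) f {zero} _ e = trans (sum-head n f) (trans (+-congˡ (sum-0 n (λ k _ → e (suc k) (λ ())))) (+-identityʳ _))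
  sum-single (suc n) f {suc j} (s≤s j≤n) e = trans (sum-head n f)
    (trans (+-cong (e 0 (λ ())) (sum-single n (f ∘ suc) j≤n (λ k k≢j → e (suc k) (k≢j ∘ N.suc-injective)))) (+-identityˡ _))

  sum-square : ∀ n (f : ℕ → Carrier) → sumTo n (λ k → f k * f k) ≈ sumTo n f * sumTo n f
  sum-square zero f = refl
  sum-square (suc n) f = trans (+-congʳ (sum-square n f)) (solve 2 (λ a b → a :* a :+ b :* b := (a :+ b) :* (a :+ b)) refl _ _)

  -- Polynomials as coefficient sequences

  ∏-cong : ∀ n (f g : Fin n → Carrier) → (∀ i → f i ≈ g i) → ∏ f ≈ ∏ g
  ∏-cong zero f g e = refl
  ∏-cong (suc n) f g e = *-cong (e zero) (∏-cong n (f ∘ suc) (g ∘ suc) (e ∘ suc))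

  -- Coefficients ascend here, whereas `evalP` lists them from the leading one; hence the indices
  -- `d ∸ b` when the two meet.
  ev : ℕ → (ℕ → Carrier) → Carrier → Carrier
  ev n p x = sumTo n (λ k → p k * x ^ k)

  ev-cong : ∀ n {p q} x → (∀ k → k N.≤ n → p k ≈ q k) → ev n p x ≈ ev n q x
  ev-cong n x e = sum-cong≤ n (λ k k≤n → *-congʳ (e k k≤n))

  ev-head : ∀ n p x → ev (suc n) p x ≈ p 0 + x * ev n (p ∘ suc) x
  ev-head n p x = begin
    ev (suc n) p x                                      ≈⟨ sum-head n _ ⟩
    p 0 * 1# + sumTo n (λ k → p (suc k) * (x * x ^ k))  ≈⟨ +-cong (*-identityʳ _) (sum-cong n (λ k →
        solve 3 (λ p x y → p :* (x :* y) := x :* (p :* y)) refl _ _ _)) ⟩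
    p 0 + sumTo n (λ k → x * (p (suc k) * x ^ k))       ≈⟨ +-congˡ (sum-*ˡ n x _) ⟩
    p 0 + x * ev n (p ∘ suc) x                          ∎

  ev-at-0 : ∀ n p → ev n p 0# ≈ p 0
  ev-at-0 zero p = *-identityʳ _
  ev-at-0 (suc n) p = trans (ev-head n p 0#) (trans (+-congˡ (zeroˡ _)) (+-identityʳ _))

  ev-+ : ∀ n p q x → ev n (λ k → p k + q k) x ≈ ev n p x + ev n q x
  ev-+ n p q x = trans (sum-cong n (λ k → distribʳ _ _ _)) (sum-+ n _ _)

  ev-*ˡ : ∀ n a p x → ev n (λ k → a * p k) x ≈ a * ev n p x
  ev-*ˡ n a p x = trans (sum-cong n (λ k → *-assoc _ _ _)) (sum-*ˡ n a _)

  ev-extend : ∀ {n m} p x → n N.≤ m → (∀ k → n N.< k → p k ≈ 0#) → ev m p x ≈ ev n p x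
  ev-extend p x n≤m e = sum-extend _ n≤m (λ k n<k → trans (*-congʳ (e k n<k)) (zeroˡ _))

  -- Synthetic division: the coefficients of (p(t) - p(x)) / (t - x) for p of degree at most n + 1.
  quot : ℕ → (ℕ → Carrier) → Carrier → ℕ → Carrier
  quot n p x k = ev (n N.∸ k) (λ j → p (suc k N.+ j)) x

  quot-last : ∀ n p x → quot n p x n ≈ p (suc n)
  quot-last n p x = begin
    ev (n N.∸ n) (λ j → p (suc n N.+ j)) x  ≡⟨ ≡.cong (λ z → ev z (λ j → p (suc n N.+ j)) x) (N.n∸n≡0 n) ⟩
    p (suc n N.+ 0) * 1#                    ≈⟨ *-identityʳ _ ⟩
    p (suc n N.+ 0)                         ≡⟨ ≡.cong p (N.+-identityʳ (suc n)) ⟩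
    p (suc n)                               ∎

  quot-rec : ∀ n p x k → k N.< n → quot n p x k ≈ p (suc k) + x * quot n p x (suc k)
  quot-rec (suc n) p x k (s≤s k≤n) = begin
    ev (suc n N.∸ k) (λ j → p (suc k N.+ j)) x     ≡⟨ ≡.cong (λ z → ev z (λ j → p (suc k N.+ j)) x) (N.+-∸-assoc 1 k≤n) ⟩
    ev (suc (n N.∸ k)) (λ j → p (suc k N.+ j)) x   ≈⟨ ev-head (n N.∸ k) _ x ⟩
    p (suc k N.+ 0) + x * ev (n N.∸ k) (λ j → p (suc k N.+ suc j)) x
      ≈⟨ +-cong (reflexive (≡.cong p (N.+-identityʳ (suc k))))
           (*-congˡ (ev-cong (n N.∸ k) x (λ j _ → reflexive (≡.cong p (N.+-suc (suc k) j))))) ⟩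
    p (suc k) + x * quot (suc n) p x (suc k)       ∎

  quot-spec : ∀ n p x t → (t + x) * ev n (quot n p x) t ≈ ev (suc n) p t + ev (suc n) p x
  quot-spec zero p x t = solve 4 (λ p0 p1 x t → (t :+ x) :* ((p1 :* :1) :* :1) :=
    (p0 :* :1 :+ p1 :* (t :* :1)) :+ (p0 :* :1 :+ p1 :* (x :* :1))) refl _ _ _ _
  quot-spec (suc n) p x t = begin
    (t + x) * ev (suc n) (quot (suc n) p x) t     ≈⟨ *-congˡ (ev-head n _ t) ⟩
    (t + x) * (q₀ + t * q′)                       ≈⟨ solve 4 (λ t x q q′ → (t :+ x) :* (q :+ t :* q′) := (t :+ x) :* q :+ t :* ((t :+ x) :* q′)) refl t x q₀ q′ ⟩
    (t + x) * q₀ + t * ((t + x) * q′)             ≈⟨ +-congˡ (*-congˡ (quot-spec n (p ∘ suc) x t)) ⟩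
    (t + x) * q₀ + t * (ev (suc n) (p ∘ suc) t + q₀)
      ≈⟨ solve 5 (λ t x q e p → (t :+ x) :* q :+ t :* (e :+ q) := (p :+ t :* e) :+ (p :+ x :* q)) refl t x q₀ (ev (suc n) (p ∘ suc) t) (p 0) ⟩
    (p 0 + t * ev (suc n) (p ∘ suc) t) + (p 0 + x * q₀) ≈⟨ +-cong (ev-head (suc n) p t) (ev-head (suc n) p x) ⟨
    ev (suc (suc n)) p t + ev (suc (suc n)) p x   ∎
    where
    q₀ = ev (suc n) (p ∘ suc) x
    q′ = ev n (quot n (p ∘ suc) x) t

  Distinct : List Carrier → Set (c ⊔ ℓ)
  Distinct = AllPairs (λ x y → ¬ x ≈ y)

  -- Dividing by t + x uses up one root, and the others remain roots of the quotient because t + x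
  -- does not vanish there. The coefficients of p are then read off from those of the quotient.
  many-roots⇒0 : ∀ n p xs → Distinct xs → All (λ x → ev n p x ≈ 0#) xs → n N.< length xs →
                 ∀ k → k N.≤ n → p k ≈ 0#
  many-roots⇒0 zero p (x ∷ xs) _ (r ∷ _) _ zero _ = trans (sym (*-identityʳ _)) r
  many-roots⇒0 (suc n) p (x ∷ xs) (x≉ ∷ dist) (r ∷ rs) (s≤s n<) = p≈0
    where
    q = quot n p x
    q≈0 : ∀ k → k N.≤ n → q k ≈ 0#
    q≈0 = many-roots⇒0 n q xs dist
      (All.zipWith (λ {y} (x≉y , ry) → *-cancelˡ-0 (λ e → x≉y (sym (+-cancel-0 e)))
        (trans (quot-spec n p x y) (trans (+-cong ry r) (+-identityˡ 0#)))) (x≉ , rs)) n<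
    p≈0 : ∀ k → k N.≤ suc n → p k ≈ 0#
    p≈0 zero _ = begin
      p 0                  ≈⟨ +-identityʳ _ ⟨
      p 0 + 0#             ≈⟨ +-congˡ (trans (*-congˡ (q≈0 0 z≤n)) (zeroʳ x)) ⟨
      p 0 + x * q 0        ≈⟨ ev-head n p x ⟨
      ev (suc n) p x       ≈⟨ r ⟩
      0#                   ∎
    p≈0 (suc k) (s≤s k≤n) with N.m≤n⇒m<n∨m≡n k≤n
    ... | inj₂ ≡.refl = trans (sym (quot-last n p x)) (q≈0 n N.≤-refl)
    ... | inj₁ k<n = begin
      p (suc k)                  ≈⟨ +-identityʳ _ ⟨
      p (suc k) + 0#             ≈⟨ +-congˡ (trans (*-congˡ (q≈0 (suc k) k<n)) (zeroʳ x)) ⟨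
      p (suc k) + x * q (suc k)  ≈⟨ quot-rec n p x k k<n ⟨
      q k                        ≈⟨ q≈0 k k≤n ⟩
      0#                         ∎

  many-roots⇒0-Fin : ∀ n p (r : Fin (suc n) → Carrier) → (∀ i j → i ≢ j → ¬ r i ≈ r j) →
                     (∀ i → ev n p (r i) ≈ 0#) → ∀ k → k N.≤ n → p k ≈ 0#
  many-roots⇒0-Fin n p r dist rs = many-roots⇒0 n p (tabulate r)
    (AllPairs.tabulate⁺ (λ i≢j → dist _ _ i≢j)) (All.tabulate⁺ rs)
    (N.≤-reflexive (≡.sym (length-tabulate r)))

  lin : Carrier → (ℕ → Carrier) → ℕ → Carrier
  lin x q zero = x * q 0
  lin x q (suc k) = q k + x * q (suc k)

  lin-spec : ∀ n x q t → q (suc n) ≈ 0# → ev (suc n) (lin x q) t ≈ (t + x) * ev n q t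
  lin-spec n x q t e = begin
    ev (suc n) (lin x q) t                              ≈⟨ ev-head n _ t ⟩
    x * q 0 + t * ev n (λ k → q k + x * q (suc k)) t    ≈⟨ +-congˡ (*-congˡ (trans (ev-+ n _ _ t) (+-congˡ (ev-*ˡ n x _ t)))) ⟩
    x * q 0 + t * (ev n q t + x * ev n (q ∘ suc) t)     ≈⟨ solve 5 (λ x q t a b → x :* q :+ t :* (a :+ x :* b) := t :* a :+ x :* (q :+ t :* b)) refl _ _ _ _ _ ⟩
    t * ev n q t + x * (q 0 + t * ev n (q ∘ suc) t)     ≈⟨ +-congˡ (*-congˡ (trans (sym (ev-head n q t)) (trans (+-congˡ (trans (*-congʳ e) (zeroˡ _))) (+-identityʳ _)))) ⟩
    t * ev n q t + x * ev n q t                         ≈⟨ distribʳ _ _ _ ⟨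
    (t + x) * ev n q t                                  ∎

  ∏-coefficients : ∀ n (θ : Fin n → Carrier) →
    ∃ λ p → p n ≈ 1# × (∀ k → n N.< k → p k ≈ 0#) × (∀ t → ∏ (λ i → t + θ i) ≈ ev n p t)
  ∏-coefficients zero θ = p , refl , (λ { (suc k) _ → refl }) , λ t → sym (*-identityˡ 1#)
    where
    p : ℕ → Carrier
    p zero = 1#
    p (suc k) = 0#
  ∏-coefficients (suc n) θ with ∏-coefficients n (θ ∘ suc)
  ... | q , lead , bound , e = lin (θ zero) q
    , trans (+-cong lead (trans (*-congˡ (bound (suc n) N.≤-refl)) (zeroʳ _))) (+-identityʳ _)
    , (λ { (suc k) (s≤s n<k) → trans (+-cong (bound k n<k) (trans (*-congˡ (bound (suc k) (N.m≤n⇒m≤1+n n<k))) (zeroʳ _))) (+-identityʳ _) })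
    , λ t → trans (*-congˡ (e t)) (sym (lin-spec n (θ zero) q t (bound (suc n) N.≤-refl)))

  addConst : Carrier → (ℕ → Carrier) → ℕ → Carrier
  addConst a p zero = a + p 0
  addConst a p (suc k) = p (suc k)

  ev-addConst : ∀ n a p x → ev (suc n) (addConst a p) x ≈ a + ev (suc n) p x
  ev-addConst n a p x = begin
    ev (suc n) (addConst a p) x            ≈⟨ ev-head n (addConst a p) x ⟩
    (a + p 0) + x * ev n (p ∘ suc) x       ≈⟨ +-assoc _ _ _ ⟩
    a + (p 0 + x * ev n (p ∘ suc) x)       ≈⟨ +-congˡ (ev-head n p x) ⟨
    a + ev (suc n) p x                     ∎

  -- Euclid's trick: a root of 1 + ∏ (t + θᵢ) differs from every θᵢ. It shows K infinite without any
  -- search, which undecidable equality would forbid.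
  fresh : ∀ n (θ : Fin (suc n) → Carrier) → ∃ λ x → ∀ i → ¬ x ≈ θ i
  fresh n θ = from (∏-coefficients (suc n) θ)
    where
    from : (∃ λ p → p (suc n) ≈ 1# × (∀ k → suc n N.< k → p k ≈ 0#) × (∀ t → ∏ (λ i → t + θ i) ≈ ev (suc n) p t)) →
           ∃ λ x → ∀ i → ¬ x ≈ θ i
    from (p , lead , _ , e) = x , avoids
      where
      rooted = algClosed (suc n) (addConst 1# p) (s≤s z≤n) (λ z → 1≉0 (trans (sym lead) z))
      x = proj₁ rooted
      avoids : ∀ i → ¬ x ≈ θ i
      avoids i x≈θi = 1≉0 (begin
        1#                            ≈⟨ +-identityʳ _ ⟨
        1# + 0#                       ≈⟨ +-congˡ (trans (*-congʳ (≈⇒+≈0 x≈θi)) (zeroˡ (∏ (λ k → x + θ (F.punchIn i k))))) ⟨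
        1# + (x + θ i) * ∏ (λ k → x + θ (F.punchIn i k)) ≈⟨ +-congˡ (∏-remove {i = i} (λ i → x + θ i)) ⟨
        1# + ∏ (λ i → x + θ i)        ≈⟨ +-congˡ (e x) ⟩
        1# + ev (suc n) p x           ≈⟨ ev-addConst n 1# p x ⟨
        ev (suc n) (addConst 1# p) x  ≈⟨ proj₂ rooted ⟩
        0#                            ∎)

  distinct-points : ∀ x n → ∃ λ (xs : List Carrier) → length xs ≡ n × Distinct xs × All (λ y → ¬ y ≈ x) xs
  distinct-points x zero = [] , ≡.refl , [] , []
  distinct-points x (suc n) = extend (distinct-points x n)
    where
    extend : (∃ λ (xs : List Carrier) → length xs ≡ n × Distinct xs × All (λ y → ¬ y ≈ x) xs) →
             ∃ λ (xs : List Carrier) → length xs ≡ suc n × Distinct xs × All (λ y → ¬ y ≈ x) xs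
    extend (xs , len , dist , ≉x) =
      y ∷ xs , ≡.cong suc len , All.tabulate (λ {z} z∈ e → proj₂ new (suc (Any.index z∈)) (trans e (reflexive (Any.lookup-index z∈)))) ∷ dist ,
      proj₂ new zero ∷ ≉x
      where
      old : Fin (suc (length xs)) → Carrier
      old zero = x
      old (suc i) = lookup xs i
      new = fresh (length xs) old
      y = proj₁ new

  vanishing-off⇒0 : ∀ n p x → (∀ t → ¬ t ≈ x → ev n p t ≈ 0#) → ∀ k → k N.≤ n → p k ≈ 0#
  vanishing-off⇒0 n p x e = many-roots⇒0 n p (proj₁ pts) (proj₁ (proj₂ (proj₂ pts)))
    (All.map (e _) (proj₂ (proj₂ (proj₂ pts)))) (N.≤-reflexive (≡.sym (proj₁ (proj₂ pts))))
    where
    pts = distinct-points x (suc n)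

  -- One point is excepted because the identities to be compared arise by cancelling t + x, which is
  -- possible only away from x.
  agreeing-off⇒≈ : ∀ n p q x → (∀ t → ¬ t ≈ x → ev n p t ≈ ev n q t) → ∀ k → k N.≤ n → p k ≈ q k
  agreeing-off⇒≈ n p q x e k k≤n = +-cancel-0 (vanishing-off⇒0 n (λ k → p k + q k) x
    (λ t t≉x → trans (ev-+ n p q t) (≈⇒+≈0 (e t t≉x))) k k≤n)

  agreeing⇒≈ : ∀ n p q → (∀ t → ev n p t ≈ ev n q t) → ∀ k → k N.≤ n → p k ≈ q k
  agreeing⇒≈ n p q e = agreeing-off⇒≈ n p q 0# (λ t _ → e t)

  factor : ∀ n p → p n ≈ 1# → ∃ λ (θ : Fin n → Carrier) → ∀ t → ev n p t ≈ ∏ (λ i → t + θ i)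
  factor zero p lead = (λ ()) , λ t → trans (*-identityʳ _) lead
  factor (suc n) p lead = θ , λ t → begin
    ev (suc n) p t                        ≈⟨ +-identityʳ _ ⟨
    ev (suc n) p t + 0#                   ≈⟨ +-congˡ (proj₂ root) ⟨
    ev (suc n) p t + ev (suc n) p x       ≈⟨ quot-spec n p x t ⟨
    (t + x) * ev n (quot n p x) t         ≈⟨ *-congˡ (proj₂ rest t) ⟩
    (t + x) * ∏ (λ i → t + proj₁ rest i)  ∎
    where
    root = algClosed (suc n) p (s≤s z≤n) (λ z → 1≉0 (trans (sym lead) z))
    x = proj₁ root
    rest = factor n (quot n p x) (trans (quot-last n p x) lead)
    θ : Fin (suc n) → Carrier
    θ zero = x
    θ (suc i) = proj₁ rest i

  -- hc k x y is (x^k − y^k) / (x − y).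
  hc : ℕ → Carrier → Carrier → Carrier
  hc zero x y = 0#
  hc (suc k) x y = x * hc k x y + y ^ k

  -- The divided difference (p(x) - p(y)) / (x - y) in polynomial form, meaningful for x = y too.
  dd : ℕ → (ℕ → Carrier) → Carrier → Carrier → Carrier
  dd n p x y = sumTo n (λ k → p k * hc k x y)

  dd≈quot : ∀ n p x y → dd (suc n) p x y ≈ ev n (quot n p y) x
  dd≈quot zero p x y = solve 3 (λ a b x → a :* :0 :+ b :* (x :* :0 :+ :1) := (b :* :1) :* :1) refl _ _ x
  dd≈quot (suc n) p x y = begin
    dd (suc (suc n)) p x y                                        ≈⟨ sum-head (suc n) _ ⟩
    p 0 * 0# + sumTo (suc n) (λ k → p (suc k) * (x * hc k x y + y ^ k))
      ≈⟨ trans (+-congʳ (zeroʳ _)) (+-identityˡ _) ⟩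
    sumTo (suc n) (λ k → p (suc k) * (x * hc k x y + y ^ k))      ≈⟨ sum-cong (suc n) (λ k →
        solve 4 (λ p x h y → p :* (x :* h :+ y) := p :* y :+ x :* (p :* h)) refl _ _ _ _) ⟩
    sumTo (suc n) (λ k → p (suc k) * y ^ k + x * (p (suc k) * hc k x y))   ≈⟨ trans (sum-+ (suc n) _ _) (+-congˡ (sum-*ˡ (suc n) x _)) ⟩
    ev (suc n) (p ∘ suc) y + x * dd (suc n) (p ∘ suc) x y         ≈⟨ +-congˡ (*-congˡ (dd≈quot n (p ∘ suc) x y)) ⟩
    ev (suc n) (p ∘ suc) y + x * ev n (quot n (p ∘ suc) y) x      ≈⟨ ev-head n _ x ⟨
    ev (suc n) (quot (suc n) p y) x                               ∎

  ·-*ˡ : ∀ k x y → k · (x * y) ≈ x * (k · y)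
  ·-*ˡ zero x y = sym (zeroʳ x)
  ·-*ˡ (suc k) x y = trans (+-congˡ (·-*ˡ k x y)) (sym (distribˡ _ _ _))

  ·-cong : ∀ k {x y} → x ≈ y → k · x ≈ k · y
  ·-cong zero e = refl
  ·-cong (suc k) e = +-cong e (·-cong k e)

  ·-*ʳ : ∀ k x y → (k · x) * y ≈ k · (x * y)
  ·-*ʳ k x y = trans (*-comm _ _) (trans (sym (·-*ˡ k y x)) (·-cong k (*-comm y x)))

  der : ℕ → (ℕ → Carrier) → Carrier → Carrier
  der n p x = sumTo n (λ k → (k · p k) * x ^ (k N.∸ 1))

  hc-diag : ∀ k x → hc k x x ≈ k · (x ^ (k N.∸ 1))
  hc-diag zero x = refl
  hc-diag (suc zero) x = solve 1 (λ x → x :* :0 :+ :1 := :1 :+ :0) refl x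
  hc-diag (suc (suc k)) x = begin
    x * hc (suc k) x x + x ^ suc k     ≈⟨ +-congʳ (*-congˡ (hc-diag (suc k) x)) ⟩
    x * (suc k · (x ^ k)) + x ^ suc k    ≈⟨ +-congʳ (·-*ˡ (suc k) x (x ^ k)) ⟨
    suc k · (x ^ suc k) + x ^ suc k      ≈⟨ +-comm _ _ ⟩
    suc (suc k) · (x ^ suc k)          ∎

  hc-cong : ∀ k {x y u v} → x ≈ u → y ≈ v → hc k x y ≈ hc k u v
  hc-cong zero e f = refl
  hc-cong (suc k) e f = +-cong (*-cong e (hc-cong k e f)) (^-cong k f)

  dd-diag : ∀ n p x → dd n p x x ≈ der n p x
  dd-diag n p x = sum-cong n (λ k → trans (*-congˡ (hc-diag k x))
    (trans (sym (·-*ˡ k (p k) _)) (sym (·-*ʳ k (p k) _))))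

  -- A repeated root is included: there the divided difference is the derivative.
  factor-roots : ∀ n p (θ : Fin n → Carrier) → (∀ t → ev n p t ≈ ∏ (λ i → t + θ i)) →
                 ∀ i j → i ≢ j → ev n p (θ i) ≈ 0# × dd n p (θ i) (θ j) ≈ 0#
  factor-roots (suc n) p θ e i j i≢j = root i , (begin
    dd (suc n) p (θ i) (θ j)       ≈⟨ dd≈quot n p (θ i) (θ j) ⟩
    -- The quotient by t + θⱼ has the same coefficients as the product of the remaining factors, and
    -- t + θᵢ is among these since i ≠ j, even if the two values coincide.
    ev n (quot n p (θ j)) (θ i)    ≈⟨ ev-cong n (θ i) (agreeing-off⇒≈ n _ r (θ j) off) ⟩
    ev n r (θ i)                   ≈⟨ r-spec (θ i) ⟨
    ∏ (λ k → θ i + θ (F.punchIn j k))  ≈⟨ at-θi (F.punchOut (i≢j ∘ ≡.sym)) (F.punchIn-punchOut _) ⟩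
    0#                             ∎)
    where
    rest = ∏-coefficients n (θ ∘ F.punchIn j)
    r = proj₁ rest
    r-spec = proj₂ (proj₂ (proj₂ rest))
    root : ∀ i → ev (suc n) p (θ i) ≈ 0#
    root i = trans (e (θ i)) (trans (∏-remove {i = i} (λ k → θ i + θ k)) (trans (*-congʳ (x+x≈0 _)) (zeroˡ _)))
    off : ∀ t → ¬ t ≈ θ j → ev n (quot n p (θ j)) t ≈ ev n r t
    off t t≉ = *-cancelˡ (λ z → t≉ (+-cancel-0 z)) (begin
      (t + θ j) * ev n (quot n p (θ j)) t          ≈⟨ quot-spec n p (θ j) t ⟩
      ev (suc n) p t + ev (suc n) p (θ j)          ≈⟨ trans (+-congˡ (root j)) (+-identityʳ _) ⟩
      ev (suc n) p t                               ≈⟨ e t ⟩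
      ∏ (λ i → t + θ i)                            ≈⟨ ∏-remove {i = j} (λ i → t + θ i) ⟩
      (t + θ j) * ∏ (λ k → t + θ (F.punchIn j k))  ≈⟨ *-congˡ (r-spec t) ⟩
      (t + θ j) * ev n r t                         ∎)
    at-θi : ∀ k → F.punchIn j k ≡ i → ∏ (λ k → θ i + θ (F.punchIn j k)) ≈ 0#
    at-θi k eq = trans (zero-factor k (reflexive (≡.cong (λ z → θ i + θ z) eq) )) refl
      where
      zero-factor : ∀ {m} {f : Fin m → Carrier} (k : Fin m) → f k ≈ θ i + θ i → ∏ f ≈ 0#
      zero-factor {suc m} {f} k eq = trans (∏-remove {i = k} f) (trans (*-congʳ (trans eq (x+x≈0 _))) (zeroˡ _))

  -- Linear algebra

  -- Double negation passes through finite quantifiers; this stands in for deciding which entries of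
  -- a matrix vanish.
  ¬¬-∀Fin : ∀ {p} n {P : Fin n → Set p} → (∀ i → ¬ ¬ P i) → ¬ ¬ (∀ i → P i)
  ¬¬-∀Fin zero f g = g λ ()
  ¬¬-∀Fin (suc n) f g = f zero λ p₀ → ¬¬-∀Fin n (f ∘ suc) λ ps → g λ { zero → p₀ ; (suc i) → ps i }

  ¬¬-∀≤ : ∀ {p} n {P : ℕ → Set p} → (∀ k → k N.≤ n → ¬ ¬ P k) → ¬ ¬ (∀ k → k N.≤ n → P k)
  ¬¬-∀≤ zero f g = f 0 z≤n λ p₀ → g λ { zero _ → p₀ }
  ¬¬-∀≤ (suc n) {P} f g = f 0 z≤n λ p₀ → ¬¬-∀≤ n {P ∘ suc} (λ k k≤n → f (suc k) (s≤s k≤n)) λ ps →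
    g λ { zero _ → p₀ ; (suc k) (s≤s k≤n) → ps k k≤n }

  -- The summands are explicit: ∑ unfolds, so unification does not recover them.
  ∑-cong : ∀ {n} (f g : Fin n → Carrier) → (∀ i → f i ≈ g i) → ∑ f ≈ ∑ g
  ∑-cong {zero} f g e = refl
  ∑-cong {suc n} f g e = +-cong (e zero) (∑-cong (f ∘ suc) (g ∘ suc) (e ∘ suc))

  ∑-0 : ∀ {n} (f : Fin n → Carrier) → (∀ i → f i ≈ 0#) → ∑ f ≈ 0#
  ∑-0 {n} f e = trans (∑-cong f (λ _ → 0#) e) (∑-replicate-0 n)

  δ : ∀ {n} → Fin n → Fin n → Carrier
  δ i j with i F.≟ j
  ... | yes _ = 1#
  ... | no _ = 0#

  δ-refl : ∀ {n} (i : Fin n) → δ i i ≈ 1#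
  δ-refl i with i F.≟ i
  ... | yes _ = refl
  ... | no i≢i = contradiction ≡.refl i≢i

  δ-≢ : ∀ {n} {i j : Fin n} → i ≢ j → δ i j ≈ 0#
  δ-≢ {i = i} {j} i≢j with i F.≟ j
  ... | yes i≡j = contradiction i≡j i≢j
  ... | no _ = refl

  δ-sym : ∀ {n} (i j : Fin n) → δ i j ≈ δ j i
  δ-sym i j with i F.≟ j
  ... | yes ≡.refl = sym (δ-refl i)
  ... | no i≢j = sym (δ-≢ (i≢j ∘ ≡.sym))

  ∑-δ : ∀ {n} (f : Fin n → Carrier) j → ∑ (λ i → f i * δ j i) ≈ f j
  ∑-δ {suc n} f j = begin
    ∑ (λ i → f i * δ j i)        ≈⟨ ∑-remove {i = j} (λ i → f i * δ j i) ⟩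
    f j * δ j j + ∑ (λ k → f (F.punchIn j k) * δ j (F.punchIn j k))
      ≈⟨ +-cong (trans (*-congˡ (δ-refl j)) (*-identityʳ _))
           (∑-0 (λ k → f (F.punchIn j k) * δ j (F.punchIn j k)) (λ k → trans (*-congˡ (δ-≢ (F.punchInᵢ≢i j k ∘ ≡.sym))) (zeroʳ _))) ⟩
    f j + 0#                     ≈⟨ +-identityʳ _ ⟩
    f j                          ∎

  HasRelation : ∀ {n m} → (Fin n → Fin m → Carrier) → Set (c ⊔ ℓ)
  HasRelation {m = m} A = ∃ λ (v : Fin m → Carrier) → (∃ λ i → ¬ v i ≈ 0#) × (∀ r → ∑ (λ i → v i * A r i) ≈ 0#)

  HasRelation-0∷ : ∀ {n} (A : Fin (suc n) → Fin (suc (suc n)) → Carrier) → (∀ i → A zero i ≈ 0#) →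
                   HasRelation (λ r i → A (suc r) (suc i)) → HasRelation A
  HasRelation-0∷ {n} A A₀≈0 (v , (i , vi≉0) , e) = w , (suc i , vi≉0) , rel
    where
    w : Fin (suc (suc n)) → Carrier
    w zero = 0#
    w (suc i) = v i
    rel : ∀ r → ∑ (λ i → w i * A r i) ≈ 0#
    rel zero = ∑-0 (λ i → w i * A zero i) (λ i → trans (*-congˡ (A₀≈0 i)) (zeroʳ (w i)))
    rel (suc r) = trans (+-cong (zeroˡ (A (suc r) zero)) (e r)) (+-identityˡ 0#)

  -- One step of Gaussian elimination with pivot in row `zero`, column p. A kernel vector of the
  -- reduced matrix is completed at p by the value `x v` that row `zero` dictates.
  module Pivot {n} (A : Fin (suc n) → Fin (suc (suc n)) → Carrier) (p : Fin (suc (suc n))) (κ : Carrier) (κ-inv : A zero p * κ ≈ 1#) where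
    eliminated : Fin n → Fin (suc n) → Carrier
    eliminated r i = A (suc r) (F.punchIn p i) + (A (suc r) p * κ) * A zero (F.punchIn p i)

    module _ (v : Fin (suc n) → Carrier) where
      x : Carrier
      x = κ * ∑ (λ i → v i * A zero (F.punchIn p i))

      row : Fin (suc n) → Carrier
      row r = ∑ (λ i → v i * A r (F.punchIn p i))

      split : ∀ r → ∑ (λ i → insertAt v p x i * A r i) ≈ x * A r p + row r
      split r = trans (∑-remove {i = p} (λ i → insertAt v p x i * A r i))
        (+-cong (*-congʳ (reflexive (insertAt-lookup v p x))) 
        (∑-cong (λ i → insertAt v p x (F.punchIn p i) * A r (F.punchIn p i)) (λ i → v i * A r (F.punchIn p i))
          (λ i → *-congʳ (reflexive (insertAt-punchIn v p x i)))))

      scaled : ∀ r → x * A r p ≈ (A r p * κ) * row zero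
      scaled r = solve 3 (λ k s a → (k :* s) :* a := (a :* k) :* s) refl κ (row zero) (A r p)

      eliminated-row : ∀ r → ∑ (λ i → v i * eliminated r i) ≈ x * A (suc r) p + row (suc r)
      eliminated-row r = begin
        ∑ (λ i → v i * eliminated r i)
          ≈⟨ ∑-cong (λ i → v i * eliminated r i) (λ i → (A (suc r) p * κ) * (v i * A zero (F.punchIn p i)) + v i * A (suc r) (F.punchIn p i))
               (λ i → solve 4 (λ v a b c → v :* (a :+ b :* c) := b :* (v :* c) :+ v :* a) refl
               (v i) (A (suc r) (F.punchIn p i)) (A (suc r) p * κ) (A zero (F.punchIn p i))) ⟩
        ∑ (λ i → (A (suc r) p * κ) * (v i * A zero (F.punchIn p i)) + v i * A (suc r) (F.punchIn p i))
          ≈⟨ ∑-+ (λ i → (A (suc r) p * κ) * (v i * A zero (F.punchIn p i))) (λ i → v i * A (suc r) (F.punchIn p i)) ⟩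
        ∑ (λ i → (A (suc r) p * κ) * (v i * A zero (F.punchIn p i))) + row (suc r)
          ≈⟨ +-congʳ (*-distribˡ-∑ (A (suc r) p * κ) (λ i → v i * A zero (F.punchIn p i))) ⟨
        (A (suc r) p * κ) * row zero + row (suc r)
          ≈⟨ +-congʳ (scaled (suc r)) ⟨
        x * A (suc r) p + row (suc r) ∎

    relation : HasRelation eliminated → HasRelation A
    relation (v , (i , vi≉0) , e) = insertAt v p (x v)
      , (F.punchIn p i , λ z → vi≉0 (trans (reflexive (≡.sym (insertAt-punchIn v p (x v) i))) z))
      , rel
      where
      rel : ∀ r → ∑ (λ i → insertAt v p (x v) i * A r i) ≈ 0#
      rel zero = trans (split v zero) (≈⇒+≈0 (trans (scaled v zero) (trans (*-congʳ κ-inv) (*-identityˡ (row v zero)))))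
      rel (suc r) = trans (split v (suc r)) (trans (sym (eliminated-row v r)) (e r))

  underdetermined : ∀ n (A : Fin n → Fin (suc n) → Carrier) → ¬ ¬ HasRelation A
  underdetermined zero A k = k ((λ _ → 1#) , (zero , 1≉0) , λ ())
  underdetermined (suc n) A k = noPivot λ { (p , Ap≉0) → pivot p (inverse (A zero p) Ap≉0) }
    where
    -- Without a pivot, row `zero` vanishes and imposes nothing; one column may then be given up
    -- with it, by setting its unknown to 0.
    noPivot : ¬ ¬ (∃ λ i → ¬ A zero i ≈ 0#)
    noPivot none = ¬¬-∀Fin (suc (suc n)) (λ i ≉0 → none (i , ≉0)) λ A₀≈0 →
      underdetermined n (λ r i → A (suc r) (suc i)) (λ rel → k (HasRelation-0∷ A A₀≈0 rel))
    pivot : ∀ p → (∃ λ κ → A zero p * κ ≈ 1#) → ⊥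
    pivot p (κ , κ-inv) = underdetermined n (Pivot.eliminated A p κ κ-inv) (λ rel → k (Pivot.relation A p κ κ-inv rel))

  -- Systems are given as linear functionals of a family indexed by an arbitrary type, which avoids
  -- writing out the matrix of the convolution equations. `underdetermined-lin` recovers that matrix
  -- by evaluating at delta families.
  record IsLinear {X : Set} (φ : (X → Carrier) → Carrier) : Set (c ⊔ ℓ) where
    field
      lin-cong  : ∀ {u v} → (∀ x → u x ≈ v x) → φ u ≈ φ v
      lin-+     : ∀ u v → φ (λ x → u x + v x) ≈ φ u + φ v
      lin-scale : ∀ a u → φ (λ x → a * u x) ≈ a * φ u
  open IsLinear

  module _ {X : Set} where
    lin-∑-inside : ∀ {φ : (X → Carrier) → Carrier} → IsLinear φ → ∀ {n} (f : Fin n → X → Carrier) →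
                   φ (λ x → ∑ (λ i → f i x)) ≈ ∑ (λ i → φ (f i))
    lin-∑-inside {φ} L {zero} f = trans (lin-cong L (λ x → sym (zeroˡ 0#))) (trans (lin-scale L 0# (λ _ → 0#)) (zeroˡ _))
    lin-∑-inside {φ} L {suc n} f = trans (lin-+ L (f zero) (λ x → ∑ (λ i → f (suc i) x))) (+-congˡ (lin-∑-inside L (f ∘ suc)))

    lin-eval : ∀ x → IsLinear {X} (λ u → u x)
    lin-eval x = record { lin-cong = λ e → e x ; lin-+ = λ u v → refl ; lin-scale = λ a u → refl }

    lin-0 : IsLinear {X} (λ u → 0#)
    lin-0 = record { lin-cong = λ e → refl ; lin-+ = λ u v → sym (+-identityˡ 0#) ; lin-scale = λ a u → sym (zeroʳ a) }

    lin-add : ∀ {φ ψ : (X → Carrier) → Carrier} → IsLinear φ → IsLinear ψ → IsLinear (λ u → φ u + ψ u)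
    lin-add L M = record
      { lin-cong = λ e → +-cong (lin-cong L e) (lin-cong M e)
      ; lin-+ = λ u v → trans (+-cong (lin-+ L u v) (lin-+ M u v))
          (solve 4 (λ a b p q → (a :+ b) :+ (p :+ q) := (a :+ p) :+ (b :+ q)) refl _ _ _ _)
      ; lin-scale = λ a u → trans (+-cong (lin-scale L a u) (lin-scale M a u)) (sym (distribˡ a _ _)) }

    lin-*ʳ : ∀ {φ : (X → Carrier) → Carrier} b → IsLinear φ → IsLinear (λ u → φ u * b)
    lin-*ʳ b L = record
      { lin-cong = λ e → *-congʳ (lin-cong L e)
      ; lin-+ = λ u v → trans (*-congʳ (lin-+ L u v)) (distribʳ _ _ _)
      ; lin-scale = λ a u → trans (*-congʳ (lin-scale L a u)) (*-assoc _ _ _) }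

    lin-∑ : ∀ n {φ : Fin n → (X → Carrier) → Carrier} → (∀ i → IsLinear (φ i)) → IsLinear (λ u → ∑ (λ i → φ i u))
    lin-∑ zero L = lin-0
    lin-∑ (suc n) L = lin-add (L zero) (lin-∑ n (L ∘ suc))

    lin-sumTo : ∀ n {φ : ℕ → (X → Carrier) → Carrier} → (∀ k → IsLinear (φ k)) → IsLinear (λ u → sumTo n (λ k → φ k u))
    lin-sumTo zero L = L 0
    lin-sumTo (suc n) L = lin-add (lin-sumTo n L) (L (suc n))

    underdetermined-lin : ∀ {n m} → m ≡ suc n → (dec : Fin m → X) (enc : X → Fin m) → (∀ i → enc (dec i) ≡ i) →
      (φ : Fin n → (X → Carrier) → Carrier) → (∀ r → IsLinear (φ r)) →
      ¬ ¬ (∃ λ (u : X → Carrier) → (∃ λ x → ¬ u x ≈ 0#) × (∀ r → φ r u ≈ 0#))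
    underdetermined-lin {n} ≡.refl dec enc enc-dec φ L k = underdetermined n (λ r i → φ r (λ x → δ (enc x) i))
      λ { (v , (i , vi≉0) , e) → k (v ∘ enc , (dec i , λ z → vi≉0 (trans (reflexive (≡.cong v (≡.sym (enc-dec i)))) z)) , λ r → begin
        φ r (v ∘ enc)                                    ≈⟨ lin-cong (L r) (λ x → sym (∑-δ v (enc x))) ⟩
        φ r (λ x → ∑ (λ i → v i * δ (enc x) i))          ≈⟨ lin-∑-inside (L r) (λ i x → v i * δ (enc x) i) ⟩
        ∑ (λ i → φ r (λ x → v i * δ (enc x) i))          ≈⟨ ∑-cong (λ i → φ r (λ x → v i * δ (enc x) i)) (λ i → v i * φ r (λ x → δ (enc x) i)) (λ i → lin-scale (L r) (v i) (λ x → δ (enc x) i)) ⟩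
        ∑ (λ i → v i * φ r (λ x → δ (enc x) i))          ≈⟨ e r ⟩
        0#                                               ∎) }

  extend0 : ∀ {n} → (Fin n → Carrier) → ℕ → Carrier
  extend0 {n} f k with k N.<? n
  ... | yes k<n = f (fromℕ< k<n)
  ... | no _ = 0#

  extend0-≥ : ∀ {n} (f : Fin n → Carrier) {k} → n N.≤ k → extend0 f k ≈ 0#
  extend0-≥ {n} f {k} n≤k with k N.<? n
  ... | yes k<n = contradiction n≤k (N.<⇒≱ k<n)
  ... | no _ = refl

  extend0-toℕ : ∀ {n} (f : Fin n → Carrier) i → extend0 f (toℕ i) ≈ f i
  extend0-toℕ {n} f i with toℕ i N.<? n
  ... | yes i<n = reflexive (≡.cong f (F.fromℕ<-toℕ i i<n))
  ... | no i≮n = contradiction (F.toℕ<n i) i≮n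

  lin-extend0 : ∀ {X : Set} {n} (g : Fin n → X) k → IsLinear (λ u → extend0 (u ∘ g) k)
  lin-extend0 {n = n} g k with k N.<? n
  ... | yes k<n = lin-eval (g (fromℕ< k<n))
  ... | no _ = lin-0

  conv : (ℕ → Carrier) → (ℕ → Carrier) → ℕ → Carrier
  conv p q k = sumTo k (λ a → p a * q (k N.∸ a))

  ev-conv : ∀ n m p q x → (∀ k → n N.< k → p k ≈ 0#) → (∀ k → m N.< k → q k ≈ 0#) →
            ev (n N.+ m) (conv p q) x ≈ ev n p x * ev m q x
  ev-conv zero m p q x p0 q0 = begin
    ev m (conv p q) x             ≈⟨ ev-cong m x (λ k _ → sum-single k _ z≤n (λ { zero 0≢0 → contradiction ≡.refl 0≢0
                                       ; (suc a) _ → trans (*-congʳ (p0 (suc a) (s≤s z≤n))) (zeroˡ _) })) ⟩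
    ev m (λ k → p 0 * q k) x      ≈⟨ ev-*ˡ m (p 0) q x ⟩
    p 0 * ev m q x                ≈⟨ *-congʳ (*-identityʳ _) ⟨
    (p 0 * 1#) * ev m q x         ∎
  ev-conv (suc n) m p q x p0 q0 = begin
    ev (suc (n N.+ m)) (conv p q) x    ≈⟨ ev-head (n N.+ m) (conv p q) x ⟩
    p 0 * q 0 + x * ev (n N.+ m) (λ k → conv p q (suc k)) x
      ≈⟨ +-congˡ (*-congˡ (ev-cong (n N.+ m) x (λ k _ → sum-head k (λ a → p a * q (suc k N.∸ a))))) ⟩
    p 0 * q 0 + x * ev (n N.+ m) (λ k → p 0 * q (suc k) + conv (p ∘ suc) q k) x
      ≈⟨ +-congˡ (*-congˡ (ev-+ (n N.+ m) (λ k → p 0 * q (suc k)) (conv (p ∘ suc) q) x)) ⟩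
    p 0 * q 0 + x * (ev (n N.+ m) (λ k → p 0 * q (suc k)) x + ev (n N.+ m) (conv (p ∘ suc) q) x)
      ≈⟨ +-congˡ (*-congˡ (+-cong (ev-*ˡ (n N.+ m) (p 0) (q ∘ suc) x) (ev-conv n m (p ∘ suc) q x (λ k n<k → p0 (suc k) (s≤s n<k)) q0))) ⟩
    p 0 * q 0 + x * (p 0 * ev (n N.+ m) (q ∘ suc) x + ev n (p ∘ suc) x * ev m q x)
      ≈⟨ solve 6 (λ a b x e f g → a :* b :+ x :* (a :* e :+ f :* g) := a :* (b :+ x :* e) :+ (x :* f) :* g) refl
           (p 0) (q 0) x (ev (n N.+ m) (q ∘ suc) x) (ev n (p ∘ suc) x) (ev m q x) ⟩
    p 0 * (q 0 + x * ev (n N.+ m) (q ∘ suc) x) + (x * ev n (p ∘ suc) x) * ev m q x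
      ≈⟨ +-congʳ (*-congˡ (trans (sym (ev-head (n N.+ m) q x)) (ev-extend q x (N.m≤n+m m (suc n)) q0))) ⟩
    p 0 * ev m q x + (x * ev n (p ∘ suc) x) * ev m q x   ≈⟨ distribʳ _ _ _ ⟨
    (p 0 + x * ev n (p ∘ suc) x) * ev m q x              ≈⟨ *-congʳ (ev-head n p x) ⟨
    ev (suc n) p x * ev m q x                            ∎

  -- Elimination over K[μ]

  module Elimination
    (H w : ℕ) (s : Fin H → ℕ) (s≤w : ∀ i → s i N.≤ w)
    (Z : Fin H → Fin H → ℕ → Carrier)
    (Z-deg : ∀ i j k → w N.+ s i N.< k N.+ s j → Z i j k ≈ 0#)
    (i₀ : Fin H) (s-i₀ : s i₀ ≡ 0)
    (Z-inj : ∀ (x : Fin H → Carrier) → (∀ j → ∑ (λ i → x i * Z i j 0) ≈ 0#) → ∀ i → x i ≈ 0#)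
    where

    -- The system asks for polynomials uᵢ and S in μ with Σᵢ uᵢ Zᵢⱼ = S δ(j, i₀) for each j. It has
    -- H · `bound` + `deg` + 1 unknown coefficients and `bound` + w equations for each of the H
    -- values of j, so `deg` = H w is exactly what leaves one unknown too many. `bound` only has to
    -- be large enough to exceed `deg` and every s j.
    deg bound : ℕ
    deg = H N.* w
    bound = suc (w N.+ deg)

    Unknown : Set
    Unknown = (Fin H × Fin bound) ⊎ Fin (suc deg)

    dec : Fin (H N.* bound N.+ suc deg) → Unknown
    dec k = Sum.map₁ (F.remQuot bound) (F.splitAt (H N.* bound) k)

    enc : Unknown → Fin (H N.* bound N.+ suc deg)
    enc x = F.join (H N.* bound) (suc deg) (Sum.map₁ (uncurry F.combine) x)

    enc-dec : ∀ k → enc (dec k) ≡ k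
    enc-dec k = ≡.trans (≡.cong (F.join (H N.* bound) (suc deg)) (lemma (F.splitAt (H N.* bound) k)))
      (F.join-splitAt (H N.* bound) (suc deg) k)
      where
      lemma : ∀ x → Sum.map₁ (uncurry F.combine) (Sum.map₁ (F.remQuot {H} bound) x) ≡ x
      lemma (inj₁ i) = ≡.cong inj₁ (F.combine-remQuot {H} bound i)
      lemma (inj₂ j) = ≡.refl

    count : H N.* bound N.+ suc deg ≡ suc (H N.* (bound N.+ w))
    count = ≡.trans (N.+-suc (H N.* bound) deg) (≡.cong suc (≡.sym (N.*-distribˡ-+ H bound w)))

    module _ (u : Unknown → Carrier) where
      û : Fin H → ℕ → Carrier
      û i = extend0 (λ a → u (inj₁ (i , a)))

      Ŝ : ℕ → Carrier
      Ŝ = extend0 (λ a → u (inj₂ a))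

      column : Fin H → ℕ → Carrier
      column j k = ∑ (λ i → conv (û i) (Z i j) k) + Ŝ k * δ j i₀

      -- The j-th coordinate contributes the coefficients of μ^k and, for the large k, the
      -- conditions deg u_j < bound ∸ s j: each j then uses exactly bound + w equations.
      equation : Fin H × ℕ → Carrier
      equation (j , k) with k N.<? (bound N.∸ s j) N.+ w
      ... | yes _ = column j k
      ... | no _ = û j (k N.∸ w)

      equation-< : ∀ j k → k N.< (bound N.∸ s j) N.+ w → equation (j , k) ≡ column j k
      equation-< j k k< with k N.<? (bound N.∸ s j) N.+ w
      ... | yes _ = ≡.refl
      ... | no k≮ = contradiction k< k≮

      equation-≥ : ∀ j k → (bound N.∸ s j) N.+ w N.≤ k → equation (j , k) ≡ û j (k N.∸ w)
      equation-≥ j k k≥ with k N.<? (bound N.∸ s j) N.+ w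
      ... | yes k< = contradiction k≥ (N.<⇒≱ k<)
      ... | no _ = ≡.refl

    equation-lin : ∀ p → IsLinear (λ u → equation u p)
    equation-lin (j , k) with k N.<? (bound N.∸ s j) N.+ w
    ... | yes _ = lin-add (lin-∑ H (λ i → lin-sumTo k (λ a → lin-*ʳ (Z i j (k N.∸ a)) (lin-extend0 (λ a → inj₁ (i , a)) a))))
                          (lin-*ʳ (δ j i₀) (lin-extend0 inj₂ k))
    ... | no _ = lin-extend0 (λ a → inj₁ (j , a)) (k N.∸ w)

    s≤D : ∀ j → s j N.≤ bound
    s≤D j = N.m≤n⇒m≤1+n (N.≤-trans (s≤w j) (N.m≤m+n w deg))

    w+w : ℕ
    w+w = w N.+ w

    Z-deg′ : ∀ i j k → w+w N.< k → Z i j k ≈ 0#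
    Z-deg′ i j k w+w<k = Z-deg i j k (N.≤-<-trans (N.+-monoʳ-≤ w (s≤w i)) (N.<-≤-trans w+w<k (N.m≤m+n k (s j))))

    -- Here x stands for the values of the normal monomials at a point over μ; the monomial of index
    -- i₀ is 1. As the rows of Z expand z times a monomial, the second hypothesis holds wherever z
    -- vanishes.
    Annihilates : (ℕ → Carrier) → Set (c ⊔ ℓ)
    Annihilates S = ∀ μ (x : Fin H → Carrier) → x i₀ ≈ 1# →
      (∀ i → ∑ (λ j → ev w+w (Z i j) μ * x j) ≈ 0#) → ev deg S μ ≈ 0#

    module Solution (u : Unknown → Carrier) (eqs : ∀ r → equation u (Product.map₂ toℕ (F.remQuot {H} (bound N.+ w) r)) ≈ 0#) where
      eqs′ : ∀ j k → k N.< bound N.+ w → equation u (j , k) ≈ 0#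
      eqs′ j k k< = ≡.subst (λ p → equation u p ≈ 0#)
        (≡.trans (≡.cong (Product.map₂ toℕ) (F.remQuot-combine j (fromℕ< k<))) (≡.cong (j ,_) (F.toℕ-fromℕ< k<)))
        (eqs (F.combine j (fromℕ< k<)))

      û-deg : ∀ j a → bound N.∸ s j N.≤ a → û u j a ≈ 0#
      û-deg j a D∸s≤a = by-cases (a N.<? bound)
        where
        by-cases : Dec (a N.< bound) → û u j a ≈ 0#
        by-cases (no a≮D) = extend0-≥ (λ a → u (inj₁ (j , a))) (N.≮⇒≥ a≮D)
        -- Equation a + w of coordinate j falls in the second range, where `equation` subtracts w
        -- again and returns coefficient a.
        by-cases (yes a<D) = trans (reflexive (≡.sym (≡.trans (equation-≥ u j (a N.+ w) (N.+-monoˡ-≤ w D∸s≤a))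
          (≡.cong (û u j) (N.m+n∸n≡m a w))))) (eqs′ j (a N.+ w) (N.+-monoˡ-< w a<D))

      û-deg′ : ∀ j a → bound N.≤ a → û u j a ≈ 0#
      û-deg′ j a D≤a = û-deg j a (N.≤-trans (N.m∸n≤m bound (s j)) D≤a)

      Ŝ-deg : ∀ a → deg N.< a → Ŝ u a ≈ 0#
      Ŝ-deg a deg<a = extend0-≥ (λ a → u (inj₂ a)) deg<a

      conv-deg : ∀ i j k → (bound N.∸ s j) N.+ w N.≤ k → conv (û u i) (Z i j) k ≈ 0#
      conv-deg i j k k≥ = sum-0 k (λ a a≤k → term a a≤k)
        where
        term : ∀ a → a N.≤ k → û u i a * Z i j (k N.∸ a) ≈ 0#
        term a a≤k = by-cases (a N.<? bound N.∸ s i)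
          where
          by-cases : Dec (a N.< bound N.∸ s i) → û u i a * Z i j (k N.∸ a) ≈ 0#
          by-cases (no a≮) = trans (*-congʳ (û-deg i a (N.≮⇒≥ a≮))) (zeroˡ _)
          by-cases (yes a<) = trans (*-congˡ (Z-deg i j (k N.∸ a) (product-degree a≤k (s≤D i) (s≤D j) a< k≥))) (zeroʳ _)

      Ŝδ-deg : ∀ j k → (bound N.∸ s j) N.+ w N.≤ k → Ŝ u k * δ j i₀ ≈ 0#
      Ŝδ-deg j k k≥ with j F.≟ i₀
      ... | no _ = zeroʳ _
      ... | yes ≡.refl = trans (*-congʳ (Ŝ-deg k (N.<-≤-trans (s≤s (N.m≤n+m deg w))
        (N.≤-trans (N.m≤m+n bound w) (≡.subst (λ z → (bound N.∸ z) N.+ w N.≤ k) s-i₀ k≥))))) (zeroˡ _)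

      column≈0 : ∀ j k → column u j k ≈ 0#
      column≈0 j k = by-cases (k N.<? (bound N.∸ s j) N.+ w)
        where
        by-cases : Dec (k N.< (bound N.∸ s j) N.+ w) → column u j k ≈ 0#
        by-cases (yes k<) = trans (reflexive (≡.sym (equation-< u j k k<)))
                       (eqs′ j k (N.<-≤-trans k< (N.+-monoˡ-≤ w (N.m∸n≤m bound (s j)))))
        by-cases (no k≮) = trans (+-cong (∑-0 (λ i → conv (û u i) (Z i j) k) (λ i → conv-deg i j k (N.≮⇒≥ k≮)))
                                  (Ŝδ-deg j k (N.≮⇒≥ k≮))) (+-identityˡ 0#)

      width : ℕ
      width = bound N.+ w+w

      -- Pair the identity Σᵢ uᵢ Zᵢⱼ = S δ(j, i₀) with x and exchange the sums: the right side
      -- becomes S(μ), while on the left each uᵢ multiplies Σⱼ Zᵢⱼ xⱼ = 0.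
      annihilates : Annihilates (Ŝ u)
      annihilates μ x xi₀≈1 null = begin
        ev deg (Ŝ u) μ                        ≈⟨ ev-extend (Ŝ u) μ deg≤B Ŝ-deg ⟨
        ev width (Ŝ u) μ                          ≈⟨ *-identityʳ _ ⟨
        ev width (Ŝ u) μ * 1#                     ≈⟨ *-congˡ xi₀≈1 ⟨
        ev width (Ŝ u) μ * x i₀                   ≈⟨ trans (*-congˡ (trans (sym (∑-δ x i₀)) (∑-cong (λ j → x j * δ i₀ j) (λ j → δ j i₀ * x j)
                                                   (λ j → trans (*-comm _ _) (*-congʳ (δ-sym i₀ j))))))
                                                   (*-distribˡ-∑ (ev width (Ŝ u) μ) (λ j → δ j i₀ * x j)) ⟩
        ∑ (λ j → ev width (Ŝ u) μ * (δ j i₀ * x j)) ≈⟨ ∑-cong (λ j → ev width (Ŝ u) μ * (δ j i₀ * x j)) (λ j → ∑ (λ i → (ev bound (û u i) μ * ev w+w (Z i j) μ) * x j)) cancel ⟩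
        ∑ (λ j → ∑ (λ i → (ev bound (û u i) μ * ev w+w (Z i j) μ) * x j))
                                              ≈⟨ ∑-comm (λ j i → (ev bound (û u i) μ * ev w+w (Z i j) μ) * x j) ⟩
        ∑ (λ i → ∑ (λ j → (ev bound (û u i) μ * ev w+w (Z i j) μ) * x j)) ≈⟨ ∑-0 (λ i → ∑ (λ j → (ev bound (û u i) μ * ev w+w (Z i j) μ) * x j)) vanish ⟩
        0#                                    ∎
        where
        deg≤B : deg N.≤ width
        deg≤B = N.≤-trans (N.m≤n⇒m≤1+n (N.m≤n+m deg w)) (N.m≤m+n bound w+w)
        vanish : ∀ i → ∑ (λ j → (ev bound (û u i) μ * ev w+w (Z i j) μ) * x j) ≈ 0#
        vanish i = begin
          ∑ (λ j → (ev bound (û u i) μ * ev w+w (Z i j) μ) * x j)   ≈⟨ ∑-cong (λ j → (ev bound (û u i) μ * ev w+w (Z i j) μ) * x j) (λ j → ev bound (û u i) μ * (ev w+w (Z i j) μ * x j)) (λ j → *-assoc _ _ _) ⟩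
          ∑ (λ j → ev bound (û u i) μ * (ev w+w (Z i j) μ * x j))   ≈⟨ *-distribˡ-∑ (ev bound (û u i) μ) (λ j → ev w+w (Z i j) μ * x j) ⟨
          ev bound (û u i) μ * ∑ (λ j → ev w+w (Z i j) μ * x j)     ≈⟨ trans (*-congˡ (null i)) (zeroʳ _) ⟩
          0#                                                    ∎
        ev-∑ : ∀ n (f : Fin n → ℕ → Carrier) → ev width (λ k → ∑ (λ i → f i k)) μ ≈ ∑ (λ i → ev width (f i) μ)
        ev-∑ zero f = sum-0 width (λ k _ → zeroˡ _)
        ev-∑ (suc n) f = trans (ev-+ width (f zero) (λ k → ∑ (λ i → f (suc i) k)) μ) (+-congˡ (ev-∑ n (f ∘ suc)))
        cancel : ∀ j → ev width (Ŝ u) μ * (δ j i₀ * x j) ≈ ∑ (λ i → (ev bound (û u i) μ * ev w+w (Z i j) μ) * x j)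
        cancel j = +-cancel-0 (begin
          ev width (Ŝ u) μ * (δ j i₀ * x j) + ∑ (λ i → (ev bound (û u i) μ * ev w+w (Z i j) μ) * x j)
            ≈⟨ +-cong (solve 3 (λ e d x → e :* (d :* x) := (d :* e) :* x) refl _ _ _) (sym (*-distribʳ-∑ (x j) (λ i → ev bound (û u i) μ * ev w+w (Z i j) μ))) ⟩
          (δ j i₀ * ev width (Ŝ u) μ) * x j + ∑ (λ i → ev bound (û u i) μ * ev w+w (Z i j) μ) * x j
            ≈⟨ trans (sym (distribʳ _ _ _)) (*-congʳ (+-comm _ _)) ⟩
          (∑ (λ i → ev bound (û u i) μ * ev w+w (Z i j) μ) + δ j i₀ * ev width (Ŝ u) μ) * x j
            ≈⟨ *-congʳ (+-cong (∑-cong (λ i → ev width (conv (û u i) (Z i j)) μ) (λ i → ev bound (û u i) μ * ev w+w (Z i j) μ)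
                 (λ i → ev-conv bound w+w (û u i) (Z i j) μ (λ k D<k → û-deg′ i k (N.<⇒≤ D<k)) (Z-deg′ i j)))
                 (trans (ev-cong width μ (λ k _ → *-comm (Ŝ u k) (δ j i₀))) (ev-*ˡ width (δ j i₀) (Ŝ u) μ))) ⟨
          (∑ (λ i → ev width (conv (û u i) (Z i j)) μ) + ev width (λ k → Ŝ u k * δ j i₀) μ) * x j
            ≈⟨ *-congʳ (+-congʳ (ev-∑ H (λ i → conv (û u i) (Z i j)))) ⟨
          (ev width (λ k → ∑ (λ i → conv (û u i) (Z i j) k)) μ + ev width (λ k → Ŝ u k * δ j i₀) μ) * x j
            ≈⟨ *-congʳ (ev-+ width (λ k → ∑ (λ i → conv (û u i) (Z i j) k)) (λ k → Ŝ u k * δ j i₀) μ) ⟨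
          ev width (column u j) μ * x j ≈⟨ *-congʳ (sum-0 width (λ k _ → trans (*-congʳ (column≈0 j k)) (zeroˡ _))) ⟩
          0# * x j             ≈⟨ zeroˡ _ ⟩
          0#                   ∎)

      -- If S = 0, the row vector u is killed by Z. Once all coefficients of u below μ^a vanish, the
      -- coefficient of μ^a in this relation involves only Z at μ = 0, and `Z-inj` removes the next
      -- coefficient.
      u≈0 : (∀ k → k N.≤ deg → Ŝ u k ≈ 0#) → ∀ x → u x ≈ 0#
      u≈0 S≈0 (inj₂ k) = trans (sym (extend0-toℕ (λ a → u (inj₂ a)) k)) (S≈0 (toℕ k) (N.≤-pred (F.toℕ<n k)))
      u≈0 S≈0 (inj₁ (i , a)) = trans (sym (extend0-toℕ (λ a → u (inj₁ (i , a))) a)) (<-rec (λ a → ∀ i → û u i a ≈ 0#) step (toℕ a) i)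
        where
        Ŝ≈0 : ∀ k → Ŝ u k ≈ 0#
        Ŝ≈0 k = by-cases (k N.≤? deg)
          where
          by-cases : Dec (k N.≤ deg) → Ŝ u k ≈ 0#
          by-cases (yes k≤) = S≈0 k k≤
          by-cases (no k≰) = Ŝ-deg k (N.≰⇒> k≰)
        step : ∀ a → (∀ {b} → b N.< a → ∀ i → û u i b ≈ 0#) → ∀ i → û u i a ≈ 0#
        step a before = Z-inj (λ i → û u i a) (λ j → begin
          ∑ (λ i → û u i a * Z i j 0)      ≈⟨ ∑-cong (λ i → û u i a * Z i j 0) (λ i → conv (û u i) (Z i j) a) (λ i → sym (lowest i j)) ⟩
          ∑ (λ i → conv (û u i) (Z i j) a) ≈⟨ +-identityʳ _ ⟨
          ∑ (λ i → conv (û u i) (Z i j) a) + 0# ≈⟨ +-congˡ (trans (*-congʳ (Ŝ≈0 a)) (zeroˡ (δ j i₀))) ⟨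
          column u j a                          ≈⟨ column≈0 j a ⟩
          0#                               ∎)
          where
          lowest : ∀ i j → conv (û u i) (Z i j) a ≈ û u i a * Z i j 0
          lowest i j = trans (conv-last a ≡.refl) (*-congˡ (reflexive (≡.cong (Z i j) (N.n∸n≡0 a))))
            where
            conv-last : ∀ a′ → a′ ≡ a → sumTo a′ (λ b → û u i b * Z i j (a N.∸ b)) ≈ û u i a′ * Z i j (a N.∸ a′)
            conv-last zero _ = refl
            conv-last (suc a′) ≡.refl = trans (+-congʳ (sum-0 a′ (λ b b≤a′ → trans (*-congʳ (before (s≤s b≤a′) i)) (zeroˡ _)))) (+-identityˡ _)

    elimination : ¬ ¬ (∃ λ S → (∃ λ k → k N.≤ deg × ¬ S k ≈ 0#) × Annihilates S)
    elimination none = underdetermined-lin count dec enc enc-dec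
      (λ r u → equation u (Product.map₂ toℕ (F.remQuot {H} (bound N.+ w) r)))
      (λ r → equation-lin _)
      λ { (u , (x , ux≉0) , eqs) →
        ¬¬-∀≤ deg (λ k k≤ Sk≉0 → none (Ŝ u , (k , k≤ , Sk≉0) , Solution.annihilates u eqs))
          λ S≈0 → ux≉0 (Solution.u≈0 u eqs S≈0 x) }

  -- The algebra of pairs of critical points

  δℕ : ℕ → ℕ → Carrier
  δℕ i j with i N.≟ j
  ... | yes _ = 1#
  ... | no _ = 0#

  δℕ-refl : ∀ i → δℕ i i ≈ 1#
  δℕ-refl i with i N.≟ i
  ... | yes _ = refl
  ... | no i≢i = contradiction ≡.refl i≢i

  δℕ-≢ : ∀ {i j} → i ≢ j → δℕ i j ≈ 0#
  δℕ-≢ {i} {j} i≢j with i N.≟ j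
  ... | yes i≡j = contradiction i≡j i≢j
  ... | no _ = refl

  module PairAlgebra (g : ℕ) (γ : ℕ → ℕ → Carrier)
    (γ-deg : ∀ b k → 2 N.* suc (suc g) N.< k N.+ 2 N.* b → γ b k ≈ 0#) where

    h : ℕ
    h = suc (suc g)

    coef : ℕ → Carrier → Carrier
    coef b μ = ev (2 N.* h) (γ b) μ

    -- In the monic polynomial t^h + Σ_{b<h} coef b μ t^b, x is a root and y is a root of the
    -- quotient by t − x.
    V : Carrier → Carrier → Carrier → Set ℓ
    V μ x y = x ^ h ≈ sumTo (suc g) (λ b → coef b μ * x ^ b)
            × hc h x y ≈ sumTo (suc g) (λ b → coef b μ * hc b x y)

    Fun : Set c
    Fun = Carrier → Carrier → Carrier → Carrier

    -- μ has weight 1 and x, y have weight 2; Rep W is the span of the normal monomials of weight ≤ W.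
    data Rep (W : ℕ) : Fun → Set (c ⊔ ℓ) where
      mono  : ∀ a b c → a N.+ 2 N.* (b N.+ c) N.≤ W → b N.< h → c N.< suc g →
              Rep W (λ μ x y → μ ^ a * (x ^ b * y ^ c))
      rep-0 : Rep W (λ μ x y → 0#)
      rep-+ : ∀ {φ ψ} → Rep W φ → Rep W ψ → Rep W (λ μ x y → φ μ x y + ψ μ x y)
      rep-* : ∀ {φ} α → Rep W φ → Rep W (λ μ x y → α * φ μ x y)
      rep-≈ : ∀ {φ ψ} → (∀ μ x y → V μ x y → φ μ x y ≈ ψ μ x y) → Rep W φ → Rep W ψ

    rep-weaken : ∀ {W W′ φ} → W N.≤ W′ → Rep W φ → Rep W′ φ
    rep-weaken W≤ (mono a b c p b< c<) = mono a b c (N.≤-trans p W≤) b< c<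
    rep-weaken W≤ rep-0 = rep-0
    rep-weaken W≤ (rep-+ r r′) = rep-+ (rep-weaken W≤ r) (rep-weaken W≤ r′)
    rep-weaken W≤ (rep-* α r) = rep-* α (rep-weaken W≤ r)
    rep-weaken W≤ (rep-≈ e r) = rep-≈ e (rep-weaken W≤ r)

    rep-sum : ∀ {W} n (f : ℕ → Fun) → (∀ k → k N.≤ n → Rep W (f k)) → Rep W (λ μ x y → sumTo n (λ k → f k μ x y))
    rep-sum zero f r = r 0 z≤n
    rep-sum (suc n) f r = rep-+ (rep-sum n f (λ k k≤n → r k (N.m≤n⇒m≤1+n k≤n))) (r (suc n) N.≤-refl)

    rep-μ : ∀ {W φ} → Rep W φ → Rep (suc W) (λ μ x y → μ * φ μ x y)
    rep-μ (mono a b c p b< c<) = rep-≈ (λ μ x y _ → *-assoc _ _ _) (mono (suc a) b c (s≤s p) b< c<)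
    rep-μ rep-0 = rep-≈ (λ μ x y _ → sym (zeroʳ _)) rep-0
    rep-μ (rep-+ r r′) = rep-≈ (λ μ x y _ → sym (distribˡ _ _ _)) (rep-+ (rep-μ r) (rep-μ r′))
    rep-μ (rep-* {φ} α r) = rep-≈ (λ μ x y _ → solve 3 (λ α m p → α :* (m :* p) := m :* (α :* p)) refl α μ (φ μ x y)) (rep-* α (rep-μ r))
    rep-μ (rep-≈ e r) = rep-≈ (λ μ x y v → *-congˡ (e μ x y v)) (rep-μ r)

    rep-μ^ : ∀ k {W φ} → Rep W φ → Rep (k N.+ W) (λ μ x y → μ ^ k * φ μ x y)
    rep-μ^ zero r = rep-≈ (λ μ x y _ → sym (*-identityˡ _)) r
    rep-μ^ (suc k) r = rep-≈ (λ μ x y _ → sym (*-assoc _ _ _)) (rep-μ (rep-μ^ k r))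

    -- The distinction is made on the degree condition A, which is decidable, and not on the
    -- vanishing of α.
    rep-scaled : ∀ {W φ} {A : Set} α → Dec A → (¬ A → α ≈ 0#) → (A → Rep W φ) → Rep W (λ μ x y → α * φ μ x y)
    rep-scaled α (yes p) _ r = rep-* α (r p)
    rep-scaled α (no ¬p) e _ = rep-≈ (λ μ x y _ → sym (trans (*-congʳ (e ¬p)) (zeroˡ _))) rep-0

    rep-coef : ∀ {W} b (φ : Fun) → (∀ k → k N.+ 2 N.* b N.≤ 2 N.* h → Rep W (λ μ x y → μ ^ k * φ μ x y)) →
               Rep W (λ μ x y → coef b μ * φ μ x y)
    rep-coef b φ r = rep-≈ (λ μ x y _ → trans (sum-cong (2 N.* h) (λ k → sym (*-assoc _ _ _))) (sum-*ʳ (2 N.* h) (φ μ x y) (λ k → γ b k * μ ^ k)))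
      (rep-sum (2 N.* h) (λ k μ x y → γ b k * (μ ^ k * φ μ x y)) (λ k _ →
        rep-scaled (γ b k) (k N.+ 2 N.* b N.≤? 2 N.* h) (λ k≰ → γ-deg b k (N.≰⇒> k≰)) (r k)))

    -- Only b = h - 1 leaves the normal monomials; there the first relation of `V` rewrites x^h.
    rep-x-mono : ∀ {W} a b c → a N.+ 2 N.* (b N.+ c) N.≤ W → b N.< h → c N.< suc g →
                 Rep (2 N.+ W) (λ μ x y → x * (μ ^ a * (x ^ b * y ^ c)))
    rep-x-mono {W} a b c p (s≤s b≤) c< = by-cases (N.m≤n⇒m<n∨m≡n b≤)
      where
      by-cases : b N.< suc g ⊎ b ≡ suc g → Rep (2 N.+ W) (λ μ x y → x * (μ ^ a * (x ^ b * y ^ c)))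
      by-cases (inj₁ b<) = rep-≈ (λ μ x y _ → solve 4 (λ m x p q → m :* ((x :* p) :* q) := x :* (m :* (p :* q))) refl (μ ^ a) x (x ^ b) (y ^ c))
        (mono a (suc b) c (weight-x {a} {b} {c} p) (s≤s b<) c<)
      by-cases (inj₂ ≡.refl) = rep-≈ (λ μ x y v → begin
          sumTo (suc g) (λ b → coef b μ * (μ ^ a * (x ^ b * y ^ c)))
            ≈⟨ sum-cong (suc g) (λ b → solve 4 (λ e m p q → e :* (m :* (p :* q)) := (e :* p) :* (m :* q)) refl (coef b μ) (μ ^ a) (x ^ b) (y ^ c)) ⟩
          sumTo (suc g) (λ b → (coef b μ * x ^ b) * (μ ^ a * y ^ c)) ≈⟨ sum-*ʳ (suc g) (μ ^ a * y ^ c) (λ b → coef b μ * x ^ b) ⟩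
          sumTo (suc g) (λ b → coef b μ * x ^ b) * (μ ^ a * y ^ c)   ≈⟨ *-congʳ (proj₁ v) ⟨
          x ^ h * (μ ^ a * y ^ c)        ≈⟨ solve 4 (λ m x p q → (x :* p) :* (m :* q) := x :* (m :* (p :* q))) refl (μ ^ a) x (x ^ suc g) (y ^ c) ⟩
          x * (μ ^ a * (x ^ suc g * y ^ c)) ∎)
        (rep-sum (suc g) (λ b μ x y → coef b μ * (μ ^ a * (x ^ b * y ^ c))) (λ b′ b′≤ →
          rep-coef b′ (λ μ x y → μ ^ a * (x ^ b′ * y ^ c)) (λ k q →
            rep-≈ (λ μ x y _ → trans (*-congʳ (^-+ μ k a)) (*-assoc _ _ _))
              (mono (k N.+ a) b′ c (weight-x-top {a} {suc g} {c} {k = k} {b′} p q) (s≤s b′≤) c<))))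

    rep-x : ∀ {W φ} → Rep W φ → Rep (2 N.+ W) (λ μ x y → x * φ μ x y)
    rep-x (mono a b c p b< c<) = rep-x-mono a b c p b< c<
    rep-x rep-0 = rep-≈ (λ μ x y _ → sym (zeroʳ _)) rep-0
    rep-x (rep-+ r r′) = rep-≈ (λ μ x y _ → sym (distribˡ _ _ _)) (rep-+ (rep-x r) (rep-x r′))
    rep-x (rep-* {φ} α r) = rep-≈ (λ μ x y _ → solve 3 (λ α m p → α :* (m :* p) := m :* (α :* p)) refl α x (φ μ x y)) (rep-* α (rep-x r))
    rep-x (rep-≈ e r) = rep-≈ (λ μ x y v → *-congˡ (e μ x y v)) (rep-x r)

    rep-x^ : ∀ k {W φ} → Rep W φ → Rep (2 N.* k N.+ W) (λ μ x y → x ^ k * φ μ x y)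
    rep-x^ zero r = rep-≈ (λ μ x y _ → sym (*-identityˡ _)) r
    rep-x^ (suc k) {W} r = rep-≈ (λ μ x y _ → sym (*-assoc _ _ _))
      (rep-weaken (N.≤-reflexive (≡.cong (N._+ W) (≡.sym (N.*-suc 2 k)))) (rep-x (rep-x^ k r)))

    rep-y^< : ∀ {W} c → c N.< suc g → 2 N.* c N.≤ W → Rep W (λ μ x y → y ^ c)
    rep-y^< c c< p = rep-≈ (λ μ x y _ → trans (*-identityˡ _) (*-identityˡ _)) (mono 0 0 c p (s≤s z≤n) c<)

    rep-hc : ∀ {W} b → b N.≤ g → 2 N.* b N.≤ W → Rep W (λ μ x y → hc (suc b) x y)
    rep-hc zero _ p = rep-≈ (λ μ x y _ → sym (trans (+-congʳ (zeroʳ x)) (+-identityˡ 1#))) (rep-y^< 0 (s≤s z≤n) p)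
    rep-hc {W} (suc b) b< p = rep-+ (rep-weaken (N.≤-trans (N.≤-reflexive (≡.sym (N.*-suc 2 b))) p)
                                   (rep-x (rep-hc b (N.<⇒≤ b<) N.≤-refl)))
                                 (rep-y^< (suc b) (s≤s b<) p)

    -- Since `hc h x y` is x times `hc (suc g) x y` plus y^(h-1), the second relation of `V`
    -- expresses y^(h-1) by normal monomials.
    rep-y^top : Rep (2 N.* suc g) (λ μ x y → y ^ suc g)
    rep-y^top = rep-≈ (λ μ x y v → begin
        sumTo (suc g) (λ b → coef b μ * hc b x y) + x * hc (suc g) x y   ≈⟨ +-congʳ (proj₂ v) ⟨
        hc h x y + x * hc (suc g) x y                                    ≈⟨ solve 2 (λ p q → (p :+ q) :+ p := q) refl (x * hc (suc g) x y) (y ^ suc g) ⟩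
        y ^ suc g                                                        ∎)
      (rep-+ (rep-sum (suc g) (λ b μ x y → coef b μ * hc b x y) term)
             (rep-weaken (N.≤-reflexive (≡.sym (N.*-suc 2 g))) (rep-x (rep-hc g N.≤-refl N.≤-refl))))
      where
      term : ∀ b → b N.≤ suc g → Rep (2 N.* suc g) (λ μ x y → coef b μ * hc b x y)
      term zero _ = rep-≈ (λ μ x y _ → sym (zeroʳ _)) rep-0
      term (suc b) (s≤s b≤g) = rep-coef (suc b) (λ μ x y → hc (suc b) x y) (λ k q →
        rep-weaken (0<·⇒ {k} {b} (N.≤-trans q (N.≤-reflexive (N.*-suc 2 (suc g))))) (rep-μ^ k (rep-hc b b≤g N.≤-refl)))

    rep-y-mono : ∀ {W} a b c → a N.+ 2 N.* (b N.+ c) N.≤ W → b N.< h → c N.< suc g →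
                 Rep (2 N.+ W) (λ μ x y → y * (μ ^ a * (x ^ b * y ^ c)))
    rep-y-mono {W} a b c p b< (s≤s c≤) = by-cases (N.m≤n⇒m<n∨m≡n c≤)
      where
      by-cases : c N.< g ⊎ c ≡ g → Rep (2 N.+ W) (λ μ x y → y * (μ ^ a * (x ^ b * y ^ c)))
      by-cases (inj₁ c<) = rep-≈ (λ μ x y _ → solve 4 (λ m y p q → m :* (p :* (y :* q)) := y :* (m :* (p :* q))) refl (μ ^ a) y (x ^ b) (y ^ c))
        (mono a b (suc c) (weight-y {a} {b} {c} p) b< (s≤s c<))
      by-cases (inj₂ ≡.refl) = rep-≈ (λ μ x y _ → solve 4 (λ m y p q → p :* (m :* (y :* q)) := y :* (m :* (p :* q))) refl (μ ^ a) y (x ^ b) (y ^ c))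
        (rep-weaken (weight-y-top {a} {b} {c} p) (rep-x^ b (rep-μ^ a rep-y^top)))

    rep-y : ∀ {W φ} → Rep W φ → Rep (2 N.+ W) (λ μ x y → y * φ μ x y)
    rep-y (mono a b c p b< c<) = rep-y-mono a b c p b< c<
    rep-y rep-0 = rep-≈ (λ μ x y _ → sym (zeroʳ _)) rep-0
    rep-y (rep-+ r r′) = rep-≈ (λ μ x y _ → sym (distribˡ _ _ _)) (rep-+ (rep-y r) (rep-y r′))
    rep-y (rep-* {φ} α r) = rep-≈ (λ μ x y _ → solve 3 (λ α m p → α :* (m :* p) := m :* (α :* p)) refl α y (φ μ x y)) (rep-* α (rep-y r))
    rep-y (rep-≈ e r) = rep-≈ (λ μ x y v → *-congˡ (e μ x y v)) (rep-y r)

    rep-y^ : ∀ k {W φ} → Rep W φ → Rep (2 N.* k N.+ W) (λ μ x y → y ^ k * φ μ x y)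
    rep-y^ zero r = rep-≈ (λ μ x y _ → sym (*-identityˡ _)) r
    rep-y^ (suc k) {W} r = rep-≈ (λ μ x y _ → sym (*-assoc _ _ _))
      (rep-weaken (N.≤-reflexive (≡.cong (N._+ W) (≡.sym (N.*-suc 2 k)))) (rep-y (rep-y^ k r)))

    H : ℕ
    H = h N.* suc g

    xdeg ydeg s : Fin H → ℕ
    xdeg j = toℕ (proj₁ (F.remQuot {h} (suc g) j))
    ydeg j = toℕ (proj₂ (F.remQuot {h} (suc g) j))
    s j = 2 N.* (xdeg j N.+ ydeg j)

    X : Fin H → Carrier → Carrier → Carrier
    X j x y = x ^ xdeg j * y ^ ydeg j

    -- The truncation T is left free so that rows of different weights can be evaluated at one
    -- common length.
    Expansion : ℕ → Fun → Set (c ⊔ ℓ)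
    Expansion W φ = ∃ λ (p : Fin H → ℕ → Carrier) → (∀ j k → W N.< k N.+ s j → p j k ≈ 0#) ×
      (∀ T → W N.≤ T → ∀ μ x y → V μ x y → φ μ x y ≈ ∑ (λ j → ev T (p j) μ * X j x y))

    expand-mono : ∀ {W} a (j₀ : Fin H) → a N.+ s j₀ N.≤ W → Expansion W (λ μ x y → μ ^ a * X j₀ x y)
    expand-mono {W} a j₀ p≤ = (λ j k → δ j₀ j * δℕ a k) , degree , value
      where
      degree : ∀ j k → W N.< k N.+ s j → δ j₀ j * δℕ a k ≈ 0#
      degree j k W< = by-cases (j₀ F.≟ j) (a N.≟ k)
        where
        by-cases : Dec (j₀ ≡ j) → Dec (a ≡ k) → δ j₀ j * δℕ a k ≈ 0#
        by-cases (no ne) _ = trans (*-congʳ (δ-≢ ne)) (zeroˡ _)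
        by-cases (yes _) (no ne) = trans (*-congˡ (δℕ-≢ ne)) (zeroʳ _)
        by-cases (yes ≡.refl) (yes ≡.refl) = contradiction p≤ (N.<⇒≱ W<)
      value : ∀ T → W N.≤ T → ∀ μ x y → V μ x y → μ ^ a * X j₀ x y ≈ ∑ (λ j → ev T (λ k → δ j₀ j * δℕ a k) μ * X j x y)
      value T W≤T μ x y _ = begin
        μ ^ a * X j₀ x y
          ≈⟨ ∑-δ (λ j → μ ^ a * X j x y) j₀ ⟨
        ∑ (λ j → (μ ^ a * X j x y) * δ j₀ j)
          ≈⟨ ∑-cong (λ j → (μ ^ a * X j x y) * δ j₀ j) (λ j → ev T (λ k → δ j₀ j * δℕ a k) μ * X j x y) (λ j → begin
              (μ ^ a * X j x y) * δ j₀ j     ≈⟨ solve 3 (λ m p d → (m :* p) :* d := (d :* m) :* p) refl (μ ^ a) (X j x y) (δ j₀ j) ⟩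
              (δ j₀ j * μ ^ a) * X j x y     ≈⟨ *-congʳ (*-congˡ (trans (sum-single T (λ k → δℕ a k * μ ^ k) a≤T
                  (λ k k≢a → trans (*-congʳ (δℕ-≢ (k≢a ∘ ≡.sym))) (zeroˡ _))) (trans (*-congʳ (δℕ-refl a)) (*-identityˡ _)))) ⟨
              (δ j₀ j * ev T (δℕ a) μ) * X j x y ≈⟨ *-congʳ (ev-*ˡ T (δ j₀ j) (δℕ a) μ) ⟨
              ev T (λ k → δ j₀ j * δℕ a k) μ * X j x y ∎) ⟩
        ∑ (λ j → ev T (λ k → δ j₀ j * δℕ a k) μ * X j x y) ∎
        where
        a≤T : a N.≤ T
        a≤T = N.≤-trans (N.m+n≤o⇒m≤o a p≤) W≤T

    expand : ∀ {W φ} → Rep W φ → Expansion W φ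
    expand {W} (mono a b c p b< c<) = ≡.subst₂ (λ b′ c′ → Expansion W (λ μ x y → μ ^ a * (x ^ b′ * y ^ c′))) xdeg≡ ydeg≡
      (expand-mono a j₀ (≡.subst₂ (λ b′ c′ → a N.+ 2 N.* (b′ N.+ c′) N.≤ W) (≡.sym xdeg≡) (≡.sym ydeg≡) p))
      where
      j₀ : Fin H
      j₀ = F.combine (fromℕ< b<) (fromℕ< c<)
      xdeg≡ : xdeg j₀ ≡ b
      xdeg≡ = ≡.trans (≡.cong (toℕ ∘ proj₁) (F.remQuot-combine (fromℕ< b<) (fromℕ< c<))) (F.toℕ-fromℕ< b<)
      ydeg≡ : ydeg j₀ ≡ c
      ydeg≡ = ≡.trans (≡.cong (toℕ ∘ proj₂) (F.remQuot-combine (fromℕ< b<) (fromℕ< c<))) (F.toℕ-fromℕ< c<)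
    expand rep-0 = (λ j k → 0#) , (λ j k _ → refl) ,
      λ T _ μ x y _ → sym (∑-0 (λ j → ev T (λ k → 0#) μ * X j x y) (λ j → trans (*-congʳ (sum-0 T (λ k _ → zeroˡ _))) (zeroˡ _)))
    expand (rep-+ r r′) with expand r | expand r′
    ... | p , p-deg , p-val | q , q-deg , q-val = (λ j k → p j k + q j k)
      , (λ j k W< → trans (+-cong (p-deg j k W<) (q-deg j k W<)) (+-identityˡ 0#))
      , λ T W≤T μ x y v → trans (+-cong (p-val T W≤T μ x y v) (q-val T W≤T μ x y v))
          (trans (sym (∑-+ (λ j → ev T (p j) μ * X j x y) (λ j → ev T (q j) μ * X j x y)))
            (∑-cong (λ j → ev T (p j) μ * X j x y + ev T (q j) μ * X j x y) (λ j → ev T (λ k → p j k + q j k) μ * X j x y)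
              (λ j → trans (sym (distribʳ _ _ _)) (*-congʳ (sym (ev-+ T (p j) (q j) μ))))))
    expand (rep-* α r) with expand r
    ... | p , p-deg , p-val = (λ j k → α * p j k)
      , (λ j k W< → trans (*-congˡ (p-deg j k W<)) (zeroʳ α))
      , λ T W≤T μ x y v → trans (*-congˡ (p-val T W≤T μ x y v))
          (trans (*-distribˡ-∑ α (λ j → ev T (p j) μ * X j x y))
            (∑-cong (λ j → α * (ev T (p j) μ * X j x y)) (λ j → ev T (λ k → α * p j k) μ * X j x y)
              (λ j → trans (sym (*-assoc _ _ _)) (*-congʳ (sym (ev-*ˡ T α (p j) μ))))))
    expand (rep-≈ e r) with expand r
    ... | p , p-deg , p-val = p , p-deg , λ T W≤T μ x y v → trans (sym (e μ x y v)) (p-val T W≤T μ x y v)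

    module Multiplication (n w : ℕ) (Γ : ℕ → ℕ → Carrier) (Γ-deg : ∀ b k → w N.< k N.+ 2 N.* b → Γ b k ≈ 0#) where
      G : Carrier → Carrier → Carrier
      G μ t = ev n (λ b → ev w (Γ b) μ) t

      G-sum : ∀ μ t φ → sumTo n (λ b → sumTo w (λ k → Γ b k * (μ ^ k * (t ^ b * φ)))) ≈ G μ t * φ
      G-sum μ t φ = trans (sum-cong n (λ b → trans
          (sum-cong w (λ k → solve 4 (λ a m t p → a :* (m :* (t :* p)) := (a :* m) :* (t :* p)) refl (Γ b k) (μ ^ k) (t ^ b) φ))
          (trans (sum-*ʳ w (t ^ b * φ) (λ k → Γ b k * μ ^ k)) (sym (*-assoc _ _ _)))))
        (sum-*ʳ n φ (λ b → ev w (Γ b) μ * t ^ b))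

      rep-G : ∀ {W} {φ : Fun} (t : Carrier → Carrier → Carrier) →
              (∀ k → Rep (2 N.* k N.+ W) (λ μ x y → t x y ^ k * φ μ x y)) →
              Rep (w N.+ W) (λ μ x y → G μ (t x y) * φ μ x y)
      rep-G {W} {φ} t r = rep-≈ (λ μ x y _ → G-sum μ (t x y) (φ μ x y))
        (rep-sum n (λ b μ x y → sumTo w (λ k → Γ b k * (μ ^ k * (t x y ^ b * φ μ x y)))) (λ b _ →
          rep-sum w (λ k μ x y → Γ b k * (μ ^ k * (t x y ^ b * φ μ x y))) (λ k _ →
            rep-scaled (Γ b k) (k N.+ 2 N.* b N.≤? w) (λ ≰ → Γ-deg b k (N.≰⇒> ≰)) (λ ≤w →
              rep-weaken (N.≤-trans (N.≤-reflexive (≡.sym (N.+-assoc k (2 N.* b) W))) (N.+-monoˡ-≤ W ≤w))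
                (rep-μ^ k (r b))))))

      z : Fun
      z μ x y = G μ x + G μ y

      zX : ∀ i → Expansion (w N.+ s i) (λ μ x y → z μ x y * X i x y)
      zX i = expand (rep-≈ (λ μ x y _ → sym (distribʳ _ _ _))
          (rep-+ (rep-G (λ x y → x) (λ k → rep-x^ k base)) (rep-G (λ x y → y) (λ k → rep-y^ k base))))
        where
        base : Rep (s i) (λ μ x y → X i x y)
        base = rep-≈ (λ μ x y _ → *-identityˡ _)
          (mono 0 (xdeg i) (ydeg i) N.≤-refl (F.toℕ<n _) (F.toℕ<n _))

      Z : Fin H → Fin H → ℕ → Carrier
      Z i = proj₁ (zX i)

      Z-deg : ∀ i j k → w N.+ s i N.< k N.+ s j → Z i j k ≈ 0#
      Z-deg i = proj₁ (proj₂ (zX i))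

      Z-value : ∀ i T → w N.+ s i N.≤ T → ∀ μ x y → V μ x y → z μ x y * X i x y ≈ ∑ (λ j → ev T (Z i j) μ * X j x y)
      Z-value i = proj₂ (proj₂ (zX i))

  -- The polynomials (u + 1)^k + u^k in u² + u

  shift : (ℕ → Carrier) → ℕ → Carrier
  shift p zero = 0#
  shift p (suc k) = p k

  -- ε k is the polynomial in t = u² + u with value (u + 1)^k + u^k.
  ε : ℕ → ℕ → Carrier
  ε zero i = 0#
  ε (suc zero) zero = 1#
  ε (suc zero) (suc i) = 0#
  ε (suc (suc k)) i = ε (suc k) i + shift (ε k) i

  -- A Lucas sequence: u and u + 1 are the roots of X² + X + t, and E is the sequence of their power
  -- sums.
  E : ℕ → Carrier → Carrier
  E zero t = 0#
  E (suc zero) t = 1#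
  E (suc (suc k)) t = E (suc k) t + t * E k t

  ε-deg : ∀ k i → k N.≤ 2 N.* i → ε k i ≈ 0#
  ε-deg zero i _ = refl
  ε-deg (suc zero) (suc i) _ = refl
  ε-deg (suc (suc k)) (suc i) p = trans (+-cong (ε-deg (suc k) (suc i) (N.≤-trans (N.n≤1+n _) p))
    (ε-deg k i (N.≤-pred (N.≤-pred (N.≤-trans p (N.≤-reflexive (N.*-suc 2 i))))))) (+-identityˡ 0#)

  ε-lead : ∀ i → ε (suc (2 N.* i)) i ≈ 1#
  ε-lead zero = refl
  ε-lead (suc i) = ≡.subst (λ k → ε (suc k) (suc i) ≈ 1#) (≡.sym (N.*-suc 2 i))
    (trans (+-cong (ε-deg (suc (suc (2 N.* i))) (suc i) (N.≤-reflexive (≡.sym (N.*-suc 2 i)))) (ε-lead i)) (+-identityˡ 1#))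

  -- For i = d the value is d + 1 times 1, which is 0 because d is odd. Thus a₀ does not reach the
  -- coefficient of t^d in G, and a₁ μ alone remains.
  ε-sublead : ∀ i → ε (2 N.+ 2 N.* i) i ≈ suc i · 1#
  ε-sublead zero = refl
  ε-sublead (suc i) = trans (+-cong (ε-lead (suc i)) (lower i)) refl
    where
    lower : ∀ i → shift (ε (2 N.* suc i)) (suc i) ≈ suc i · 1#
    lower i = ≡.subst (λ k → ε k i ≈ suc i · 1#) (≡.sym (N.*-suc 2 i)) (ε-sublead i)

  even·1≈0 : ∀ k → (2 N.* k) · 1# ≈ 0#
  even·1≈0 zero = refl
  even·1≈0 (suc k) = ≡.subst (λ j → j · 1# ≈ 0#) (≡.sym (N.*-suc 2 k)) (trans (+-congˡ (+-congˡ (even·1≈0 k))) (solve 0 (:1 :+ (:1 :+ :0) := :0) refl))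

  ev-shift : ∀ n p t → ev (suc n) (shift p) t ≈ t * ev n p t
  ev-shift n p t = trans (ev-head n (shift p) t) (+-identityˡ _)

  ev-ε : ∀ n k t → k N.≤ 2 N.+ 2 N.* n → ev n (ε k) t ≈ E k t
  ev-ε n zero t _ = sum-0 n (λ k _ → zeroˡ _)
  ev-ε n (suc zero) t _ = trans (sum-single n _ z≤n (λ { zero 0≢0 → contradiction ≡.refl 0≢0 ; (suc k) _ → zeroˡ _ })) (*-identityʳ 1#)
  ev-ε zero (suc (suc zero)) t _ = solve 1 (λ t → (:1 :+ :0) :* :1 := :1 :+ t :* :0) refl t
  ev-ε zero (suc (suc (suc k))) t (s≤s (s≤s ()))
  ev-ε (suc n) (suc (suc k)) t p = trans (ev-+ (suc n) (ε (suc k)) (shift (ε k)) t)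
    (+-cong (ev-ε (suc n) (suc k) t (N.≤-trans (N.n≤1+n _) p))
      (trans (ev-shift n (ε k) t) (*-congˡ (ev-ε n k t (N.≤-trans (N.≤-pred (N.≤-pred p)) (N.≤-reflexive (N.*-suc 2 n)))))))

  E-cong : ∀ k {s t} → s ≈ t → E k s ≈ E k t
  E-cong zero e = refl
  E-cong (suc zero) e = refl
  E-cong (suc (suc k)) e = +-cong (E-cong (suc k) e) (*-cong e (E-cong k e))

  E-power : ∀ k u → E k (u * u + u) ≈ (u + 1#) ^ k + u ^ k
  E-power zero u = sym char2
  E-power (suc zero) u = solve 1 (λ u → :1 := (u :+ :1) :* :1 :+ u :* :1) refl u
  E-power (suc (suc k)) u = trans (+-cong (E-power (suc k) u) (*-congˡ (E-power k u)))
    (solve 3 (λ u p q → ((u :+ :1) :* p :+ u :* q) :+ (u :* u :+ u) :* (p :+ q) := (u :+ :1) :* ((u :+ :1) :* p) :+ u :* (u :* q)) refl u ((u + 1#) ^ k) (u ^ k))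

  -- The derivative of `E k` in t, obtained by differentiating the recurrence.
  E′ : ℕ → Carrier → Carrier
  E′ zero t = 0#
  E′ (suc zero) t = 0#
  E′ (suc (suc k)) t = E′ (suc k) t + (E k t + t * E′ k t)

  der-+ : ∀ n p q t → der n (λ k → p k + q k) t ≈ der n p t + der n q t
  der-+ n p q t = trans (sum-cong n (λ k → trans (*-congʳ (·-+ k (p k) (q k))) (distribʳ _ _ _))) (sum-+ n _ _)
    where
    ·-+ : ∀ k x y → k · (x + y) ≈ k · x + k · y
    ·-+ zero x y = sym (+-identityˡ 0#)
    ·-+ (suc k) x y = trans (+-congˡ (·-+ k x y)) (solve 4 (λ x y p q → (x :+ y) :+ (p :+ q) := (x :+ p) :+ (y :+ q)) refl x y (k · x) (k · y))

  der-shift : ∀ n p t → der (suc n) (shift p) t ≈ ev n p t + t * der n p t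
  der-shift n p t = begin
    der (suc n) (shift p) t                                    ≈⟨ sum-head n _ ⟩
    0# * 1# + sumTo n (λ k → (suc k · p k) * t ^ k)            ≈⟨ trans (+-congʳ (zeroˡ 1#)) (+-identityˡ _) ⟩
    sumTo n (λ k → (suc k · p k) * t ^ k)                      ≈⟨ sum-cong n (λ k → trans (distribʳ _ _ _) (+-congˡ (lower k))) ⟩
    sumTo n (λ k → p k * t ^ k + t * ((k · p k) * t ^ (k N.∸ 1)))  ≈⟨ trans (sum-+ n _ _) (+-congˡ (sum-*ˡ n t _)) ⟩
    ev n p t + t * der n p t                                   ∎
    where
    lower : ∀ k → (k · p k) * t ^ k ≈ t * ((k · p k) * t ^ (k N.∸ 1))
    lower zero = trans (zeroˡ _) (sym (trans (*-congˡ (zeroˡ _)) (zeroʳ t)))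
    lower (suc k) = solve 3 (λ a t p → a :* (t :* p) := t :* (a :* p)) refl (suc k · p (suc k)) t (t ^ k)

  der-ε : ∀ n k t → k N.≤ 2 N.+ 2 N.* n → der n (ε k) t ≈ E′ k t
  der-ε n zero t _ = sum-0 n (λ k _ → trans (*-congʳ (·-0 k)) (zeroˡ _))
    where
    ·-0 : ∀ k → k · 0# ≈ 0#
    ·-0 zero = refl
    ·-0 (suc k) = trans (+-identityˡ _) (·-0 k)
  der-ε n (suc zero) t _ = sum-0 n (λ { zero _ → zeroˡ _ ; (suc k) _ → trans (*-congʳ (·-0 (suc k))) (zeroˡ _) })
    where
    ·-0 : ∀ k → k · 0# ≈ 0#
    ·-0 zero = refl
    ·-0 (suc k) = trans (+-identityˡ _) (·-0 k)
  der-ε zero (suc (suc zero)) t _ = solve 1 (λ t → :0 :* :1 := :0 :+ (:0 :+ t :* :0)) refl t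
  der-ε zero (suc (suc (suc k))) t (s≤s (s≤s ()))
  der-ε (suc n) (suc (suc k)) t p = trans (der-+ (suc n) (ε (suc k)) (shift (ε k)) t)
    (+-cong (der-ε (suc n) (suc k) t (N.≤-trans (N.n≤1+n _) p))
      (trans (der-shift n (ε k) t) (+-cong (ev-ε n k t p′) (*-congˡ (der-ε n k t p′)))))
    where
    p′ = N.≤-trans (N.≤-pred (N.≤-pred p)) (N.≤-reflexive (N.*-suc 2 n))

  E-even-odd : ∀ j t → E (2 N.* j) t ≈ E j t * E j t × E (suc (2 N.* j)) t ≈ E (suc j) t * E (suc j) t + t * (E j t * E j t)
  E-even-odd zero t = sym (zeroˡ 0#) , solve 1 (λ t → :1 := :1 :* :1 :+ t :* (:0 :* :0)) refl t
  E-even-odd (suc j) t = ≡.subst (λ k → E k t ≈ E (suc j) t * E (suc j) t × E (suc k) t ≈ E (suc (suc j)) t * E (suc (suc j)) t + t * (E (suc j) t * E (suc j) t))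
    (≡.sym (N.*-suc 2 j)) (even′ , trans (+-cong even′ (*-congˡ odd))
      (solve 3 (λ x y t → y :* y :+ t :* (y :* y :+ t :* (x :* x)) := (y :+ t :* x) :* (y :+ t :* x) :+ t :* (y :* y)) refl (E j t) (E (suc j) t) t))
    where
    even = proj₁ (E-even-odd j t)
    odd = proj₂ (E-even-odd j t)
    even′ : E (suc (2 N.* j)) t + t * E (2 N.* j) t ≈ E (suc j) t * E (suc j) t
    even′ = trans (+-cong odd (*-congˡ even)) (solve 2 (λ x y → (x :+ y) :+ y := x) refl _ _)

  -- Squares have derivative 0, so in `E-even-odd` only the summand t (E j t)² contributes. This is
  -- why ∂G/∂t is a square up to a factor, and why C involves only the odd-indexed coefficients of
  -- f.
  E′-even-odd : ∀ j t → E′ (2 N.* j) t ≈ 0# × E′ (suc (2 N.* j)) t ≈ E j t * E j t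
  E′-even-odd zero t = refl , sym (zeroˡ 0#)
  E′-even-odd (suc j) t = ≡.subst (λ k → E′ k t ≈ 0# × E′ (suc k) t ≈ E (suc j) t * E (suc j) t)
    (≡.sym (N.*-suc 2 j)) (even′ , trans (+-cong even′ (+-cong odd (*-congˡ odd-E′)))
      (solve 2 (λ x y → :0 :+ ((x :+ y) :+ y) := x) refl _ _))
    where
    even = proj₁ (E-even-odd j t)
    odd = proj₂ (E-even-odd j t)
    even-E′ = proj₁ (E′-even-odd j t)
    odd-E′ = proj₂ (E′-even-odd j t)
    even′ : E′ (suc (2 N.* j)) t + (E (2 N.* j) t + t * E′ (2 N.* j) t) ≈ 0#
    even′ = trans (+-cong odd-E′ (+-cong even (*-congˡ even-E′))) (solve 2 (λ x t → x :+ (x :+ t :* :0) := :0) refl _ t)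

  artinSchreier : ∀ t → ∃ λ u → u * u + u ≈ t
  artinSchreier t with algClosed 2 p (s≤s z≤n) 1≉0
    where
    p : ℕ → Carrier
    p zero = t
    p (suc k) = 1#
  ... | u , root = u , +-cancel-0 (trans (solve 2 (λ u t → (u :* u :+ u) :+ t := (t :* :1 :+ :1 :* (u :* :1)) :+ :1 :* (u :* (u :* :1))) refl u t) root)

  -- The fibre μ = 0

  ^-comm : ∀ x j k → (x ^ j) ^ k ≈ (x ^ k) ^ j
  ^-comm x j k = trans (^-^ x j k) (trans (^-cong-≡ x (N.*-comm j k)) (sym (^-^ x k j)))

  frob-2 : ∀ k x → x ^ (2 N.^ suc k) ≈ (x * x) ^ (2 N.^ k)
  frob-2 k x = trans (sym (^-^ x 2 (2 N.^ k))) (^-cong (2 N.^ k) (^2≈* x))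

  -- Inverses would give only the double negation. Directly, x is a power of x * x, because some
  -- iterate of Frobenius fixes x.
  square≈0 : ∀ {x} → x * x ≈ 0# → x ≈ 0#
  square≈0 {x} e with algebraic x
  ... | suc k , _ , fix = trans (sym fix) (trans (frob-2 k x) (trans (^-cong (2 N.^ k) e) (0^ (2 N.^ k) (N.m^n>0 2 k))))

  frob≈0 : ∀ k {x} → x ^ (2 N.^ k) ≈ 0# → x ≈ 0#
  frob≈0 zero e = trans (sym (*-identityʳ _)) e
  frob≈0 (suc k) {x} e = square≈0 (frob≈0 k (trans (sym (frob-2 k x)) e))

  frob-injective : ∀ k {x y} → x ^ (2 N.^ k) ≈ y ^ (2 N.^ k) → x ≈ y
  frob-injective k {x} {y} e = +-cancel-0 (frob≈0 k (trans (frob k x y) (≈⇒+≈0 e)))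

  -- Membership in the field with 2^k elements.
  Fixed : ℕ → Carrier → Set ℓ
  Fixed k x = x ^ (2 N.^ k) ≈ x

  fixed-+ : ∀ {x} j k → Fixed j x → x ^ (2 N.^ (j N.+ k)) ≈ x ^ (2 N.^ k)
  fixed-+ {x} j k e = trans (^-cong-≡ x (N.^-distribˡ-+-* 2 j k)) (trans (sym (^-^ x (2 N.^ j) (2 N.^ k))) (^-cong (2 N.^ k) e))

  fixed-* : ∀ {x} k n → Fixed k x → Fixed (n N.* k) x
  fixed-* k zero e = *-identityʳ _
  fixed-* k (suc n) e = trans (fixed-+ k (n N.* k) e) (fixed-* k n e)

  -- Bézout makes the gcd a difference of multiples of r and l, and Frobenius iterated by either
  -- multiple fixes x.
  fixed-gcd : ∀ {x} r l → Fixed r x → Fixed l x → Fixed (gcd r l) x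
  fixed-gcd {x} r l er el with Bézout.identity (gcd-GCD r l)
  ... | Bézout.+- p q eq = begin
    x ^ (2 N.^ g)                   ≈⟨ fixed-+ (q N.* l) g (fixed-* l q el) ⟨
    x ^ (2 N.^ (q N.* l N.+ g))     ≡⟨ ≡.cong (λ k → x ^ (2 N.^ k)) (≡.trans (N.+-comm (q N.* l) g) eq) ⟩
    x ^ (2 N.^ (p N.* r))           ≈⟨ fixed-* r p er ⟩
    x                               ∎
    where g = gcd r l
  ... | Bézout.-+ p q eq = begin
    x ^ (2 N.^ g)                   ≈⟨ fixed-+ (p N.* r) g (fixed-* r p er) ⟨
    x ^ (2 N.^ (p N.* r N.+ g))     ≡⟨ ≡.cong (λ k → x ^ (2 N.^ k)) (≡.trans (N.+-comm (p N.* r) g) eq) ⟩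
    x ^ (2 N.^ (q N.* l))           ≈⟨ fixed-* l q el ⟩
    x                               ∎
    where g = gcd r l

  fixed-1∨2 : ∀ {x} g → g ≡ 1 ⊎ g ≡ 2 → Fixed g x → x ^ 4 ≈ x
  fixed-1∨2 {x} _ (inj₁ ≡.refl) e = trans (solve 1 (λ x → x :* (x :* (x :* (x :* :1))) := (x :* (x :* :1)) :* (x :* (x :* :1))) refl x)
    (trans (*-cong e e) (trans (sym (^2≈* x)) e))
  fixed-1∨2 _ (inj₂ ≡.refl) e = e

  -- Over μ = 0 the critical points are t = u² + u with (u + 1)^d = u^d, and the critical
  -- values are (u^q + u + 1)^(2^r) up to a constant, with q = 2^l.
  module Infinity (r′ l d : ℕ) (gcd≡ : gcd (suc r′) l ≡ 1 ⊎ gcd (suc r′) l ≡ 2)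
    (1≤d : 1 N.≤ d) (d≡ : suc d ≡ 2 N.^ r′ N.* (2 N.^ l N.+ 1)) where

    Q q : ℕ
    Q = 2 N.^ r′
    q = 2 N.^ l

    norm : ∀ u → u ^ (q N.+ 1) ≈ u ^ q * u
    norm u = trans (^-+ u q 1) (*-congˡ (*-identityʳ u))

    norm-u+1 : ∀ u → (u + 1#) ^ (q N.+ 1) ≈ u ^ q * u + ((u ^ q + u) + 1#)
    norm-u+1 u = trans (norm (u + 1#)) (trans (*-congʳ (trans (frob l u 1#) (+-congˡ (1^ q))))
      (solve 2 (λ p u → (p :+ :1) :* (u :+ :1) := p :* u :+ ((p :+ u) :+ :1)) refl (u ^ q) u))

    value : ∀ u → E (2 N.* suc d) (u * u + u) ≈ ((u ^ q + u) + 1#) ^ (2 N.^ suc r′)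
    value u = begin
      E (2 N.* suc d) (u * u + u)                                ≈⟨ E-power (2 N.* suc d) u ⟩
      (u + 1#) ^ (2 N.* suc d) + u ^ (2 N.* suc d)               ≈⟨ +-cong (pow (u + 1#)) (pow u) ⟩
      ((u + 1#) ^ (q N.+ 1)) ^ R + (u ^ (q N.+ 1)) ^ R           ≈⟨ frob (suc r′) _ _ ⟨
      ((u + 1#) ^ (q N.+ 1) + u ^ (q N.+ 1)) ^ R                 ≈⟨ ^-cong R (trans (+-cong (norm-u+1 u) (norm u))
                                                                     (solve 2 (λ a b → (a :+ b) :+ a := b) refl _ _)) ⟩
      ((u ^ q + u) + 1#) ^ R                                     ∎
      where
      R = 2 N.^ suc r′
      exponent : 2 N.* suc d ≡ (q N.+ 1) N.* R
      exponent = ≡.trans (≡.cong (2 N.*_) d≡) (≡.trans (≡.sym (N.*-assoc 2 Q (q N.+ 1))) (N.*-comm R (q N.+ 1)))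
      pow : ∀ x → x ^ (2 N.* suc d) ≈ (x ^ (q N.+ 1)) ^ R
      pow x = trans (^-cong-≡ x exponent) (sym (^-^ x (q N.+ 1) R))

    module Critical (u : Carrier) (crit : (u + 1#) ^ d ≈ u ^ d) where
      u≉0 : ¬ u ≈ 0#
      u≉0 u≈0 = 1≉0 (begin
        1#            ≈⟨ 1^ d ⟨
        1# ^ d        ≈⟨ ^-cong d (trans (+-congʳ u≈0) (+-identityˡ 1#)) ⟨
        (u + 1#) ^ d  ≈⟨ crit ⟩
        u ^ d         ≈⟨ ^-cong d u≈0 ⟩
        0# ^ d        ≈⟨ 0^ d 1≤d ⟩
        0#            ∎)

      u+1≉0 : ¬ u + 1# ≈ 0#
      u+1≉0 e = 1≉0 (begin
        1#            ≈⟨ 1^ d ⟨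
        1# ^ d        ≈⟨ ^-cong d (+-cancel-0 e) ⟨
        u ^ d         ≈⟨ crit ⟨
        (u + 1#) ^ d  ≈⟨ ^-cong d e ⟩
        0# ^ d        ≈⟨ 0^ d 1≤d ⟩
        0#            ∎)

      -- Multiplying (u + 1)^d = u^d by u(u + 1) raises the exponents to d + 1 = Q(q + 1), so u N(u
      -- + 1)^Q = (u + 1) N(u)^Q with N(u) = u^q u. Inserting N(u + 1) = N(u) + (u^q + u + 1)
      -- cancels u N(u)^Q.
      key : (u ^ q * u) ^ Q ≈ u * ((u ^ q + u) + 1#) ^ Q
      key = +-cancel-0 (begin
        n + u * b               ≈⟨ solve 3 (λ n u b → n :+ u :* b := u :* (n :+ b) :+ (u :+ :1) :* n) refl n u b ⟩
        u * (n + b) + (u + 1#) * n  ≈⟨ +-cong (*-congˡ pow-u+1) (*-congˡ pow-u) ⟨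
        u * (u + 1#) ^ suc d + (u + 1#) * u ^ suc d  ≈⟨ +-congʳ (*-congˡ (*-congˡ crit)) ⟩
        u * ((u + 1#) * u ^ d) + (u + 1#) * (u * u ^ d) ≈⟨ solve 3 (λ a b x → a :* (b :* x) :+ b :* (a :* x) := :0) refl u (u + 1#) (u ^ d) ⟩
        0#                      ∎)
        where
        n = (u ^ q * u) ^ Q
        b = ((u ^ q + u) + 1#) ^ Q
        pow : ∀ x → x ^ suc d ≈ (x ^ (q N.+ 1)) ^ Q
        pow x = trans (^-cong-≡ x (≡.trans d≡ (N.*-comm Q (q N.+ 1)))) (sym (^-^ x (q N.+ 1) Q))
        pow-u : u ^ suc d ≈ n
        pow-u = trans (pow u) (^-cong Q (norm u))
        pow-u+1 : (u + 1#) ^ suc d ≈ n + b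
        pow-u+1 = trans (pow (u + 1#)) (trans (^-cong Q (norm-u+1 u)) (frob r′ _ _))

      -- If u^q = u, then `key` reads u^(2Q) = u, so the gcd hypothesis gives u^4 = u. As u^4 + u =
      -- u(u + 1)(u² + u + 1) and a critical u is neither 0 nor 1, the last factor vanishes.
      trace0⇒t≈1 : u ^ q + u ≈ 0# → u * u + u ≈ 1#
      trace0⇒t≈1 s≈0 = +-cancel-0 (*-cancelˡ-0 (*-≉0 u≉0 u+1≉0) (begin
        (u * (u + 1#)) * ((u * u + u) + 1#)   ≈⟨ solve 1 (λ u → (u :* (u :+ :1)) :* ((u :* u :+ u) :+ :1) := (u :* (u :* (u :* (u :* :1)))) :+ u) refl u ⟩
        u ^ 4 + u                             ≈⟨ ≈⇒+≈0 (fixed-1∨2 (gcd (suc r′) l) gcd≡ (fixed-gcd (suc r′) l fixed-r fixed-l)) ⟩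
        0#                                    ∎))
        where
        fixed-l : Fixed l u
        fixed-l = +-cancel-0 s≈0
        fixed-r : Fixed (suc r′) u
        fixed-r = begin
          u ^ (2 N.^ suc r′)               ≈⟨ frob-2 r′ u ⟩
          (u * u) ^ Q                      ≈⟨ ^-cong Q (*-congʳ fixed-l) ⟨
          (u ^ q * u) ^ Q                  ≈⟨ key ⟩
          u * ((u ^ q + u) + 1#) ^ Q       ≈⟨ *-congˡ (trans (^-cong Q (trans (+-congʳ s≈0) (+-identityˡ 1#))) (1^ Q)) ⟩
          u * 1#                           ≈⟨ *-identityʳ u ⟩
          u                                ∎

    -- Here `relation` makes S the quotient (P² + w)/(P + w) of elements of 𝔽_q, so the common trace
    -- s lies in 𝔽_q. Then N(u) and A = (s + 1)^Q are fixed by x ↦ x^q, and so is u, because u A =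
    -- N(u)^Q; hence s = 0.
    traces-distinct : ∀ u v → (u + 1#) ^ d ≈ u ^ d → (v + 1#) ^ d ≈ v ^ d →
      ¬ (u * u + u ≈ v * v + v) → ¬ (u ^ q + u ≈ v ^ q + v)
    traces-distinct u v crit-u crit-v t≉ s≈ = t≉ (trans (U.trace0⇒t≈1 s≈0) (sym (V.trace0⇒t≈1 (trans (sym s≈) s≈0))))
      where
      module U = Critical u crit-u
      module V = Critical v crit-v
      w = u + v
      s = u ^ q + u
      P = w ^ Q
      S = s ^ Q
      w-fixed : w ^ q ≈ w
      w-fixed = begin
        w ^ q            ≈⟨ frob l u v ⟩
        u ^ q + v ^ q    ≈⟨ solve 4 (λ a u b v → a :+ b := (a :+ u) :+ ((b :+ v) :+ (u :+ v))) refl (u ^ q) u (v ^ q) v ⟩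
        s + ((v ^ q + v) + w)  ≈⟨ +-congˡ (+-congʳ s≈) ⟨
        s + (s + w)      ≈⟨ solve 2 (λ s w → s :+ (s :+ w) := w) refl s w ⟩
        w                ∎
      -- The sum of the two key relations, with N(u) + N(v) = w s + w² raised to the power Q.
      relation : S * (P + w) ≈ P * P + w
      relation = +-cancel-0 (begin
        S * (P + w) + (P * P + w)              ≈⟨ solve 3 (λ S P w → S :* (P :+ w) :+ (P :* P :+ w) := (P :* S :+ P :* P) :+ w :* (S :+ :1)) refl S P w ⟩
        (P * S + P * P) + w * (S + 1#)         ≈⟨ +-cong (+-cong (^-distrib-* w s Q) (^-distrib-* w w Q)) (*-congˡ (trans (frob r′ s 1#) (+-congˡ (1^ Q)))) ⟨
        ((w * s) ^ Q + (w * w) ^ Q) + w * (s + 1#) ^ Q ≈⟨ +-congʳ (frob r′ (w * s) (w * w)) ⟨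
        (w * s + w * w) ^ Q + w * (s + 1#) ^ Q ≈⟨ +-cong (^-cong Q norms) refl ⟩
        (u ^ q * u + v ^ q * v) ^ Q + w * (s + 1#) ^ Q ≈⟨ +-congʳ (frob r′ _ _) ⟩
        ((u ^ q * u) ^ Q + (v ^ q * v) ^ Q) + w * (s + 1#) ^ Q ≈⟨ +-congʳ (+-cong U.key (trans V.key (*-congˡ (^-cong Q (+-congʳ (sym s≈)))))) ⟩
        (u * (s + 1#) ^ Q + v * (s + 1#) ^ Q) + (u + v) * (s + 1#) ^ Q ≈⟨ solve 3 (λ u v a → (u :* a :+ v :* a) :+ (u :+ v) :* a := :0) refl u v _ ⟩
        0#                                     ∎)
        where
        norms : w * s + w * w ≈ u ^ q * u + v ^ q * v
        norms = begin
          w * s + w * w           ≈⟨ +-congˡ (*-congʳ w-fixed) ⟨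
          w * s + w ^ q * w       ≈⟨ +-congˡ (*-congʳ (frob l u v)) ⟩
          w * s + (u ^ q + v ^ q) * w ≈⟨ solve 4 (λ a u b v → (u :+ v) :* (a :+ u) :+ (a :+ b) :* (u :+ v)
                                            := (a :* u :+ b :* v) :+ (u :* ((a :+ u) :+ (b :+ v)))) refl (u ^ q) u (v ^ q) v ⟩
          (u ^ q * u + v ^ q * v) + u * (s + (v ^ q + v)) ≈⟨ +-congˡ (trans (*-congˡ (≈⇒+≈0 s≈)) (zeroʳ u)) ⟩
          (u ^ q * u + v ^ q * v) + 0#  ≈⟨ +-identityʳ _ ⟩
          u ^ q * u + v ^ q * v   ∎
      -- P = w would turn `relation` into w² + w = 0, that is, u² + u = v² + v.
      P+w≉0 : ¬ P + w ≈ 0#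
      P+w≉0 e = t≉ (+-cancel-0 (begin
        (u * u + u) + (v * v + v)  ≈⟨ solve 2 (λ u v → (u :* u :+ u) :+ (v :* v :+ v) := (u :+ v) :* (u :+ v) :+ (u :+ v)) refl u v ⟩
        w * w + w                  ≈⟨ +-congʳ (*-cong (+-cancel-0 e) (+-cancel-0 e)) ⟨
        P * P + w                  ≈⟨ relation ⟨
        S * (P + w)                ≈⟨ trans (*-congˡ e) (zeroʳ S) ⟩
        0#                         ∎))
      P-fixed : P ^ q ≈ P
      P-fixed = trans (^-comm w Q q) (^-cong Q w-fixed)
      S-fixed : S ^ q ≈ S
      S-fixed = *-cancelˡ P+w≉0 (begin
        (P + w) * S ^ q          ≈⟨ *-congʳ (trans (frob l P w) (+-cong P-fixed w-fixed)) ⟨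
        (P + w) ^ q * S ^ q      ≈⟨ trans (^-distrib-* _ _ q) refl ⟨
        ((P + w) * S) ^ q        ≈⟨ ^-cong q (trans (*-comm _ _) relation) ⟩
        (P * P + w) ^ q          ≈⟨ trans (frob l _ w) (+-cong (trans (^-distrib-* P P q) (*-cong P-fixed P-fixed)) w-fixed) ⟩
        P * P + w                ≈⟨ trans (*-comm _ _) relation ⟨
        (P + w) * S              ∎)
      s-fixed : s ^ q ≈ s
      s-fixed = frob-injective r′ (trans (sym (^-comm s Q q)) S-fixed)
      u-fixed² : (u ^ q) ^ q ≈ u
      u-fixed² = begin
        (u ^ q) ^ q                     ≈⟨ solve 2 (λ a b → a := (a :+ b) :+ b) refl _ (u ^ q) ⟩
        ((u ^ q) ^ q + u ^ q) + u ^ q   ≈⟨ +-congʳ (trans (sym (frob l (u ^ q) u)) s-fixed) ⟩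
        (u ^ q + u) + u ^ q             ≈⟨ solve 2 (λ a u → (a :+ u) :+ a := u) refl _ u ⟩
        u                               ∎
      A = (s + 1#) ^ Q
      A-fixed : A ^ q ≈ A
      A-fixed = trans (^-comm (s + 1#) Q q) (^-cong Q (trans (frob l s 1#) (+-cong s-fixed (1^ q))))
      A≉0 : ¬ A ≈ 0#
      A≉0 A≈0 = *-≉0 (^-≉0 q U.u≉0) U.u≉0 (frob≈0 r′ (trans U.key (trans (*-congˡ A≈0) (zeroʳ u))))
      s≈0 : s ≈ 0#
      s≈0 = *-cancelˡ-0 A≉0 (begin
        A * (u ^ q + u)          ≈⟨ solve 3 (λ A a u → A :* (a :+ u) := a :* A :+ u :* A) refl A (u ^ q) u ⟩
        u ^ q * A + u * A        ≈⟨ ≈⇒+≈0 (begin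
          u ^ q * A              ≈⟨ *-congˡ A-fixed ⟨
          u ^ q * A ^ q          ≈⟨ ^-distrib-* u A q ⟨
          (u * A) ^ q            ≈⟨ ^-cong q U.key ⟨
          ((u ^ q * u) ^ Q) ^ q  ≈⟨ ^-comm _ Q q ⟩
          ((u ^ q * u) ^ q) ^ Q  ≈⟨ ^-cong Q (trans (^-distrib-* _ u q) (trans (*-congʳ u-fixed²) (*-comm _ _))) ⟩
          (u ^ q * u) ^ Q        ≈⟨ U.key ⟩
          u * A                  ∎) ⟩
        0#                       ∎)

    values-distinct : ∀ t₁ t₂ → E d t₁ ≈ 0# → E d t₂ ≈ 0# → ¬ t₁ ≈ t₂ → ¬ E (2 N.* suc d) t₁ ≈ E (2 N.* suc d) t₂
    values-distinct t₁ t₂ e₁ e₂ t≉ e with artinSchreier t₁ | artinSchreier t₂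
    ... | u , u-t | v , v-t = traces-distinct u v (crit u-t e₁) (crit v-t e₂)
        (λ z → t≉ (trans (sym u-t) (trans z v-t)))
        (+-cancelʳ-1 (frob-injective (suc r′) (trans (sym (value u)) (trans (E-cong (2 N.* suc d) u-t)
          (trans e (trans (E-cong (2 N.* suc d) (sym v-t)) (value v)))))))
      where
      crit : ∀ {u t} → u * u + u ≈ t → E d t ≈ 0# → (u + 1#) ^ d ≈ u ^ d
      crit {u} u-t e = +-cancel-0 (trans (sym (E-power d u)) (trans (E-cong d u-t) e))
      +-cancelʳ-1 : ∀ {x y} → x + 1# ≈ y + 1# → x ≈ y
      +-cancelʳ-1 {x} {y} e = +-cancel-0 (trans (solve 2 (λ x y → x :+ y := (x :+ :1) :+ (y :+ :1)) refl x y) (≈⇒+≈0 e))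

  -- Products and reindexing

  sum-rev : ∀ n (f : ℕ → Carrier) → sumTo n (λ k → f (n N.∸ k)) ≈ sumTo n f
  sum-rev zero f = refl
  sum-rev (suc n) f = trans (sum-head n (λ k → f (suc n N.∸ k))) (trans (+-comm _ _) (+-congʳ (sum-rev n f)))

  ^-inverse : ∀ {α μ} n k → k N.≤ n → α * μ ≈ 1# → α ^ n * μ ^ k ≈ α ^ (n N.∸ k)
  ^-inverse {α} {μ} n k k≤n inv = begin
    α ^ n * μ ^ k                     ≈⟨ *-congʳ (^-cong-≡ α (N.m∸n+n≡m k≤n)) ⟨
    α ^ (n N.∸ k N.+ k) * μ ^ k       ≈⟨ *-congʳ (^-+ α (n N.∸ k) k) ⟩
    (α ^ (n N.∸ k) * α ^ k) * μ ^ k   ≈⟨ *-assoc _ _ _ ⟩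
    α ^ (n N.∸ k) * (α ^ k * μ ^ k)   ≈⟨ *-congˡ (trans (sym (^-distrib-* α μ k)) (trans (^-cong k inv) (1^ k))) ⟩
    α ^ (n N.∸ k) * 1#                ≈⟨ *-identityʳ _ ⟩
    α ^ (n N.∸ k)                     ∎

  -- G and C are stored by powers of t for the elimination, but understood as combinations of the
  -- polynomials E. This regroups one form into the other; φ b is t^b for values and b t^(b-1) for
  -- derivatives.
  sum-family : ∀ n w (α : ℕ → Carrier) (e : ℕ → ℕ) μ (φ : ℕ → Carrier) →
    sumTo n (λ b → ev w (λ k → α k * ε (e k) b) μ * φ b) ≈ sumTo w (λ k → (α k * μ ^ k) * sumTo n (λ b → ε (e k) b * φ b))
  sum-family n w α e μ φ = begin
    sumTo n (λ b → ev w (λ k → α k * ε (e k) b) μ * φ b)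
      ≈⟨ sum-cong n (λ b → sym (sum-*ʳ w (φ b) (λ k → (α k * ε (e k) b) * μ ^ k))) ⟩
    sumTo n (λ b → sumTo w (λ k → ((α k * ε (e k) b) * μ ^ k) * φ b))
      ≈⟨ sum-comm n w (λ b k → ((α k * ε (e k) b) * μ ^ k) * φ b) ⟩
    sumTo w (λ k → sumTo n (λ b → ((α k * ε (e k) b) * μ ^ k) * φ b))
      ≈⟨ sum-cong w (λ k → trans (sum-cong n (λ b → solve 4 (λ a e m p → ((a :* e) :* m) :* p := (a :* m) :* (e :* p)) refl (α k) (ε (e k) b) (μ ^ k) (φ b)))
           (sum-*ˡ n (α k * μ ^ k) (λ b → ε (e k) b * φ b))) ⟩
    sumTo w (λ k → (α k * μ ^ k) * sumTo n (λ b → ε (e k) b * φ b)) ∎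

  der≈sum : ∀ n p t → der n p t ≈ sumTo n (λ b → p b * (b · (t ^ (b N.∸ 1))))
  der≈sum n p t = sum-cong n (λ b → trans (·-*ʳ b (p b) _) (·-*ˡ b (p b) _))

  sum-odd : ∀ n (f : ℕ → Carrier) → (∀ i → f (2 N.* i) ≈ 0#) → sumTo (suc (2 N.* n)) f ≈ sumTo n (λ i → f (suc (2 N.* i)))
  sum-odd zero f e = trans (+-congʳ (e 0)) (+-identityˡ _)
  sum-odd (suc n) f e = trans (split (N.*-suc 2 n)) (+-congʳ (sum-odd n f e))
    where
    split : ∀ {j} → j ≡ 2 N.+ 2 N.* n → sumTo (suc j) f ≈ sumTo (suc (2 N.* n)) f + f (suc j)
    split ≡.refl = +-congʳ (trans (+-congˡ (trans (reflexive (≡.cong f (≡.sym (N.*-suc 2 n)))) (e (suc n)))) (+-identityʳ _))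

  prodFin≈∏ : ∀ n (f : Fin n → Carrier) → prodFin n f ≈ ∏ f
  prodFin≈∏ n f = trans (reflexive (≡.cong prod (map-tabulate id f))) (prod-tabulate n f)
    where
    prod-tabulate : ∀ n (f : Fin n → Carrier) → prod (tabulate f) ≈ ∏ f
    prod-tabulate zero f = refl
    prod-tabulate (suc n) f = *-congˡ (prod-tabulate n (f ∘ suc))

  ∏-cast : ∀ {m n} (eq : m ≡ n) (f : Fin n → Carrier) → ∏ (λ i → f (F.cast eq i)) ≈ ∏ f
  ∏-cast {m} ≡.refl f = ∏-cong m (λ i → f (F.cast ≡.refl i)) f (λ i → reflexive (≡.cong f (F.cast-is-id ≡.refl i)))

  ∏-scale : ∀ n a (f : Fin n → Carrier) → ∏ (λ i → a * f i) ≈ a ^ n * ∏ f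
  ∏-scale zero a f = sym (*-identityˡ 1#)
  ∏-scale (suc n) a f = trans (*-congˡ (∏-scale n a (f ∘ suc)))
    (solve 4 (λ a x p q → (a :* x) :* (p :* q) := (a :* p) :* (x :* q)) refl a (f zero) (a ^ n) _)

  prod-≉0 : ∀ {xs} → All (λ x → ¬ x ≈ 0#) xs → ¬ prod xs ≈ 0#
  prod-≉0 [] = 1≉0
  prod-≉0 (x≉0 ∷ xs≉0) = *-≉0 x≉0 (prod-≉0 xs≉0)

  module _ (d : ℕ) (b : ℕ → Carrier) (τ : Fin N.⌊ d N.∸ 1 /2⌋ → Carrier) where
    -- Names the function local to Pi: the meta is solved by Pi≡.
    mutual
      pairTerm : Fin N.⌊ d N.∸ 1 /2⌋ → Fin N.⌊ d N.∸ 1 /2⌋ → List Carrier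
      pairTerm = _

      Pi≡ : Pi d b τ ≡ prod (concatMap (λ i → concatMap (λ j → pairTerm i j) (allFin N.⌊ d N.∸ 1 /2⌋)) (allFin N.⌊ d N.∸ 1 /2⌋))
      Pi≡ = ≡.refl

    Pi-≉0 : (∀ i j → i ≢ j → ¬ evalP d b (τ i) + evalP d b (τ j) ≈ 0#) → ¬ Pi d b τ ≈ 0#
    Pi-≉0 distinct = prod-≉0 (All.concat⁺ (All.map⁺ (All.tabulate⁺ (λ i → All.concat⁺ (All.map⁺ (All.tabulate⁺ (λ j → term i j)))))))
      where
      term : ∀ i j → All (λ x → ¬ x ≈ 0#) (pairTerm i j)
      term i j with i F.≟ j
      ... | yes _ = []
      ... | no i≢j = distinct i j i≢j ∷ []

  -- The reciprocal polynomial has the α themselves as roots instead of μ = 1/α, so the given list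
  -- can be counted directly.
  ev-reverse : ∀ n S {α μ} → α * μ ≈ 1# → ev n (λ k → S (n N.∸ k)) α ≈ α ^ n * ev n S μ
  ev-reverse n S {α} {μ} inv = begin
    ev n (λ k → S (n N.∸ k)) α                  ≈⟨ sum-cong≤ n (λ k k≤n → *-congˡ (trans (^-cong-≡ α (≡.sym (N.m∸[m∸n]≡n k≤n)))
                                                     (sym (^-inverse n (n N.∸ k) (N.m∸n≤m n k) inv)))) ⟩
    sumTo n (λ k → S (n N.∸ k) * (α ^ n * μ ^ (n N.∸ k))) ≈⟨ sum-rev n (λ k → S k * (α ^ n * μ ^ k)) ⟩
    sumTo n (λ k → S k * (α ^ n * μ ^ k))       ≈⟨ trans (sum-cong n (λ k → solve 3 (λ s a m → s :* (a :* m) := a :* (s :* m)) refl (S k) (α ^ n) (μ ^ k))) (sum-*ˡ n (α ^ n) _) ⟩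
    α ^ n * ev n S μ                            ∎

  ∑-split : ∀ m {n} (f : Fin (m N.+ n) → Carrier) → ∑ f ≈ ∑ (λ i → f (i F.↑ˡ n)) + ∑ (λ j → f (m F.↑ʳ j))
  ∑-split zero f = sym (+-identityˡ _)
  ∑-split (suc m) f = trans (+-congˡ (∑-split m (f ∘ suc))) (sym (+-assoc _ _ _))

  ∑-combine : ∀ m n (f : Fin (m N.* n) → Carrier) → ∑ f ≈ ∑ (λ i → ∑ (λ j → f (F.combine {m} {n} i j)))
  ∑-combine zero n f = refl
  ∑-combine (suc m) n f = trans (∑-split n f) (+-congˡ (∑-combine m n (λ k → f (n F.↑ʳ k))))

  ∑-toℕ : ∀ n (f : ℕ → Carrier) → ∑ {suc n} (λ i → f (toℕ i)) ≈ sumTo n f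
  ∑-toℕ zero f = +-identityʳ _
  ∑-toℕ (suc n) f = trans (+-congˡ (∑-toℕ n (f ∘ suc))) (sym (sum-head n f))

  vanishing-Fin : ∀ n (r : Fin (suc n) → Carrier) → (∀ i j → i ≢ j → ¬ r i ≈ r j) → (x : Fin (suc n) → Carrier) →
                  (∀ i → ∑ (λ k → x k * r i ^ toℕ k) ≈ 0#) → ∀ k → x k ≈ 0#
  vanishing-Fin n r dist x e k = trans (sym (extend0-toℕ x k))
    (many-roots⇒0-Fin n (extend0 x) r dist (λ i → begin
      ev n (extend0 x) (r i)                          ≈⟨ ∑-toℕ n (λ k → extend0 x k * r i ^ k) ⟨
      ∑ {suc n} (λ k → extend0 x (toℕ k) * r i ^ toℕ k)       ≈⟨ ∑-cong {suc n} (λ k → extend0 x (toℕ k) * r i ^ toℕ k) (λ k → x k * r i ^ toℕ k) (λ k → *-congʳ (extend0-toℕ x k)) ⟩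
      ∑ (λ k → x k * r i ^ toℕ k)                     ≈⟨ e i ⟩
      0#                                              ∎) (toℕ k) (N.≤-pred (F.toℕ<n k)))

  -- Two Vandermonde steps. For fixed i, a polynomial in the second variable with n + 1 coefficients
  -- vanishes at the n + 1 points r j, j ≠ i. Each of its coefficients is a polynomial in r i with n
  -- + 2 coefficients and n + 2 zeros. The ranges b < h and c < h - 1 of the normal monomials fit
  -- exactly.
  grid-vanishing : ∀ {n} (r : Fin (suc (suc n)) → Carrier) → (∀ i j → i ≢ j → ¬ r i ≈ r j) →
    (x : Fin (suc (suc n)) → Fin (suc n) → Carrier) →
    (∀ i j → i ≢ j → ∑ (λ p → ∑ (λ q → x p q * (r i ^ toℕ p * r j ^ toℕ q))) ≈ 0#) → ∀ p q → x p q ≈ 0#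
  grid-vanishing {n} r dist x e p q = vanishing-Fin (suc n) r dist (λ p → x p q)
    (λ i → vanishing-Fin n (λ k → r (F.punchIn i k)) (λ j k j≢k → dist _ _ (j≢k ∘ F.punchIn-injective i j k))
      (λ q → ∑ (λ p → x p q * r i ^ toℕ p)) (λ j → begin
        ∑ (λ q → ∑ (λ p → x p q * r i ^ toℕ p) * r (F.punchIn i j) ^ toℕ q)
          ≈⟨ ∑-cong (λ q → ∑ (λ p → x p q * r i ^ toℕ p) * r (F.punchIn i j) ^ toℕ q)
                    (λ q → ∑ (λ p → x p q * (r i ^ toℕ p * r (F.punchIn i j) ^ toℕ q)))
               (λ q → trans (*-distribʳ-∑ (r (F.punchIn i j) ^ toℕ q) (λ p → x p q * r i ^ toℕ p))
                 (∑-cong (λ p → (x p q * r i ^ toℕ p) * r (F.punchIn i j) ^ toℕ q) (λ p → x p q * (r i ^ toℕ p * r (F.punchIn i j) ^ toℕ q)) (λ p → *-assoc _ _ _))) ⟩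
        ∑ (λ q → ∑ (λ p → x p q * (r i ^ toℕ p * r (F.punchIn i j) ^ toℕ q)))
          ≈⟨ ∑-comm (λ q p → x p q * (r i ^ toℕ p * r (F.punchIn i j) ^ toℕ q)) ⟩
        ∑ (λ p → ∑ (λ q → x p q * (r i ^ toℕ p * r (F.punchIn i j) ^ toℕ q)))
          ≈⟨ e i (F.punchIn i j) (F.punchInᵢ≢i i j ∘ ≡.sym) ⟩
        0# ∎) q) p

  -- Counting

  module Counting (g : ℕ) (a : ℕ → Carrier) (a₀≉0 : ¬ a 0 ≈ 0#) (a₁≉0 : ¬ a 1 ≈ 0#) where

    h d m w : ℕ
    h = suc (suc g)
    d = suc (2 N.* h)
    w = suc (2 N.* d)
    m = 2 N.* suc d

    m≡ : m ≡ suc w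
    m≡ = N.*-suc 2 d

    -- With μ = 1/α and t = y/α², the polynomial L_α f becomes α^m G μ t, where
    -- G μ t = Σ a_k μ^k E (m − k) t, and ∂G/∂t = a_1 μ (C μ t)² with C μ t = Σ σ_k μ^k E (d − k) t
    -- and σ_k = √(a_{2k+1} / a_1).
    ρ : ℕ → Carrier
    ρ k = proj₁ (sqrt (a (suc (2 N.* k))))

    ρ² : ∀ k → ρ k * ρ k ≈ a (suc (2 N.* k))
    ρ² k = proj₂ (sqrt (a (suc (2 N.* k))))

    ρ₀≉0 : ¬ ρ 0 ≈ 0#
    ρ₀≉0 e = a₁≉0 (trans (sym (ρ² 0)) (trans (*-congʳ e) (zeroˡ _)))

    κ : Carrier
    κ = proj₁ (inverse (ρ 0) ρ₀≉0)

    σ : ℕ → Carrier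
    σ k = ρ k * κ

    σ₀ : σ 0 ≈ 1#
    σ₀ = proj₂ (inverse (ρ 0) ρ₀≉0)

    σ² : ∀ k → a 1 * (σ k * σ k) ≈ a (suc (2 N.* k))
    σ² k = begin
      a 1 * (σ k * σ k)                     ≈⟨ *-congʳ (ρ² 0) ⟨
      (ρ 0 * ρ 0) * (σ k * σ k)             ≈⟨ solve 3 (λ x r y → (x :* x) :* ((r :* y) :* (r :* y)) := ((x :* y) :* (x :* y)) :* (r :* r)) refl (ρ 0) (ρ k) κ ⟩
      (σ 0 * σ 0) * (ρ k * ρ k)             ≈⟨ *-cong (*-cong σ₀ σ₀) (ρ² k) ⟩
      (1# * 1#) * a (suc (2 N.* k))         ≈⟨ trans (*-congʳ (*-identityˡ 1#)) (*-identityˡ _) ⟩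
      a (suc (2 N.* k))                     ∎

    γ Γ : ℕ → ℕ → Carrier
    γ b k = σ k * ε (d N.∸ k) b
    Γ b k = a k * ε (m N.∸ k) b

    γ-deg : ∀ b k → 2 N.* h N.< k N.+ 2 N.* b → γ b k ≈ 0#
    γ-deg b k p = trans (*-congˡ (ε-deg (d N.∸ k) b (N.m≤n+o⇒m∸n≤o d k p))) (zeroʳ (σ k))

    Γ-deg : ∀ b k → w N.< k N.+ 2 N.* b → Γ b k ≈ 0#
    Γ-deg b k p = trans (*-congˡ (ε-deg (m N.∸ k) b (N.m≤n+o⇒m∸n≤o m k (N.≤-trans (N.≤-reflexive m≡) p)))) (zeroʳ (a k))

    open PairAlgebra g γ γ-deg hiding (h)
    open Multiplication d w Γ Γ-deg

    C : Carrier → Carrier → Carrier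
    C μ t = ev h (λ b → coef b μ) t

    C-sum : ∀ μ t → C μ t ≈ sumTo (2 N.* h) (λ k → (σ k * μ ^ k) * E (d N.∸ k) t)
    C-sum μ t = trans (sum-family h (2 N.* h) σ (d N.∸_) μ (t ^_))
      (sum-cong (2 N.* h) (λ k → *-congˡ (ev-ε h (d N.∸ k) t (N.≤-trans (N.m∸n≤m d k) (N.n≤1+n d)))))

    G-sum-E : ∀ μ t → G μ t ≈ sumTo w (λ k → (a k * μ ^ k) * E (m N.∸ k) t)
    G-sum-E μ t = trans (sum-family d w a (m N.∸_) μ (t ^_))
      (sum-cong w (λ k → *-congˡ (ev-ε d (m N.∸ k) t (N.≤-trans (N.m∸n≤m m k) (N.≤-reflexive m≡)))))

    coef-lead : ∀ μ → coef h μ ≈ 1#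
    coef-lead μ = begin
      coef h μ                  ≈⟨ sum-single (2 N.* h) (λ k → γ h k * μ ^ k) z≤n (λ { zero 0≢0 → contradiction ≡.refl 0≢0
                                     ; (suc k) _ → trans (*-congʳ (γ-deg h (suc k) (s≤s (N.m≤n+m (2 N.* h) k)))) (zeroˡ _) }) ⟩
      (σ 0 * ε d h) * 1#        ≈⟨ *-identityʳ _ ⟩
      σ 0 * ε d h               ≈⟨ *-cong σ₀ (ε-lead h) ⟩
      1# * 1#                   ≈⟨ *-identityˡ 1# ⟩
      1#                        ∎

    der-G : ∀ μ t → der d (λ b → ev w (Γ b) μ) t ≈ (a 1 * μ) * (C μ t * C μ t)
    der-G μ t = begin
      der d (λ b → ev w (Γ b) μ) t
        ≈⟨ trans (der≈sum d _ t) (sum-family d w a (m N.∸_) μ (λ b → b · (t ^ (b N.∸ 1)))) ⟩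
      sumTo w (λ k → (a k * μ ^ k) * sumTo d (λ b → ε (m N.∸ k) b * (b · (t ^ (b N.∸ 1)))))
        ≈⟨ sum-cong w (λ k → *-congˡ (trans (sym (der≈sum d (ε (m N.∸ k)) t)) (der-ε d (m N.∸ k) t (N.≤-trans (N.m∸n≤m m k) (N.≤-reflexive m≡))))) ⟩
      sumTo w (λ k → (a k * μ ^ k) * E′ (m N.∸ k) t)
        ≈⟨ sum-odd d (λ k → (a k * μ ^ k) * E′ (m N.∸ k) t) even ⟩
      sumTo d (λ i → (a (suc (2 N.* i)) * μ ^ suc (2 N.* i)) * E′ (m N.∸ suc (2 N.* i)) t)
        ≈⟨ sum-cong≤ d odd ⟩
      sumTo d (λ i → (a 1 * μ) * (v i * v i))
        ≈⟨ trans (sum-*ˡ d (a 1 * μ) (λ i → v i * v i)) (*-congˡ (sum-square d v)) ⟩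
      (a 1 * μ) * (sumTo d v * sumTo d v)
        ≈⟨ *-congˡ (*-cong sum-v sum-v) ⟩
      (a 1 * μ) * (C μ t * C μ t) ∎
      where
      v : ℕ → Carrier
      v i = (σ i * μ ^ i) * E (d N.∸ i) t
      sum-v : sumTo d v ≈ C μ t
      -- The sum runs to d = 2h + 1, one term further than `C-sum`; that term carries `E 0 t`, which
      -- is 0.
      sum-v = trans (trans (+-congˡ (trans (*-congˡ (reflexive (≡.cong (λ k → E k t) (N.n∸n≡0 d)))) (zeroʳ _))) (+-identityʳ _)) (sym (C-sum μ t))
      even : ∀ i → (a (2 N.* i) * μ ^ (2 N.* i)) * E′ (m N.∸ 2 N.* i) t ≈ 0#
      even i = trans (*-congˡ (trans (reflexive (≡.cong (λ k → E′ k t) (≡.sym (N.*-distribˡ-∸ 2 (suc d) i)))) (proj₁ (E′-even-odd (suc d N.∸ i) t)))) (zeroʳ _)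
      odd : ∀ i → i N.≤ d → (a (suc (2 N.* i)) * μ ^ suc (2 N.* i)) * E′ (m N.∸ suc (2 N.* i)) t ≈ (a 1 * μ) * (v i * v i)
      odd i i≤d = begin
        (a (suc (2 N.* i)) * μ ^ suc (2 N.* i)) * E′ (m N.∸ suc (2 N.* i)) t
          ≈⟨ *-cong (*-cong (sym (σ² i)) (*-congˡ (trans (^-cong-≡ μ (≡.cong (i N.+_) (N.+-identityʳ i))) (^-+ μ i i))))
               (trans (reflexive (≡.cong (λ k → E′ k t) index)) (proj₂ (E′-even-odd (d N.∸ i) t))) ⟩
        ((a 1 * (σ i * σ i)) * (μ * (μ ^ i * μ ^ i))) * (E (d N.∸ i) t * E (d N.∸ i) t)
          ≈⟨ solve 5 (λ a s m p e → ((a :* (s :* s)) :* (m :* (p :* p))) :* (e :* e) := (a :* m) :* (((s :* p) :* e) :* ((s :* p) :* e)))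
               refl (a 1) (σ i) μ (μ ^ i) (E (d N.∸ i) t) ⟩
        (a 1 * μ) * (v i * v i) ∎
        where
        index : m N.∸ suc (2 N.* i) ≡ suc (2 N.* (d N.∸ i))
        index = ≡.trans (≡.cong (N._∸ suc (2 N.* i)) m≡)
          (≡.trans (N.+-∸-assoc 1 (N.*-monoʳ-≤ 2 i≤d)) (≡.cong suc (≡.sym (N.*-distribˡ-∸ 2 d i))))

    -- It matches the factor of C² in `der-G`, as the leading coefficient in `IsCritFactorisation`
    -- demands.
    G-lead : ∀ μ → ev w (Γ d) μ ≈ a 1 * μ
    G-lead μ = trans (sum-single w (λ k → Γ d k * μ ^ k) {1} (s≤s z≤n) others)
      (*-cong (trans (*-congˡ lead) (*-identityʳ (a 1))) (*-identityʳ μ))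
      where
      lead : ε (m N.∸ 1) d ≈ 1#
      lead = trans (reflexive (≡.cong (λ k → ε (k N.∸ 1) d) m≡)) (ε-lead d)
      others : ∀ k → k ≢ 1 → Γ d k * μ ^ k ≈ 0#
      others zero _ = trans (*-congʳ (trans (*-congˡ sublead) (zeroʳ (a 0)))) (zeroˡ _)
        where
        sublead : ε m d ≈ 0#
        sublead = trans (reflexive (≡.cong (λ k → ε k d) m≡)) (trans (ε-sublead d)
          (trans (reflexive (≡.cong (_· 1#) (≡.sym (N.*-suc 2 h)))) (even·1≈0 (suc h))))
      others (suc zero) 1≢1 = contradiction ≡.refl 1≢1
      others (suc (suc k)) _ = trans (*-congʳ (Γ-deg d (suc (suc k)) (s≤s (s≤s (N.m≤n+m (2 N.* d) k))))) (zeroˡ _)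

    root-pairs : ∀ μ (θ : Fin h → Carrier) → (∀ t → C μ t ≈ ∏ (λ i → t + θ i)) → ∀ i j → i ≢ j → V μ (θ i) (θ j)
    root-pairs μ θ e i j i≢j = let root , dd≈0 = factor-roots h (λ b → coef b μ) θ e i j i≢j in
      sym (+-cancel-0 (trans (+-congˡ (sym (trans (*-congʳ (coef-lead μ)) (*-identityˡ _)))) root)) ,
      sym (+-cancel-0 (trans (+-congˡ (sym (trans (*-congʳ (coef-lead μ)) (*-identityˡ _)))) dd≈0))

    -- Put x = α u in the defining identity: x(x + α) = α²(u² + u), and the k-th powers of x + α and
    -- x add up to α^k E k t. By `artinSchreier` every t is of the form u² + u.
    Lα≈G : ∀ {α μ} c′ → α * μ ≈ 1# → IsLalpha m d a α c′ → ∀ t → evalP d c′ ((α * α) * t) ≈ α ^ m * G μ t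
    Lα≈G {α} {μ} c′ inv L t with artinSchreier t
    ... | u , u-t = begin
      evalP d c′ ((α * α) * t)                 ≈⟨ sum-cong d (λ k → *-congˡ (^-cong k (trans (*-congˡ (sym u-t))
                                                    (solve 2 (λ α u → (α :* α) :* (u :* u :+ u) := (α :* u) :* (α :* u :+ α)) refl α u)))) ⟩
      evalP d c′ ((α * u) * (α * u + α))       ≈⟨ L (α * u) ⟩
      evalP m a (α * u + α) + evalP m a (α * u) ≈⟨ sum-+ m _ _ ⟨
      sumTo m (λ k → a (m N.∸ k) * (α * u + α) ^ k + a (m N.∸ k) * (α * u) ^ k)
        ≈⟨ sum-cong≤ m term ⟩
      sumTo m (λ k → f (m N.∸ k))              ≈⟨ sum-rev m f ⟩
      sumTo m f                                ≈⟨ reflexive (≡.cong (λ k → sumTo k f) m≡) ⟩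
      sumTo w f + f (suc w)                    ≈⟨ trans (+-congˡ f-last) (+-identityʳ _) ⟩
      sumTo w f                                ≈⟨ sum-cong w (λ k → solve 4 (λ A a m e → a :* ((A :* m) :* e) := A :* ((a :* m) :* e)) refl (α ^ m) (a k) (μ ^ k) (E (m N.∸ k) t)) ⟩
      sumTo w (λ k → α ^ m * ((a k * μ ^ k) * E (m N.∸ k) t)) ≈⟨ sum-*ˡ w (α ^ m) _ ⟩
      α ^ m * sumTo w (λ k → (a k * μ ^ k) * E (m N.∸ k) t)   ≈⟨ *-congˡ (G-sum-E μ t) ⟨
      α ^ m * G μ t                            ∎
      where
      f : ℕ → Carrier
      f k = a k * ((α ^ m * μ ^ k) * E (m N.∸ k) t)
      -- Index m belongs to the constant term of f, which cancels in f(x + α) + f(x).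
      f-last : f (suc w) ≈ 0#
      f-last = trans (*-congˡ (trans (*-congˡ (reflexive (≡.cong (λ k → E k t) (≡.trans (≡.cong (N._∸ suc w) m≡) (N.n∸n≡0 (suc w)))))) (zeroʳ _))) (zeroʳ _)
      term : ∀ k → k N.≤ m → a (m N.∸ k) * (α * u + α) ^ k + a (m N.∸ k) * (α * u) ^ k ≈ f (m N.∸ k)
      term k k≤m = trans (sym (distribˡ _ _ _)) (*-congˡ (begin
        (α * u + α) ^ k + (α * u) ^ k               ≈⟨ +-congʳ (^-cong k (solve 2 (λ α u → α :* u :+ α := α :* (u :+ :1)) refl α u)) ⟩
        (α * (u + 1#)) ^ k + (α * u) ^ k            ≈⟨ +-cong (^-distrib-* α (u + 1#) k) (^-distrib-* α u k) ⟩
        α ^ k * (u + 1#) ^ k + α ^ k * u ^ k        ≈⟨ distribˡ _ _ _ ⟨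
        α ^ k * ((u + 1#) ^ k + u ^ k)              ≈⟨ *-cong (trans (^-inverse m (m N.∸ k) (N.m∸n≤m m k) inv) (^-cong-≡ α (N.m∸[m∸n]≡n k≤m)))
                                                         (trans (E-cong k (sym u-t)) (E-power k u)) ⟨
        (α ^ m * μ ^ (m N.∸ k)) * E k t             ≈⟨ *-congˡ (reflexive (≡.cong (λ j → E j t) (N.m∸[m∸n]≡n k≤m))) ⟨
        (α ^ m * μ ^ (m N.∸ k)) * E (m N.∸ (m N.∸ k)) t ∎))

    module LAlpha {α μ} (c′ : ℕ → Carrier) (α≉0 : ¬ α ≈ 0#) (inv : α * μ ≈ 1#) (L : IsLalpha m d a α c′) where
      β : Carrier
      β = α * α

      β≉0 : ¬ β ≈ 0#
      β≉0 = *-≉0 α≉0 α≉0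

      C′ : ℕ → Carrier
      C′ b = c′ (d N.∸ b) * β ^ b

      -- `IsLalpha` is an identity of functions; the derivative needs coefficients, which it
      -- determines because K is infinite.
      C′-coef : ∀ b → b N.≤ d → C′ b ≈ α ^ m * ev w (Γ b) μ
      C′-coef = agreeing⇒≈ d C′ (λ b → α ^ m * ev w (Γ b) μ) (λ t → begin
        ev d C′ t                 ≈⟨ sum-cong d (λ k → trans (*-assoc _ _ _) (*-congˡ (sym (^-distrib-* β t k)))) ⟩
        evalP d c′ (β * t)        ≈⟨ Lα≈G c′ inv L t ⟩
        α ^ m * G μ t             ≈⟨ ev-*ˡ d (α ^ m) (λ b → ev w (Γ b) μ) t ⟨
        ev d (λ b → α ^ m * ev w (Γ b) μ) t ∎)

      evalDeriv-scaled : ∀ t → β * evalDeriv d c′ (β * t) ≈ (α ^ m * (a 1 * μ)) * (C μ t * C μ t)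
      evalDeriv-scaled t = begin
        β * evalDeriv d c′ (β * t)     ≈⟨ sum-*ˡ d β _ ⟨
        sumTo d (λ k → β * ((k · c′ (d N.∸ k)) * (β * t) ^ (k N.∸ 1)))  ≈⟨ sum-cong≤ d term ⟩
        sumTo d (λ k → α ^ m * ((k · ev w (Γ k) μ) * t ^ (k N.∸ 1)))    ≈⟨ sum-*ˡ d (α ^ m) _ ⟩
        α ^ m * der d (λ b → ev w (Γ b) μ) t                            ≈⟨ *-congˡ (der-G μ t) ⟩
        α ^ m * ((a 1 * μ) * (C μ t * C μ t))                           ≈⟨ *-assoc _ _ _ ⟨
        (α ^ m * (a 1 * μ)) * (C μ t * C μ t)                           ∎
        where
        term : ∀ k → k N.≤ d → β * ((k · c′ (d N.∸ k)) * (β * t) ^ (k N.∸ 1)) ≈ α ^ m * ((k · ev w (Γ k) μ) * t ^ (k N.∸ 1))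
        term zero _ = trans (*-congˡ (zeroˡ _)) (trans (zeroʳ β) (sym (trans (*-congˡ (zeroˡ _)) (zeroʳ _))))
        term (suc k) k≤d = begin
          β * ((suc k · x) * (β * t) ^ k)        ≈⟨ *-congˡ (*-congˡ (^-distrib-* β t k)) ⟩
          β * ((suc k · x) * (β ^ k * t ^ k))    ≈⟨ solve 4 (λ b x p q → b :* (x :* (p :* q)) := (x :* (b :* p)) :* q) refl β (suc k · x) (β ^ k) (t ^ k) ⟩
          ((suc k · x) * β ^ suc k) * t ^ k      ≈⟨ *-congʳ (trans (·-*ʳ (suc k) x (β ^ suc k)) (trans (·-cong (suc k) (C′-coef (suc k) k≤d)) (·-*ˡ (suc k) _ _))) ⟩
          (α ^ m * (suc k · ev w (Γ (suc k)) μ)) * t ^ k ≈⟨ *-assoc _ _ _ ⟩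
          α ^ m * ((suc k · ev w (Γ (suc k)) μ) * t ^ k) ∎
          where x = c′ (d N.∸ suc k)

      h≡ : N.⌊ d N.∸ 1 /2⌋ ≡ h
      h≡ = ≡.trans (≡.cong N.⌊_/2⌋ (≡.cong (h N.+_) (N.+-identityʳ h))) (≡.sym (N.n≡⌊n+n/2⌋ h))

      module _ (θ : Fin h → Carrier) (fact : ∀ t → C μ t ≈ ∏ (λ i → t + θ i)) where
        τ : Fin N.⌊ d N.∸ 1 /2⌋ → Carrier
        τ i = β * θ (F.cast h≡ i)

        product : ∀ t → prodFin N.⌊ d N.∸ 1 /2⌋ (λ i → (β * t + τ i) ^ 2) ≈ β ^ (2 N.* h) * (C μ t * C μ t)
        product t = begin
          prodFin N.⌊ d N.∸ 1 /2⌋ (λ i → (β * t + τ i) ^ 2)   ≈⟨ prodFin≈∏ N.⌊ d N.∸ 1 /2⌋ (λ i → (β * t + τ i) ^ 2) ⟩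
          ∏ (λ i → (β * t + β * θ (F.cast h≡ i)) ^ 2)         ≈⟨ ∏-cast h≡ (λ i → (β * t + β * θ i) ^ 2) ⟩
          ∏ (λ i → (β * t + β * θ i) ^ 2)                     ≈⟨ ∏-cong h (λ i → (β * t + β * θ i) ^ 2) (λ i → β ^ 2 * ((t + θ i) * (t + θ i))) (λ i → solve 3 (λ b t p → (b :* t :+ b :* p) :* ((b :* t :+ b :* p) :* :1)
                                                                   := (b :* (b :* :1)) :* ((t :+ p) :* (t :+ p))) refl β t (θ i)) ⟩
          ∏ (λ i → β ^ 2 * ((t + θ i) * (t + θ i)))           ≈⟨ ∏-scale h (β ^ 2) (λ i → (t + θ i) * (t + θ i)) ⟩
          (β ^ 2) ^ h * ∏ (λ i → (t + θ i) * (t + θ i))       ≈⟨ *-cong (^-^ β 2 h) (∏-distrib-* (λ i → t + θ i) (λ i → t + θ i)) ⟩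
          β ^ (2 N.* h) * (∏ (λ i → t + θ i) * ∏ (λ i → t + θ i)) ≈⟨ *-congˡ (*-cong (fact t) (fact t)) ⟨
          β ^ (2 N.* h) * (C μ t * C μ t)                     ∎

        isCrit : IsCritFactorisation d c′ τ
        isCrit y = *-cancelˡ β≉0 (begin
          β * evalDeriv d c′ y              ≈⟨ *-congˡ (sum-cong d (λ k → *-congˡ (^-cong (k N.∸ 1) y≈))) ⟩
          β * evalDeriv d c′ (β * t)        ≈⟨ evalDeriv-scaled t ⟩
          (α ^ m * (a 1 * μ)) * (C μ t * C μ t)  ≈⟨ *-congʳ (trans (C′-coef d N.≤-refl) (*-congˡ (G-lead μ))) ⟨
          (c′ (d N.∸ d) * β ^ d) * (C μ t * C μ t) ≈⟨ solve 4 (λ c b p q → (c :* (b :* p)) :* q := b :* (c :* (p :* q))) refl (c′ (d N.∸ d)) β (β ^ (2 N.* h)) (C μ t * C μ t) ⟩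
          β * (c′ (d N.∸ d) * (β ^ (2 N.* h) * (C μ t * C μ t)))  ≈⟨ *-congˡ (*-cong (reflexive (≡.cong c′ (N.n∸n≡0 d))) (sym (product t))) ⟩
          β * (c′ 0 * prodFin N.⌊ d N.∸ 1 /2⌋ (λ i → (β * t + τ i) ^ 2))
            ≈⟨ *-congˡ (*-congˡ (trans (prodFin≈∏ N.⌊ d N.∸ 1 /2⌋ (λ i → (β * t + τ i) ^ 2))
                 (trans (∏-cong N.⌊ d N.∸ 1 /2⌋ (λ i → (β * t + τ i) ^ 2) (λ i → (y + τ i) ^ 2) (λ i → ^-cong 2 (+-congʳ (sym y≈)))) (sym (prodFin≈∏ N.⌊ d N.∸ 1 /2⌋ (λ i → (y + τ i) ^ 2)))))) ⟩
          β * (c′ 0 * prodFin N.⌊ d N.∸ 1 /2⌋ (λ i → (y + τ i) ^ 2)) ∎)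
          where
          t = (μ * μ) * y
          y≈ : y ≈ β * t
          y≈ = sym (trans (solve 3 (λ a m y → (a :* a) :* ((m :* m) :* y) := (a :* m) :* ((a :* m) :* y)) refl α μ y)
            (trans (*-congʳ inv) (trans (*-identityˡ _) (trans (*-congʳ inv) (*-identityˡ y)))))

        -- A bad α refutes every candidate τ, in particular the scaled roots of C. For these `Pi-≉0`
        -- would succeed if no pair of indices had equal values.
        collision : ¬ HasDistinctCritVals d c′ → ¬ ¬ (∃ λ x → ∃ λ y → V μ x y × z μ x y ≈ 0#)
        collision bad none = bad (τ , isCrit , Pi-≉0 d c′ τ (λ i j i≢j e →
          let i′ = F.cast h≡ i
              j′ = F.cast h≡ j
          in none (θ i′ , θ j′ , root-pairs μ θ fact i′ j′ (λ eq → i≢j (cast-injective eq)) ,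
            *-cancelˡ-0 (^-≉0 m α≉0) (trans (distribˡ _ _ _) (trans (+-cong (sym (Lα≈G c′ inv L (θ i′))) (sym (Lα≈G c′ inv L (θ j′)))) e)))))
          where
          cast-injective : ∀ {i j} → F.cast h≡ i ≡ F.cast h≡ j → i ≡ j
          cast-injective {i} {j} eq = F.toℕ-injective (≡.trans (≡.sym (F.toℕ-cast h≡ i)) (≡.trans (≡.cong toℕ eq) (F.toℕ-cast h≡ j)))

    bad⇒collision : ∀ {α μ} → α * μ ≈ 1# → Bad m d a α → ¬ ¬ (∃ λ x → ∃ λ y → V μ x y × z μ x y ≈ 0#)
    bad⇒collision {α} {μ} inv (α≉0 , c′ , L , bad) = let θ , fact = factor h (λ b → coef b μ) (coef-lead μ) in
      LAlpha.collision c′ α≉0 inv L θ fact bad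

    C-at-0 : ∀ t → C 0# t ≈ E d t
    C-at-0 t = begin
      C 0# t                                                      ≈⟨ C-sum 0# t ⟩
      sumTo (2 N.* h) (λ k → (σ k * 0# ^ k) * E (d N.∸ k) t)      ≈⟨ sum-single (2 N.* h) _ z≤n (λ { zero 0≢0 → contradiction ≡.refl 0≢0
                                                                       ; (suc k) _ → trans (*-congʳ (trans (*-congˡ (zeroˡ _)) (zeroʳ _))) (zeroˡ _) }) ⟩
      (σ 0 * 1#) * E d t                                          ≈⟨ trans (*-congʳ (trans (*-identityʳ _) σ₀)) (*-identityˡ _) ⟩
      E d t                                                       ∎

    der-C-at-0 : ∀ t → der h (λ b → coef b 0#) t ≈ E h t * E h t
    der-C-at-0 t = begin
      der h (λ b → coef b 0#) t
        ≈⟨ trans (der≈sum h _ t) (sum-family h (2 N.* h) σ (d N.∸_) 0# (λ b → b · (t ^ (b N.∸ 1)))) ⟩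
      sumTo (2 N.* h) (λ k → (σ k * 0# ^ k) * sumTo h (λ b → ε (d N.∸ k) b * (b · (t ^ (b N.∸ 1)))))
        ≈⟨ sum-single (2 N.* h) _ z≤n (λ { zero 0≢0 → contradiction ≡.refl 0≢0
             ; (suc k) _ → trans (*-congʳ (trans (*-congˡ (zeroˡ _)) (zeroʳ _))) (zeroˡ _) }) ⟩
      (σ 0 * 1#) * sumTo h (λ b → ε d b * (b · (t ^ (b N.∸ 1))))
        ≈⟨ trans (*-congʳ (trans (*-identityʳ _) σ₀)) (*-identityˡ _) ⟩
      sumTo h (λ b → ε d b * (b · (t ^ (b N.∸ 1))))
        ≈⟨ trans (sym (der≈sum h (ε d) t)) (der-ε h d t (N.n≤1+n d)) ⟩
      E′ d t
        ≈⟨ proj₂ (E′-even-odd h t) ⟩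
      E h t * E h t ∎

    G-at-0 : ∀ t → G 0# t ≈ a 0 * E m t
    G-at-0 t = begin
      G 0# t                                               ≈⟨ G-sum-E 0# t ⟩
      sumTo w (λ k → (a k * 0# ^ k) * E (m N.∸ k) t)       ≈⟨ sum-single w _ z≤n (λ { zero 0≢0 → contradiction ≡.refl 0≢0
                                                                ; (suc k) _ → trans (*-congʳ (trans (*-congˡ (zeroˡ _)) (zeroʳ _))) (zeroˡ _) }) ⟩
      (a 0 * 1#) * E m t                                   ≈⟨ *-congʳ (*-identityʳ _) ⟩
      a 0 * E m t                                          ∎

    -- Separability of `E d`, whose derivative is (E h)². Given (u + 1)^h = u^h, the equation (u +
    -- 1)^d = u^d with d = 2h + 1 reduces to u^(2h) = 0. Then u = 0, and the first equation reads 1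
    -- = 0.
    E-coprime : ∀ t → E h t ≈ 0# → ¬ E d t ≈ 0#
    E-coprime t e e′ with artinSchreier t
    ... | u , u-t = u≉0 λ u≈0 → 1≉0 (begin
        1#               ≈⟨ 1^ h ⟨
        1# ^ h           ≈⟨ ^-cong h (trans (+-congʳ u≈0) (+-identityˡ 1#)) ⟨
        (u + 1#) ^ h     ≈⟨ same h e ⟩
        u ^ h            ≈⟨ trans (^-cong h u≈0) (0^ h (s≤s z≤n)) ⟩
        0#               ∎)
      where
      same : ∀ k → E k t ≈ 0# → (u + 1#) ^ k ≈ u ^ k
      same k e = +-cancel-0 (trans (sym (E-power k u)) (trans (E-cong k u-t) e))
      square : ∀ x → x ^ (2 N.* h) ≈ x ^ h * x ^ h
      square x = trans (^-cong-≡ x (≡.cong (h N.+_) (N.+-identityʳ h))) (^-+ x h h)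
      u≉0 : ¬ ¬ u ≈ 0#
      u≉0 u≉0 = *-≉0 (^-≉0 h u≉0) (^-≉0 h u≉0) (begin
        u ^ h * u ^ h                               ≈⟨ solve 2 (λ p u → p :* p := (u :+ :1) :* (p :* p) :+ u :* (p :* p)) refl (u ^ h) u ⟩
        (u + 1#) * (u ^ h * u ^ h) + u * (u ^ h * u ^ h) ≈⟨ +-cong (*-congˡ (trans (square (u + 1#)) (*-cong (same h e) (same h e)))) (*-congˡ (square u)) ⟨
        (u + 1#) ^ d + u ^ d                        ≈⟨ ≈⇒+≈0 (same d e′) ⟩
        0#                                          ∎)

    module Fibre₀ (separated : ∀ t₁ t₂ → E d t₁ ≈ 0# → E d t₂ ≈ 0# → ¬ t₁ ≈ t₂ → ¬ E m t₁ ≈ E m t₂)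
      (θ : Fin h → Carrier) (fact : ∀ t → C 0# t ≈ ∏ (λ i → t + θ i)) where

      θ-root : ∀ i j → i ≢ j → E d (θ i) ≈ 0#
      θ-root i j i≢j = trans (sym (C-at-0 (θ i))) (proj₁ (factor-roots h (λ b → coef b 0#) θ fact i j i≢j))

      θ-distinct : ∀ i j → i ≢ j → ¬ θ i ≈ θ j
      θ-distinct i j i≢j θi≈θj = E-coprime (θ i) (square≈0 (begin
        E h (θ i) * E h (θ i)                     ≈⟨ der-C-at-0 (θ i) ⟨
        der h (λ b → coef b 0#) (θ i)             ≈⟨ dd-diag h (λ b → coef b 0#) (θ i) ⟨
        dd h (λ b → coef b 0#) (θ i) (θ i)        ≈⟨ sum-cong h (λ k → *-congˡ (hc-cong k refl θi≈θj)) ⟩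
        dd h (λ b → coef b 0#) (θ i) (θ j)        ≈⟨ proj₂ (factor-roots h (λ b → coef b 0#) θ fact i j i≢j) ⟩
        0#                                        ∎)) (θ-root i j i≢j)

      z≉0 : ∀ i j → i ≢ j → ¬ z 0# (θ i) (θ j) ≈ 0#
      z≉0 i j i≢j e = separated (θ i) (θ j) (θ-root i j i≢j) (θ-root j i (i≢j ∘ ≡.sym)) (θ-distinct i j i≢j)
        (*-cancelˡ a₀≉0 (trans (sym (G-at-0 (θ i))) (trans (+-cancel-0 e) (G-at-0 (θ j)))))

      -- A vector x killed by Z at μ = 0 is a combination of monomials whose product with z vanishes
      -- at every ordered pair of distinct roots. There z is nonzero, so the combination itself
      -- vanishes at all h(h - 1) pairs, and `grid-vanishing` applies.
      Z-inj : ∀ (x : Fin H → Carrier) → (∀ j → ∑ (λ i → x i * Z i j 0) ≈ 0#) → ∀ i → x i ≈ 0#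
      Z-inj x rel i = trans (reflexive (≡.cong x (≡.sym (F.combine-remQuot {h} (suc g) i))))
        (grid-vanishing θ θ-distinct (λ p q → x (F.combine p q)) vanish (proj₁ (F.remQuot {h} (suc g) i)) (proj₂ (F.remQuot {h} (suc g) i)))
        where
        at-pair : ∀ i j → i ≢ j → ∑ (λ k → x k * X k (θ i) (θ j)) ≈ 0#
        at-pair i j i≢j = *-cancelˡ-0 (z≉0 i j i≢j) (begin
          z₀ * ∑ (λ k → x k * X₀ k)                         ≈⟨ *-distribˡ-∑ z₀ (λ k → x k * X₀ k) ⟩
          ∑ (λ k → z₀ * (x k * X₀ k))                       ≈⟨ ∑-cong (λ k → z₀ * (x k * X₀ k)) (λ k → ∑ (λ j → (x k * Z k j 0) * X₀ j)) expandRow ⟩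
          ∑ (λ k → ∑ (λ j → (x k * Z k j 0) * X₀ j))        ≈⟨ ∑-comm (λ k j → (x k * Z k j 0) * X₀ j) ⟩
          ∑ (λ j → ∑ (λ k → (x k * Z k j 0) * X₀ j))        ≈⟨ ∑-0 (λ j → ∑ (λ k → (x k * Z k j 0) * X₀ j)) (λ j →
                                                                 trans (sym (*-distribʳ-∑ (X₀ j) (λ k → x k * Z k j 0))) (trans (*-congʳ (rel j)) (zeroˡ _))) ⟩
          0#                                                ∎)
          where
          z₀ = z 0# (θ i) (θ j)
          X₀ : Fin H → Carrier
          X₀ k = X k (θ i) (θ j)
          expandRow : ∀ k → z₀ * (x k * X₀ k) ≈ ∑ (λ j → (x k * Z k j 0) * X₀ j)
          expandRow k = begin
            z₀ * (x k * X₀ k)                                ≈⟨ solve 3 (λ z x p → z :* (x :* p) := x :* (z :* p)) refl z₀ (x k) (X₀ k) ⟩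
            x k * (z₀ * X₀ k)                                ≈⟨ *-congˡ (Z-value k (w N.+ s k) N.≤-refl 0# (θ i) (θ j) (root-pairs 0# θ fact i j i≢j)) ⟩
            x k * ∑ (λ j → ev (w N.+ s k) (Z k j) 0# * X₀ j) ≈⟨ *-distribˡ-∑ (x k) (λ j → ev (w N.+ s k) (Z k j) 0# * X₀ j) ⟩
            ∑ (λ j → x k * (ev (w N.+ s k) (Z k j) 0# * X₀ j)) ≈⟨ ∑-cong (λ j → x k * (ev (w N.+ s k) (Z k j) 0# * X₀ j)) (λ j → (x k * Z k j 0) * X₀ j)
                                                                 (λ j → trans (*-congˡ (*-congʳ (ev-at-0 (w N.+ s k) (Z k j)))) (sym (*-assoc _ _ _))) ⟩
            ∑ (λ j → (x k * Z k j 0) * X₀ j)                 ∎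
        vanish : ∀ i j → i ≢ j → ∑ {h} (λ p → ∑ {suc g} (λ q → x (F.combine p q) * (θ i ^ toℕ p * θ j ^ toℕ q))) ≈ 0#
        vanish i j i≢j = begin
          ∑ {h} (λ p → ∑ {suc g} (λ q → x (F.combine p q) * (θ i ^ toℕ p * θ j ^ toℕ q)))
            ≈⟨ ∑-cong {h} (λ p → ∑ {suc g} (λ q → x (F.combine p q) * (θ i ^ toℕ p * θ j ^ toℕ q))) (λ p → ∑ {suc g} (λ q → x (F.combine p q) * X (F.combine p q) (θ i) (θ j)))
                 (λ p → ∑-cong {suc g} (λ q → x (F.combine p q) * (θ i ^ toℕ p * θ j ^ toℕ q)) (λ q → x (F.combine p q) * X (F.combine p q) (θ i) (θ j))
                   (λ q → *-congˡ (reflexive (≡.cong (λ r → θ i ^ toℕ (proj₁ r) * θ j ^ toℕ (proj₂ r)) (≡.sym (F.remQuot-combine p q)))))) ⟩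
          ∑ {h} (λ p → ∑ {suc g} (λ q → x (F.combine p q) * X (F.combine p q) (θ i) (θ j)))
            ≈⟨ ∑-combine h (suc g) (λ k → x k * X k (θ i) (θ j)) ⟨
          ∑ (λ k → x k * X k (θ i) (θ j))
            ≈⟨ at-pair i j i≢j ⟩
          0# ∎

      i₀ : Fin H
      i₀ = F.combine {h} {suc g} zero zero

      i₀-degrees : F.remQuot {h} (suc g) i₀ ≡ (zero , zero)
      i₀-degrees = F.remQuot-combine {h} {suc g} zero zero

      s≤w : ∀ i → s i N.≤ w
      s≤w i = N.m≤n⇒m≤1+n (N.*-monoʳ-≤ 2 (N.m≤n⇒m≤1+n (N.≤-trans (N.+-mono-≤ (N.<⇒≤ (F.toℕ<n (proj₁ (F.remQuot {h} (suc g) i))))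
        (N.m≤n⇒m≤1+n (N.<⇒≤ (F.toℕ<n (proj₂ (F.remQuot {h} (suc g) i)))))) (N.≤-reflexive (≡.cong (h N.+_) (≡.sym (N.+-identityʳ h)))))))

      open Elimination H w s s≤w Z Z-deg i₀ (≡.cong (λ r → 2 N.* (toℕ (proj₁ r) N.+ toℕ (proj₂ r))) i₀-degrees) Z-inj

      collision⇒root : ∀ {S μ x y} → Annihilates S → V μ x y → z μ x y ≈ 0# → ev (H N.* w) S μ ≈ 0#
      collision⇒root {S} {μ} {x} {y} ann v z≈0 = ann μ (λ j → X j x y)
        (trans (reflexive (≡.cong (λ r → x ^ toℕ (proj₁ r) * y ^ toℕ (proj₂ r)) i₀-degrees)) (*-identityˡ 1#))
        (λ i → trans (sym (Z-value i w+w (N.+-monoʳ-≤ w (s≤w i)) μ x y v)) (trans (*-congʳ z≈0) (zeroˡ _)))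

      count-bad : ∀ αs → Distinct αs → All (Bad m d a) αs → length αs N.≤ H N.* w
      count-bad αs dist bads = decidable-stable (length αs N.≤? H N.* w) λ ≰ →
        elimination λ { (S , (k , k≤ , Sk≉0) , ann) →
          ¬¬-All (All.map (root S ann) bads) λ roots →
            -- `S k` is the coefficient of index H w - k in the reversed polynomial.
            Sk≉0 (trans (reflexive (≡.cong S (≡.sym (N.m∸[m∸n]≡n k≤))))
              (many-roots⇒0 (H N.* w) (λ k → S (H N.* w N.∸ k)) αs dist roots (N.≰⇒> ≰) (H N.* w N.∸ k) (N.m∸n≤m (H N.* w) k))) }
        where
        ¬¬-All : ∀ {p} {P : Carrier → Set p} {xs} → All (λ x → ¬ ¬ P x) xs → ¬ ¬ All P xs
        ¬¬-All [] k = k []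
        ¬¬-All (p ∷ ps) k = p λ px → ¬¬-All ps λ pxs → k (px ∷ pxs)
        root : ∀ S → Annihilates S → ∀ {α} → Bad m d a α → ¬ ¬ ev (H N.* w) (λ k → S (H N.* w N.∸ k)) α ≈ 0#
        root S ann {α} bad none = let μ , inv = inverse α (proj₁ bad) in
          bad⇒collision inv bad λ { (x , y , v , z≈0) → none (begin
            ev (H N.* w) (λ k → S (H N.* w N.∸ k)) α
              ≈⟨ ev-reverse (H N.* w) S inv ⟩
            α ^ (H N.* w) * ev (H N.* w) S μ
              ≈⟨ trans (*-congˡ (collision⇒root {S} ann v z≈0)) (zeroʳ _) ⟩
            0# ∎) }

    count : (∀ t₁ t₂ → E d t₁ ≈ 0# → E d t₂ ≈ 0# → ¬ t₁ ≈ t₂ → ¬ E m t₁ ≈ E m t₂) →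
      ∀ αs → Distinct αs → All (Bad m d a) αs → length αs N.≤ (h N.* suc g) N.* w
    count separated = let θ , fact = factor h (λ b → coef b 0#) (coef-lead 0#) in Fibre₀.count-bad separated θ fact

-- The bound for m = 2^r (2^l + 1)

open import Data.Nat using (_+_; _*_; _^_; _∸_; _≤_; ⌊_/2⌋)
open import Data.Nat.Combinatorics using (_C_)

theorem3p5 : ∀ {c ℓ : Level} (K : AlgClosureF2 c ℓ) →
    let Carrier = AlgClosureF2.Carrier K
        _≈_ = AlgClosureF2._≈_ K
        0# = AlgClosureF2.0# K
        _^ᴷ_ = AlgClosureF2._^_ K
        Bad = Poly.Bad K
    in ∀ (r l : ℕ) → 2 ≤ r → 1 ≤ l → (gcd r l ≡ 1 ⊎ gcd r l ≡ 2) →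
       let m = (2 ^ r) * ((2 ^ l) + 1)
           d = ⌊ m ∸ 2 /2⌋
           e = ⌊ d ∸ 1 /2⌋ C 2
       in ∀ (n : ℕ) → 1 ≤ n →
          ∀ (a : ℕ → Carrier) →
          (∀ i → i ≤ m → ((a i) ^ᴷ (2 ^ n)) ≈ a i) →
          ¬ (a 0 ≈ 0#) → ¬ (a 1 ≈ 0#) →
          ∀ (αs : List Carrier) →
          AllPairs (λ x y → ¬ (x ≈ y)) αs →
          All (Bad m d a) αs →
          length αs ≤ (5 * d + 4) * e
theorem3p5 K (suc (suc r)) l (s≤s (s≤s z≤n)) 1≤l gcd≡ n 1≤n a _ a₀≉0 a₁≉0 αs distinct bads =
  count′ (2 ^ suc (suc r) * (2 ^ l + 1)) ⌊ 2 ^ suc (suc r) * (2 ^ l + 1) ∸ 2 /2⌋ m≡ d≡ bads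
  where
  open Arithmetic
  open CriticalValues K
  g = Product.proj₁ (3≤factor r l 1≤l)
  δ₀ = suc (2 * suc (suc g))
  suc-d : suc δ₀ ≡ 2 ^ suc r * (2 ^ l + 1)
  suc-d = ≡.trans (≡.sym (N.*-suc 2 (suc (suc g))))
    (≡.trans (≡.cong (2 *_) (≡.sym (Product.proj₂ (3≤factor r l 1≤l)))) (≡.sym (N.*-assoc 2 (2 ^ r) (2 ^ l + 1))))
  m≡ : 2 ^ suc (suc r) * (2 ^ l + 1) ≡ 2 * suc δ₀
  m≡ = ≡.trans (N.*-assoc 2 (2 ^ suc r) (2 ^ l + 1)) (≡.cong (2 *_) (≡.sym suc-d))
  d≡ : ⌊ 2 ^ suc (suc r) * (2 ^ l + 1) ∸ 2 /2⌋ ≡ δ₀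
  d≡ = half-m∸2 δ₀ m≡
  -- m and d become variables so that their equations can be matched with `refl`; the expressions of
  -- the statement do not reduce to 2(δ₀ + 1) and δ₀.
  count′ : ∀ m d → m ≡ 2 * suc δ₀ → d ≡ δ₀ → All (Poly.Bad K m d a) αs → length αs ≤ (5 * d + 4) * (⌊ d ∸ 1 /2⌋ C 2)
  count′ _ _ ≡.refl ≡.refl bads = N.≤-trans
    (Counting.count g a a₀≉0 a₁≉0 (Infinity.values-distinct (suc r) l δ₀ gcd≡ (s≤s z≤n) suc-d) αs distinct bads)
    (count≤bound g δ₀ ≡.refl)
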